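{- Let $K$ be a perfect $A$-field, let $0\to M_1\to M\to M_2\to0$ be an exact sequence of dual $\mathbf t$-motives over $K$, and let $N$ be a dual $\mathbf t$-motive. Then: (i) there is an exact sequence of $\mathbb F_q[t]$-modules $$0\to\operatorname{Hom}_{\mathcal M_t^\vee}(N,M_1)\to\operatorname{Hom}_{\mathcal M_t^\vee}(N,M)\to\operatorname{Hom}_{\mathcal M_t^\vee}(N,M_2)\to\operatorname{Ext}^1_{\mathcal M_t^\vee}(N,M_1)\to\operatorname{Ext}^1_{\mathcal M_t^\vee}(N,M)\to\operatorname{Ext}^1_{\mathcal M_t^\vee}(N,M_2)\to0;$$ (ii) there is an exact sequence of $\mathbb F_q[t]$-modules $$0\to\operatorname{Hom}_{\mathcal M_t^\vee}(M_2,N)\to\operatorname{Hom}_{\mathcal M_t^\vee}(M,N)\to\operatorname{Hom}_{\mathcal M_t^\vee}(M_1,N)\to\operatorname{Ext}^1_{\mathcal M_t^\vee}(M_2,N)\to\operatorname{Ext}^1_{\mathcal M_t^\vee}(M,N)\to\operatorname{Ext}^1_{\mathcal M_t^\vee}(M_1,N)\to0.$$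
   Context: $A=\mathbb F_q[t]$; $K$ a perfect field of characteristic $p$ with $\mathbb F_q$-algebra map $\iota:A\to K$, $\theta=\iota(t)$. $K\{\sigma\}$: twisted polynomials with $\sigma x=x^{q^{ -1}}\sigma$. $K[t,\sigma]$ is the ring generated by $K$, $t$, $\sigma$ with $tc=ct$, $t\sigma=\sigma t$, $\sigma c=c^{q^{ -1}}\sigma$ ($c\in K$). A dual $\mathbf t$-motive is a left $K[t,\sigma]$-module that is free and finitely generated over $K\{\sigma\}$ and such that $(t-\theta)^l(H/\sigma H)=0$ for some $l\in\mathbb N$; morphisms are $K[t,\sigma]$-module homomorphisms, and $\operatorname{Hom}_{\mathcal M_t^\vee}$ denotes the $\mathbb F_q[t]$-module of morphisms. A sequence of dual $\mathbf t$-motives is exact if it is exact as a sequence of $\mathbb F_q[t]$-modules. $\operatorname{Ext}^1_{\mathcal M_t^\vee}(M_2,M_1)$ is the set of (equivalence classes of) short exact sequences $0\to M_1\to M\to M_2\to0$ of dual $\mathbf t$-motives, an $\mathbb F_q[t]$-module under Baer sum with multiplication by $a$ given by pushout along multiplication by $a$ on $M_1$. -}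

module Defs where

open import Algebra.Apartness.Bundles using (HeytingField; HeytingCommutativeRing)
open import Algebra.Bundles using (Ring; CommutativeRing; AbelianGroup; CommutativeMonoid)
open import Algebra.Module.Bundles using (LeftModule)
open import Algebra.Module.Bundles.Raw using (RawLeftModule)
import Algebra.Module.Construct.DirectProduct as DirectProduct
import Algebra.Module.Morphism.Construct.Composition as ModuleComposition
import Algebra.Module.Morphism.Construct.Identity as ModuleIdentity
import Algebra.Module.Morphism.LeftModuleMonomorphism as LeftModuleMonomorphism
open import Algebra.Module.Morphism.Structures using (IsLeftModuleHomomorphism; IsLeftModuleIsomorphism)
open import Algebra.Module.Structures using (IsPreleftSemimodule)
open import Algebra.Morphism.Bundles using (RingHomomorphism)
import Algebra.Morphism.Construct.Composition as RingComposition
import Algebra.Morphism.Construct.Identity as RingIdentity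
import Algebra.Properties.AbelianGroup as AbelianGroupProperties
import Algebra.Properties.CommutativeMonoid.Sum as Sum
import Algebra.Properties.CommutativeSemigroup as CommutativeSemigroupProperties
import Algebra.Properties.CommutativeSemiring.Binomial as Binomial
import Algebra.Properties.CommutativeSemiring.Exp as CommutativeExp
import Algebra.Properties.Group as GroupProperties
import Algebra.Properties.Ring as RingProperties
import Algebra.Properties.Semiring.Exp as SemiringExp
import Algebra.Properties.Semiring.Mult as Mult
open import Algebra.Structures using (IsAbelianGroup; IsCommutativeMonoid)
open import Data.Empty using (⊥-elim)
open import Data.Fin.Base as Fin using (Fin; zero; suc; fromℕ; punchIn; _↑ˡ_; _↑ʳ_; splitAt; join)
import Data.Fin.Permutation as Perm
import Data.Fin.Properties as Fin
open import Data.List.Base as List using (List; []; _∷_)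
open import Data.Nat.Base as ℕ using (ℕ; zero; suc; _∸_; _!)
open import Data.Nat.Combinatorics using (nCk≡n!/k![n-k]!; k![n∸k]!∣n!; nCk≡nC[n∸k]; nCn≡1) renaming (_C_ to _choose_)
open import Data.Nat.Divisibility as ∣ using (_∣_; divides)
open import Data.Nat.DivMod using (m/n*n≡m)
open import Data.Nat.Primality using (Prime; euclidsLemma; prime⇒nonZero; prime⇒nonTrivial)
import Data.Nat.Properties as ℕ
open import Data.Product.Base using (Σ; ∃; _×_; _,_; proj₁; proj₂)
open import Data.Sum.Base using (_⊎_; inj₁; inj₂)
open import Data.Vec.Functional using (removeAt; replicate; _++_)
open import Data.Vec.Functional.Properties using (lookup-++ˡ; lookup-++ʳ)
open import Function.Base using (_∘_)
open import Function.Bundles using (Bijection; Equivalence; _⇔_; mk⇔)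
open import Function.Definitions using (Injective; Surjective; Bijective)
open import Level using (Level; _⊔_) renaming (suc to lsuc)
open import Relation.Binary.PropositionalEquality as ≡ using (_≡_)
import Relation.Binary.Reasoning.Setoid as SetoidReasoning
open import Relation.Nullary using (¬_; Dec; yes; no)
open import Relation.Nullary.Decidable using (map′)

private
  variable
    c d ℓ ℓ₁ ℓ₂ r s ℓr m m₁ m₂ m₃ ℓm ℓm₁ ℓm₂ ℓm₃ : Level

fieldRing : HeytingField c ℓ₁ ℓ₂ → CommutativeRing c ℓ₁
fieldRing K = HeytingCommutativeRing.commutativeRing (HeytingField.heytingCommutativeRing K)

module _ (K : HeytingField c ℓ₁ ℓ₂) where
  open CommutativeRing (fieldRing K)
  open CommutativeExp commutativeSemiring using (_^_)
  open Mult semiring renaming (_×_ to _·_)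

  HasCardinality : ℕ → Set _
  HasCardinality q = Bijection (≡.setoid (Fin q)) setoid

  HasCharacteristic : ℕ → Set _
  HasCharacteristic p = Prime p × p · 1# ≈ 0#

  IsPerfect : ℕ → Set _
  IsPerfect p = Bijective _≈_ _≈_ (_^ p)

-- Multiplication by x ≠ 0 permutes the nonzero elements of a finite field, so x^(q-1) = 1 and x^q = x.
-- This is what makes 𝔽_q central in K{σ}.
module _ (F : HeytingField c ℓ₁ ℓ₂) where
  private
    module F = HeytingField F
  open CommutativeRing (fieldRing F) hiding (zero)
  open CommutativeExp commutativeSemiring using (_^_; ^-congˡ)
  open RingProperties ring using (x[y-z]≈xy-xz; x∙y⁻¹≈ε⇒x≈y)
  open Sum *-commutativeMonoid using ()
    renaming (sum to Π; sum-cong-≋ to Π-cong; ∑-distrib-+ to Π-distrib-*; ∑-permute to Π-permute; sum-remove to Π-remove; sum-replicate to Π-replicate)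
  open SetoidReasoning setoid

  x^q≈x : ∀ q → HasCardinality F q → ∀ x → x ^ q ≈ x
  x^q≈x zero    enum x with () ← proj₁ (Bijection.surjective enum x)
  x^q≈x (suc n) enum x = result (x ≟ 0#)
    where
    e : Fin (suc n) → Carrier
    e = Bijection.to enum

    index : Carrier → Fin (suc n)
    index = Bijection.to⁻ enum

    e-index : ∀ y → e (index y) ≈ y
    e-index y = proj₂ (Bijection.strictlySurjective enum y)

    e-injective : ∀ {i j} → e i ≈ e j → i ≡ j
    e-injective = Bijection.injective enum

    _≟_ : ∀ y z → Dec (y ≈ z)
    y ≟ z = map′
      (λ eq → trans (sym (e-index y)) (trans (reflexive (≡.cong e eq)) (e-index z)))
      (λ y≈z → e-injective (trans (e-index y) (trans y≈z (sym (e-index z)))))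
      (index y Fin.≟ index z)

    stable : ∀ {y z} → ¬ ¬ (y ≈ z) → y ≈ z
    stable {y} {z} ¬¬eq with y ≟ z
    ... | yes eq = eq
    ... | no neq = ⊥-elim (¬¬eq neq)

    inverse⇒ : ∀ {y} → ¬ y ≈ 0# → ¬ ¬ (∃ λ u → u * y ≈ 1#)
    inverse⇒ {y} y≉0 k = y≉0 (proj₁ (F.tight y 0#) λ y#0 →
      let u , uy≈1 , _ = F.#⇒invertible y#0
      in k (u , trans (*-congˡ (sym (trans (+-congˡ (RingProperties.-0#≈0# ring)) (+-identityʳ y)))) uy≈1))

    cancel₀ : ∀ {y z} → ¬ y ≈ 0# → y * z ≈ 0# → z ≈ 0#
    cancel₀ {y} {z} y≉0 yz≈0 = stable λ z≉0 → inverse⇒ y≉0 λ (u , uy≈1) → z≉0 (begin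
      z            ≈⟨ *-identityˡ z ⟨
      1# * z       ≈⟨ *-congʳ uy≈1 ⟨
      u * y * z    ≈⟨ *-assoc u y z ⟩
      u * (y * z)  ≈⟨ *-congˡ yz≈0 ⟩
      u * 0#       ≈⟨ zeroʳ u ⟩
      0#           ∎)

    1-0≈1 : 1# - 0# ≈ 1#
    1-0≈1 = trans (+-congˡ (RingProperties.-0#≈0# ring)) (+-identityʳ 1#)

    1≉0 : ¬ 1# ≈ 0#
    1≉0 1≈0 = proj₂ (F.tight 1# 0#) 1≈0
      (F.invertible⇒# (1# , trans (*-identityˡ _) 1-0≈1 , trans (*-identityʳ _) 1-0≈1))

    pick : Carrier → Carrier → Carrier
    pick a y with y ≟ 0#
    ... | yes _ = 1#
    ... | no  _ = a

    pick-≈0 : ∀ {a y} → y ≈ 0# → pick a y ≈ 1#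
    pick-≈0 {a} {y} y≈0 with y ≟ 0#
    ... | yes _   = refl
    ... | no  y≉0 = ⊥-elim (y≉0 y≈0)

    pick-≉0 : ∀ {a y} → ¬ y ≈ 0# → pick a y ≈ a
    pick-≉0 {a} {y} y≉0 with y ≟ 0#
    ... | yes y≈0 = ⊥-elim (y≉0 y≈0)
    ... | no  _   = refl

    g : Carrier → Carrier
    g y = pick y y

    g≉0 : ∀ y → ¬ g y ≈ 0#
    g≉0 y with y ≟ 0#
    ... | yes _   = 1≉0
    ... | no  y≉0 = y≉0

    g-cong : ∀ {y z} → y ≈ z → g y ≈ g z
    g-cong {y} {z} y≈z with z ≟ 0#
    ... | yes z≈0 = pick-≈0 (trans y≈z z≈0)
    ... | no  z≉0 = trans (pick-≉0 λ y≈0 → z≉0 (trans (sym y≈z) y≈0)) y≈z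

    Π≉0 : ∀ {k} (t : Fin k → Carrier) → (∀ i → ¬ t i ≈ 0#) → ¬ Π t ≈ 0#
    Π≉0 {zero}  t t≉0 = 1≉0
    Π≉0 {suc k} t t≉0 eq = Π≉0 (t ∘ suc) (t≉0 ∘ suc) (cancel₀ (t≉0 zero) eq)

    nonzero : ¬ x ≈ 0# → (∃ λ u → u * x ≈ 1#) → x ^ suc n ≈ x
    nonzero x≉0 (u , ux≈1) = begin
      x * x ^ n                        ≈⟨ *-congˡ (Π-replicate n) ⟨
      x * Π (replicate n x)            ≈⟨ *-congˡ (Π-cong {n} λ j → pick-≉0 (others j)) ⟨
      x * Π (removeAt h i₀)            ≈⟨ *-congˡ (*-identityˡ _) ⟨
      x * (1# * Π (removeAt h i₀))     ≈⟨ *-congˡ (*-congʳ (pick-≈0 (e-index 0#))) ⟨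
      x * (h i₀ * Π (removeAt h i₀))   ≈⟨ *-congˡ (Π-remove h) ⟨
      x * Π h                          ≈⟨ *-congˡ Πh≈1 ⟩
      x * 1#                           ≈⟨ *-identityʳ x ⟩
      x                                ∎
      where
      h : Fin (suc n) → Carrier
      h i = pick x (e i)

      i₀ : Fin (suc n)
      i₀ = index 0#

      others : ∀ j → ¬ e (punchIn i₀ j) ≈ 0#
      others j eq = Fin.punchInᵢ≢i i₀ j (e-injective (trans eq (sym (e-index 0#))))

      to from : Fin (suc n) → Fin (suc n)
      to i = index (x * e i)
      from i = index (u * e i)

      undo : ∀ {a b} → a * b ≈ 1# → ∀ i → index (a * e (index (b * e i))) ≡ i
      undo {a} {b} ab≈1 i = e-injective (begin
        e (index (a * e (index (b * e i))))  ≈⟨ e-index _ ⟩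
        a * e (index (b * e i))              ≈⟨ *-congˡ (e-index _) ⟩
        a * (b * e i)                        ≈⟨ *-assoc a b _ ⟨
        a * b * e i                          ≈⟨ *-congʳ ab≈1 ⟩
        1# * e i                             ≈⟨ *-identityˡ _ ⟩
        e i                                  ∎)

      π : Perm.Permutation′ (suc n)
      π = Perm.permutation to from (undo (trans (*-comm x u) ux≈1)) (undo ux≈1)

      g-* : ∀ y → g (x * y) ≈ pick x y * g y
      g-* y with y ≟ 0#
      ... | yes y≈0 = trans (pick-≈0 (trans (*-congˡ y≈0) (zeroʳ x))) (sym (*-identityˡ 1#))
      ... | no  y≉0 = pick-≉0 λ xy≈0 → y≉0 (cancel₀ x≉0 xy≈0)

      P : Carrier
      P = Π (g ∘ e)

      P≈ΠhP : P ≈ Π h * P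
      P≈ΠhP = begin
        P                            ≈⟨ Π-permute (g ∘ e) π ⟩
        Π (λ i → g (e (to i)))       ≈⟨ Π-cong (λ i → trans (g-cong (e-index _)) (g-* (e i))) ⟩
        Π (λ i → h i * g (e i))      ≈⟨ Π-distrib-* h (g ∘ e) ⟩
        Π h * P                      ∎

      Πh≈1 : Π h ≈ 1#
      Πh≈1 = x∙y⁻¹≈ε⇒x≈y _ _ (cancel₀ (Π≉0 (g ∘ e) (g≉0 ∘ e)) (begin
        P * (Π h - 1#)       ≈⟨ x[y-z]≈xy-xz P (Π h) 1# ⟩
        P * Π h - P * 1#     ≈⟨ +-cong (trans (*-comm P _) (sym P≈ΠhP)) (-‿cong (*-identityʳ P)) ⟩
        P - P                ≈⟨ -‿inverseʳ P ⟩
        0#                   ∎))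

    result : Dec (x ≈ 0#) → x ^ suc n ≈ x
    result (yes x≈0) = trans (*-congʳ x≈0) (trans (zeroˡ _) (sym x≈0))
    result (no  x≉0) = stable λ ≉ → inverse⇒ x≉0 (≉ ∘ nonzero x≉0)

-- p divides the binomial coefficients (p choose k), 0 < k < p, so x ↦ x^p is additive in characteristic p.
private
  p∤k! : ∀ {p} → Prime p → ∀ k → k ℕ.< p → ¬ p ∣ k !
  p∤k! {p} pr zero k<p p∣1 =
    ℕ.nonTrivial⇒≢1 ⦃ prime⇒nonTrivial pr ⦄ (∣.∣1⇒≡1 p∣1)
  p∤k! pr (suc k) k<p p∣ with euclidsLemma (suc k) (k !) pr p∣
  ... | inj₁ p∣1+k = ℕ.<⇒≱ k<p (∣.∣⇒≤ p∣1+k)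
  ... | inj₂ p∣k!  = p∤k! pr k (ℕ.<-trans (ℕ.n<1+n k) k<p) p∣k!

  p∣pCk : ∀ {p} → Prime p → ∀ k → 0 ℕ.< k → k ℕ.< p → p ∣ p choose k
  p∣pCk {p@(suc p-1)} pr k 0<k k<p = cases (euclidsLemma (p choose k) (k ! ℕ.* (p ∸ k) !) pr p∣product)
    where
    p∣product : p ∣ (p choose k) ℕ.* (k ! ℕ.* (p ∸ k) !)
    p∣product = ≡.subst (p ∣_)
      (≡.sym (≡.trans (≡.cong (ℕ._* (k ! ℕ.* (p ∸ k) !)) (nCk≡n!/k![n-k]! (ℕ.<⇒≤ k<p)))
                      (m/n*n≡m ⦃ k ℕ.!* (p ∸ k) !≢0 ⦄ (k![n∸k]!∣n! (ℕ.<⇒≤ k<p)))))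
      (∣.m∣m*n (p-1 !))

    cases : p ∣ p choose k ⊎ p ∣ k ! ℕ.* (p ∸ k) ! → p ∣ p choose k
    cases (inj₁ p∣pCk) = p∣pCk
    cases (inj₂ p∣k![p-k]!) with euclidsLemma (k !) ((p ∸ k) !) pr p∣k![p-k]!
    ... | inj₁ p∣k!     = ⊥-elim (p∤k! pr k k<p p∣k!)
    ... | inj₂ p∣[p-k]! = ⊥-elim (p∤k! pr (p ∸ k) (ℕ.∸-monoʳ-< 0<k (ℕ.<⇒≤ k<p)) p∣[p-k]!)

module _ {c ℓ} (R : CommutativeRing c ℓ) {p : ℕ} (pr : Prime p) where
  open CommutativeRing R hiding (zero)
  open CommutativeExp commutativeSemiring
  open Mult semiring renaming (_×_ to _·_)
  open Sum +-commutativeMonoid using (sum; sum-cong-≋; sum-replicate-zero; sum-init-last)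
  open SetoidReasoning setoid

  module _ (char : p · 1# ≈ 0#) where
    private
      p∣⇒≈0 : ∀ {n} → p ∣ n → ∀ x → n · x ≈ 0#
      p∣⇒≈0 {n} (divides k n≡k*p) x = begin
        n · x               ≈⟨ ×-congˡ n≡k*p ⟩
        (k ℕ.* p) · x       ≈⟨ ×-assocˡ x k p ⟨
        k · (p · x)         ≈⟨ ×-congʳ k (×-congʳ p (*-identityˡ x)) ⟨
        k · (p · (1# * x))  ≈⟨ ×-congʳ k (×-assoc-* p 1# x) ⟨
        k · (p · 1# * x)    ≈⟨ ×-congʳ k (trans (*-congʳ char) (zeroˡ x)) ⟩
        k · 0#              ≈⟨ ×-congʳ k (zeroʳ 0#) ⟨
        k · (0# * 0#)       ≈⟨ ×-comm-* k 0# 0# ⟨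
        0# * (k · 0#)       ≈⟨ zeroˡ _ ⟩
        0#                  ∎

    ^p-homo-+ : ∀ x y → (x + y) ^ p ≈ x ^ p + y ^ p
    ^p-homo-+ x y = go p ≡.refl
      where
      go : ∀ q → q ≡ p → (x + y) ^ q ≈ x ^ q + y ^ q
      go zero 0≡p = ⊥-elim (ℕ.≢-nonZero⁻¹ p ⦃ prime⇒nonZero pr ⦄ (≡.sym 0≡p))
      go (suc n) ≡.refl = begin
        (x + y) ^ suc n                                  ≈⟨ Binomial.theorem commutativeSemiring (suc n) x y ⟩
        term zero + sum (term ∘ suc)                     ≈⟨ +-congˡ (sum-init-last (term ∘ suc)) ⟩
        term zero + (sum middle + term (fromℕ (suc n)))  ≈⟨ +-cong first (+-cong middle≈0 last) ⟩
        y ^ suc n + (0# + x ^ suc n)                     ≈⟨ +-congˡ (+-identityˡ _) ⟩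
        y ^ suc n + x ^ suc n                            ≈⟨ +-comm _ _ ⟩
        x ^ suc n + y ^ suc n                            ∎
        where
        term : Fin (suc (suc n)) → Carrier
        term = Binomial.binomialTerm commutativeSemiring x y (suc n)

        middle : Fin n → Carrier
        middle i = term (suc (Fin.inject₁ i))

        middle≈0 : sum middle ≈ 0#
        middle≈0 = trans
          (sum-cong-≋ {n} λ i → p∣⇒≈0 (p∣pCk pr _ (ℕ.s≤s ℕ.z≤n)
             (ℕ.s≤s (≡.subst (ℕ._< n) (≡.sym (Fin.toℕ-inject₁ i)) (Fin.toℕ<n i)))) _)
          (sum-replicate-zero n)

        first : term zero ≈ y ^ suc n
        first = trans (×-congˡ {x = 1# * y ^ suc n} (nC0 (suc n))) (trans (×-homo-1 _) (*-identityˡ _))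
          where
          nC0 : ∀ m → m choose 0 ≡ 1
          nC0 m = ≡.trans (nCk≡nC[n∸k] {0} {m} ℕ.z≤n) (nCn≡1 m)

        last : term (fromℕ (suc n)) ≈ x ^ suc n
        last = begin
          term (fromℕ (suc n))  ≡⟨ ≡.cong (λ k → (suc n choose k) · (x ^ k * y ^ (suc n ∸ k))) (Fin.toℕ-fromℕ (suc n)) ⟩
          (suc n choose suc n) · (x ^ suc n * y ^ (n ∸ n))  ≈⟨ ×-congˡ (nCn≡1 (suc n)) ⟩
          1 · (x ^ suc n * y ^ (n ∸ n))               ≈⟨ ×-homo-1 _ ⟩
          x ^ suc n * y ^ (n ∸ n)                     ≈⟨ *-congˡ (^-congʳ y (ℕ.n∸n≡0 n)) ⟩
          x ^ suc n * 1#                              ≈⟨ *-identityʳ _ ⟩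
          x ^ suc n                                   ∎

infix 2 _⟶ᴿ_

_⟶ᴿ_ : Ring c ℓ₁ → Ring d ℓ₂ → Set _
R ⟶ᴿ S = RingHomomorphism (Ring.rawRing R) (Ring.rawRing S)

module _ {R : Ring c ℓ₁} {S : Ring d ℓ₂} where
  private
    module R = Ring R
  open Ring S

  mkRingHom : (f : R.Carrier → Carrier) →
              (∀ {x y} → x R.≈ y → f x ≈ f y) →
              (∀ x y → f (x R.+ y) ≈ f x + f y) →
              (∀ x y → f (x R.* y) ≈ f x * f y) →
              f R.1# ≈ 1# →
              R ⟶ᴿ S
  mkRingHom f f-cong f-+ f-* f-1 = record
    { ⟦_⟧ = f
    ; isRingHomomorphism = record
      { isSemiringHomomorphism = record
        { isNearSemiringHomomorphism = record
          { +-isMonoidHomomorphism = record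
            { isMagmaHomomorphism = record
              { isRelHomomorphism = record { cong = f-cong }
              ; homo = f-+
              }
            ; ε-homo = f-0
            }
          ; *-homo = f-*
          }
        ; 1#-homo = f-1
        }
      ; -‿homo = λ x → GroupProperties.inverseʳ-unique +-group _ _
          (trans (sym (f-+ x (R.- x))) (trans (f-cong (R.-‿inverseʳ x)) f-0))
      }
    }
    where
    f-0 : f R.0# ≈ 0#
    f-0 = RingProperties.+-cancelʳ S (f R.0#) _ _
      (trans (sym (f-+ R.0# R.0#)) (trans (f-cong (R.+-identityʳ R.0#)) (sym (+-identityˡ _))))

idᴿ : (R : Ring c ℓ) → R ⟶ᴿ R
idᴿ R = record { isRingHomomorphism = RingIdentity.isRingHomomorphism (Ring.rawRing R) (Ring.refl R) }

infixr 9 _∘ᴿ_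

_∘ᴿ_ : ∀ {c₁ c₂ c₃ l₁ l₂ l₃} {R : Ring c₁ l₁} {S : Ring c₂ l₂} {T : Ring c₃ l₃} → S ⟶ᴿ T → R ⟶ᴿ S → R ⟶ᴿ T
_∘ᴿ_ {T = T} g f = record
  { isRingHomomorphism = RingComposition.isRingHomomorphism (Ring.trans T)
      (RingHomomorphism.isRingHomomorphism f) (RingHomomorphism.isRingHomomorphism g) }

-- The automorphism x ↦ x^(1/q) of a perfect field of characteristic p, for q = p^e
module QthRoot (K : HeytingField c ℓ₁ ℓ₂) {p : ℕ} (char : HasCharacteristic K p) (perfect : IsPerfect K p) where
  open CommutativeRing (fieldRing K)
  open CommutativeExp commutativeSemiring
  open SetoidReasoning setoid

  ^p^suc : ∀ e x → x ^ (p ℕ.^ suc e) ≈ (x ^ p) ^ (p ℕ.^ e)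
  ^p^suc e x = sym (^-assocʳ x p (p ℕ.^ e))

  root : ℕ → Carrier → Carrier
  root zero    x = x
  root (suc e) x = proj₁ (proj₂ perfect (root e x))

  root-^ : ∀ e x → root e x ^ (p ℕ.^ e) ≈ x
  root-^ zero    x = *-identityʳ x
  root-^ (suc e) x = begin
    root (suc e) x ^ (p ℕ.^ suc e)    ≈⟨ ^p^suc e _ ⟩
    (root (suc e) x ^ p) ^ (p ℕ.^ e)  ≈⟨ ^-congˡ (p ℕ.^ e) (proj₂ (proj₂ perfect (root e x)) refl) ⟩
    root e x ^ (p ℕ.^ e)              ≈⟨ root-^ e x ⟩
    x                                 ∎

  ^-injective : ∀ e → Injective _≈_ _≈_ (_^ (p ℕ.^ e))
  ^-injective zero    eq = trans (sym (*-identityʳ _)) (trans eq (*-identityʳ _))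
  ^-injective (suc e) eq = proj₁ perfect (^-injective e (trans (sym (^p^suc e _)) (trans eq (^p^suc e _))))

  ^-homo-+ : ∀ e x y → (x + y) ^ (p ℕ.^ e) ≈ x ^ (p ℕ.^ e) + y ^ (p ℕ.^ e)
  ^-homo-+ zero    x y = trans (*-identityʳ _) (sym (+-cong (*-identityʳ x) (*-identityʳ y)))
  ^-homo-+ (suc e) x y = begin
    (x + y) ^ (p ℕ.^ suc e)                          ≈⟨ ^p^suc e _ ⟩
    ((x + y) ^ p) ^ (p ℕ.^ e)                        ≈⟨ ^-congˡ (p ℕ.^ e) (^p-homo-+ (fieldRing K) (proj₁ char) (proj₂ char) x y) ⟩
    (x ^ p + y ^ p) ^ (p ℕ.^ e)                      ≈⟨ ^-homo-+ e _ _ ⟩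
    (x ^ p) ^ (p ℕ.^ e) + (y ^ p) ^ (p ℕ.^ e)        ≈⟨ +-cong (^p^suc e x) (^p^suc e y) ⟨
    x ^ (p ℕ.^ suc e) + y ^ (p ℕ.^ suc e)            ∎

  1^n≈1 : ∀ n → 1# ^ n ≈ 1#
  1^n≈1 zero    = refl
  1^n≈1 (suc n) = trans (*-identityˡ _) (1^n≈1 n)

  root-unique : ∀ e {x y} → y ^ (p ℕ.^ e) ≈ x → root e x ≈ y
  root-unique e y^q≈x = ^-injective e (trans (root-^ e _) (sym y^q≈x))

  rootHom : ℕ → ring ⟶ᴿ ring
  rootHom e = mkRingHom {R = ring} {S = ring} (root e)
    (λ {x} {y} x≈y → root-unique e (trans (root-^ e y) (sym x≈y)))
    (λ x y → root-unique e (trans (^-homo-+ e _ _) (+-cong (root-^ e x) (root-^ e y))))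
    (λ x y → root-unique e (trans (^-distrib-* _ _ (p ℕ.^ e)) (*-cong (root-^ e x) (root-^ e y))))
    (root-unique e (1^n≈1 (p ℕ.^ e)))

-- The skew polynomial ring R[X; φ], in which X r = φ(r) X
module SkewPolynomials (R : Ring c ℓ) (φ : R ⟶ᴿ R) where
  open Ring R hiding (zero)
  open RingHomomorphism φ using (⟦_⟧; ⟦⟧-cong; +-homo; *-homo; 0#-homo; 1#-homo)
  open RingProperties R using (-0#≈0#)
  open CommutativeSemigroupProperties (CommutativeMonoid.commutativeSemigroup +-commutativeMonoid)
    using (interchange)

  -- a₀ ∷ a₁ ∷ … ∷ aₙ ∷ [] stands for a₀ + a₁ X + … + aₙ Xⁿ; trailing zeros are immaterial.
  Poly : Set c
  Poly = List Carrier

  coeff : Poly → ℕ → Carrier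
  coeff []      n       = 0#
  coeff (a ∷ f) zero    = a
  coeff (a ∷ f) (suc n) = coeff f n

  infix  4 _≈ₚ_
  infixl 6 _+ₚ_
  infixl 7 _·ₚ_ _*ₚ_

  -- A record, so that f and g can be inferred from f ≈ₚ g.
  record _≈ₚ_ (f g : Poly) : Set ℓ where
    constructor coeffwise
    field at : ∀ n → coeff f n ≈ coeff g n
  open _≈ₚ_

  _+ₚ_ : Poly → Poly → Poly
  []      +ₚ g       = g
  (a ∷ f) +ₚ []      = a ∷ f
  (a ∷ f) +ₚ (b ∷ g) = (a + b) ∷ (f +ₚ g)

  -ₚ_ : Poly → Poly
  -ₚ_ = List.map (-_)

  _·ₚ_ : Carrier → Poly → Poly
  a ·ₚ f = List.map (a *_) f

  X·_ : Poly → Poly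
  X· f = 0# ∷ List.map ⟦_⟧ f

  _*ₚ_ : Poly → Poly → Poly
  []      *ₚ g = []
  (a ∷ f) *ₚ g = a ·ₚ g +ₚ f *ₚ (X· g)

  1ₚ : Poly
  1ₚ = 1# ∷ []

  X : Poly
  X = 0# ∷ 1# ∷ []

  private
    ≈ₚ-refl : ∀ {f} → f ≈ₚ f
    ≈ₚ-refl .at n = refl

    ≈ₚ-sym : ∀ {f g} → f ≈ₚ g → g ≈ₚ f
    ≈ₚ-sym p .at n = sym (at p n)

    ≈ₚ-trans : ∀ {f g h} → f ≈ₚ g → g ≈ₚ h → f ≈ₚ h
    ≈ₚ-trans p q .at n = trans (at p n) (at q n)

    ∷-cong : ∀ {a b f g} → a ≈ b → f ≈ₚ g → a ∷ f ≈ₚ b ∷ g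
    ∷-cong p q .at zero    = p
    ∷-cong p q .at (suc n) = at q n

    0∷[] : 0# ∷ [] ≈ₚ []
    0∷[] .at zero    = refl
    0∷[] .at (suc n) = refl

    coeff-+ : ∀ f g n → coeff (f +ₚ g) n ≈ coeff f n + coeff g n
    coeff-+ []      g       n       = sym (+-identityˡ _)
    coeff-+ (a ∷ f) []      n       = sym (+-identityʳ _)
    coeff-+ (a ∷ f) (b ∷ g) zero    = refl
    coeff-+ (a ∷ f) (b ∷ g) (suc n) = coeff-+ f g n

    coeff-map : ∀ (h : Carrier → Carrier) → h 0# ≈ 0# → ∀ f n → coeff (List.map h f) n ≈ h (coeff f n)
    coeff-map h h0 []      n       = sym h0
    coeff-map h h0 (a ∷ f) zero    = refl
    coeff-map h h0 (a ∷ f) (suc n) = coeff-map h h0 f n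

    coeff-neg : ∀ f n → coeff (-ₚ f) n ≈ - coeff f n
    coeff-neg = coeff-map -_ -0#≈0#

    coeff-· : ∀ a f n → coeff (a ·ₚ f) n ≈ a * coeff f n
    coeff-· a = coeff-map (a *_) (zeroʳ a)

    coeff-φ : ∀ f n → coeff (List.map ⟦_⟧ f) n ≈ ⟦ coeff f n ⟧
    coeff-φ = coeff-map ⟦_⟧ 0#-homo

    +-congₚ : ∀ {f f′ g g′} → f ≈ₚ f′ → g ≈ₚ g′ → f +ₚ g ≈ₚ f′ +ₚ g′
    +-congₚ {f} {f′} {g} {g′} p q .at n =
      trans (coeff-+ f g n) (trans (+-cong (at p n) (at q n)) (sym (coeff-+ f′ g′ n)))

    +-assocₚ : ∀ f g h → (f +ₚ g) +ₚ h ≈ₚ f +ₚ (g +ₚ h)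
    +-assocₚ f g h .at n = trans (coeff-+ (f +ₚ g) h n) (trans (+-congʳ (coeff-+ f g n))
      (trans (+-assoc _ _ _) (sym (trans (coeff-+ f (g +ₚ h) n) (+-congˡ (coeff-+ g h n))))))

    +-commₚ : ∀ f g → f +ₚ g ≈ₚ g +ₚ f
    +-commₚ f g .at n = trans (coeff-+ f g n) (trans (+-comm _ _) (sym (coeff-+ g f n)))

    +-identityʳₚ : ∀ f → f +ₚ [] ≈ₚ f
    +-identityʳₚ f .at n = trans (coeff-+ f [] n) (+-identityʳ _)

    -‿congₚ : ∀ {f g} → f ≈ₚ g → -ₚ f ≈ₚ -ₚ g
    -‿congₚ {f} {g} p .at n = trans (coeff-neg f n) (trans (-‿cong (at p n)) (sym (coeff-neg g n)))

    -‿inverseˡₚ : ∀ f → -ₚ f +ₚ f ≈ₚ []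
    -‿inverseˡₚ f .at n = trans (coeff-+ (-ₚ f) f n) (trans (+-congʳ (coeff-neg f n)) (-‿inverseˡ _))

    -‿inverseʳₚ : ∀ f → f +ₚ -ₚ f ≈ₚ []
    -‿inverseʳₚ f .at n = trans (coeff-+ f (-ₚ f) n) (trans (+-congˡ (coeff-neg f n)) (-‿inverseʳ _))

    +ₚ-isAbelianGroup : IsAbelianGroup _≈ₚ_ _+ₚ_ [] -ₚ_
    +ₚ-isAbelianGroup = record
      { isGroup = record
        { isMonoid = record
          { isSemigroup = record
            { isMagma = record
              { isEquivalence = record { refl = ≈ₚ-refl; sym = ≈ₚ-sym; trans = ≈ₚ-trans }
              ; ∙-cong = +-congₚ
              }
            ; assoc = +-assocₚ
            }
          ; identity = (λ f → ≈ₚ-refl) , +-identityʳₚ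
          }
        ; inverse = -‿inverseˡₚ , -‿inverseʳₚ
        ; ⁻¹-cong = -‿congₚ
        }
      ; comm = +-commₚ
      }

    +ₚ-abelianGroup : AbelianGroup c ℓ
    +ₚ-abelianGroup = record { isAbelianGroup = +ₚ-isAbelianGroup }

    open CommutativeSemigroupProperties (AbelianGroup.commutativeSemigroup +ₚ-abelianGroup) using ()
      renaming (interchange to interchangeₚ)

    polySetoid = AbelianGroup.setoid +ₚ-abelianGroup
    open SetoidReasoning polySetoid

    +ₚ-identityˡ′ : ∀ {f g} → f ≈ₚ [] → f +ₚ g ≈ₚ g
    +ₚ-identityˡ′ p = +-congₚ p ≈ₚ-refl

    ·-cong : ∀ {a b f g} → a ≈ b → f ≈ₚ g → a ·ₚ f ≈ₚ b ·ₚ g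
    ·-cong {a} {b} {f} {g} p q .at n = trans (coeff-· a f n) (trans (*-cong p (at q n)) (sym (coeff-· b g n)))

    ·-zeroˡ : ∀ {a} f → a ≈ 0# → a ·ₚ f ≈ₚ []
    ·-zeroˡ {a} f p .at n = trans (coeff-· a f n) (trans (*-congʳ p) (zeroˡ _))

    ·-identity : ∀ f → 1# ·ₚ f ≈ₚ f
    ·-identity f .at n = trans (coeff-· 1# f n) (*-identityˡ _)

    ·-assoc : ∀ a b f → (a * b) ·ₚ f ≈ₚ a ·ₚ (b ·ₚ f)
    ·-assoc a b f .at n = trans (coeff-· (a * b) f n) (trans (*-assoc _ _ _)
      (sym (trans (coeff-· a (b ·ₚ f) n) (*-congˡ (coeff-· b f n)))))

    ·-distribˡ : ∀ a f g → a ·ₚ (f +ₚ g) ≈ₚ a ·ₚ f +ₚ a ·ₚ g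
    ·-distribˡ a f g .at n = trans (coeff-· a (f +ₚ g) n) (trans (*-congˡ (coeff-+ f g n))
      (trans (distribˡ _ _ _) (sym (trans (coeff-+ (a ·ₚ f) (a ·ₚ g) n) (+-cong (coeff-· a f n) (coeff-· a g n))))))

    ·-distribʳ : ∀ a b f → (a + b) ·ₚ f ≈ₚ a ·ₚ f +ₚ b ·ₚ f
    ·-distribʳ a b f .at n = trans (coeff-· (a + b) f n)
      (trans (distribʳ _ _ _) (sym (trans (coeff-+ (a ·ₚ f) (b ·ₚ f) n) (+-cong (coeff-· a f n) (coeff-· b f n)))))

    X-cong : ∀ {f g} → f ≈ₚ g → X· f ≈ₚ X· g
    X-cong {f} {g} p .at zero    = refl
    X-cong {f} {g} p .at (suc n) = trans (coeff-φ f n) (trans (⟦⟧-cong (at p n)) (sym (coeff-φ g n)))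

    X-+ : ∀ f g → X· (f +ₚ g) ≈ₚ X· f +ₚ X· g
    X-+ f g .at zero    = sym (+-identityˡ 0#)
    X-+ f g .at (suc n) = trans (coeff-φ (f +ₚ g) n) (trans (⟦⟧-cong (coeff-+ f g n)) (trans (+-homo _ _)
      (sym (trans (coeff-+ (List.map ⟦_⟧ f) (List.map ⟦_⟧ g) n) (+-cong (coeff-φ f n) (coeff-φ g n))))))

    X-· : ∀ a f → X· (a ·ₚ f) ≈ₚ ⟦ a ⟧ ·ₚ (X· f)
    X-· a f .at zero    = sym (zeroʳ _)
    X-· a f .at (suc n) = trans (coeff-φ (a ·ₚ f) n) (trans (⟦⟧-cong (coeff-· a f n)) (trans (*-homo _ _)
      (sym (trans (coeff-· ⟦ a ⟧ (List.map ⟦_⟧ f) n) (*-congˡ (coeff-φ f n))))))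

    *-congʳₚ : ∀ f {g h} → g ≈ₚ h → f *ₚ g ≈ₚ f *ₚ h
    *-congʳₚ []      p = ≈ₚ-refl
    *-congʳₚ (a ∷ f) p = +-congₚ (·-cong refl p) (*-congʳₚ f (X-cong p))

    *-zeroˡₚ : ∀ f {g} → f ≈ₚ [] → f *ₚ g ≈ₚ []
    *-zeroˡₚ []      p = ≈ₚ-refl
    *-zeroˡₚ (a ∷ f) {g} p = ≈ₚ-trans (+ₚ-identityˡ′ (·-zeroˡ g (at p zero))) (*-zeroˡₚ f (coeffwise (at p ∘ suc)))

    *-congˡₚ : ∀ f f′ {g} → f ≈ₚ f′ → f *ₚ g ≈ₚ f′ *ₚ g
    *-congˡₚ []      f′       p = ≈ₚ-sym (*-zeroˡₚ f′ (≈ₚ-sym p))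
    *-congˡₚ (a ∷ f) []       p = *-zeroˡₚ (a ∷ f) p
    *-congˡₚ (a ∷ f) (b ∷ f′) p = +-congₚ (·-cong (at p zero) ≈ₚ-refl) (*-congˡₚ f f′ (coeffwise (at p ∘ suc)))

    *-congₚ : ∀ {f f′ g g′} → f ≈ₚ f′ → g ≈ₚ g′ → f *ₚ g ≈ₚ f′ *ₚ g′
    *-congₚ {f} {f′} p q = ≈ₚ-trans (*-congʳₚ f q) (*-congˡₚ f f′ p)

    distribˡₚ : ∀ f g h → f *ₚ (g +ₚ h) ≈ₚ f *ₚ g +ₚ f *ₚ h
    distribˡₚ []      g h = ≈ₚ-refl
    distribˡₚ (a ∷ f) g h = begin
      a ·ₚ (g +ₚ h) +ₚ f *ₚ (X· (g +ₚ h))                      ≈⟨ +-congₚ (·-distribˡ a g h) (≈ₚ-trans (*-congʳₚ f (X-+ g h)) (distribˡₚ f (X· g) (X· h))) ⟩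
      (a ·ₚ g +ₚ a ·ₚ h) +ₚ (f *ₚ (X· g) +ₚ f *ₚ (X· h))        ≈⟨ interchangeₚ (a ·ₚ g) (a ·ₚ h) (f *ₚ (X· g)) (f *ₚ (X· h)) ⟩
      (a ·ₚ g +ₚ f *ₚ (X· g)) +ₚ (a ·ₚ h +ₚ f *ₚ (X· h))        ∎

    distribʳₚ : ∀ h f g → (f +ₚ g) *ₚ h ≈ₚ f *ₚ h +ₚ g *ₚ h
    distribʳₚ h []      g       = ≈ₚ-refl
    distribʳₚ h (a ∷ f) []      = ≈ₚ-sym (+-identityʳₚ _)
    distribʳₚ h (a ∷ f) (b ∷ g) = begin
      (a + b) ·ₚ h +ₚ (f +ₚ g) *ₚ (X· h)                       ≈⟨ +-congₚ (·-distribʳ a b h) (distribʳₚ (X· h) f g) ⟩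
      (a ·ₚ h +ₚ b ·ₚ h) +ₚ (f *ₚ (X· h) +ₚ g *ₚ (X· h))        ≈⟨ interchangeₚ (a ·ₚ h) (b ·ₚ h) (f *ₚ (X· h)) (g *ₚ (X· h)) ⟩
      (a ·ₚ h +ₚ f *ₚ (X· h)) +ₚ (b ·ₚ h +ₚ g *ₚ (X· h))        ∎

    ·-*-assoc : ∀ a f g → (a ·ₚ f) *ₚ g ≈ₚ a ·ₚ (f *ₚ g)
    ·-*-assoc a []      g = ≈ₚ-refl
    ·-*-assoc a (b ∷ f) g = begin
      (a * b) ·ₚ g +ₚ (a ·ₚ f) *ₚ (X· g)        ≈⟨ +-congₚ (·-assoc a b g) (·-*-assoc a f (X· g)) ⟩
      a ·ₚ (b ·ₚ g) +ₚ a ·ₚ (f *ₚ (X· g))       ≈⟨ ·-distribˡ a (b ·ₚ g) (f *ₚ (X· g)) ⟨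
      a ·ₚ (b ·ₚ g +ₚ f *ₚ (X· g))              ∎

    φ-*-X : ∀ f g → List.map ⟦_⟧ f *ₚ (X· g) ≈ₚ X· (f *ₚ g)
    φ-*-X []      g = ≈ₚ-sym 0∷[]
    φ-*-X (a ∷ f) g = begin
      ⟦ a ⟧ ·ₚ (X· g) +ₚ List.map ⟦_⟧ f *ₚ (X· (X· g))  ≈⟨ +-congₚ (≈ₚ-sym (X-· a g)) (φ-*-X f (X· g)) ⟩
      (X· (a ·ₚ g)) +ₚ (X· (f *ₚ (X· g)))               ≈⟨ X-+ (a ·ₚ g) (f *ₚ (X· g)) ⟨
      X· (a ·ₚ g +ₚ f *ₚ (X· g))                        ∎

    X-*-assoc : ∀ f g → (X· f) *ₚ g ≈ₚ X· (f *ₚ g)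
    X-*-assoc f g = ≈ₚ-trans (+ₚ-identityˡ′ (·-zeroˡ g refl)) (φ-*-X f g)

    *-assocₚ : ∀ f g h → (f *ₚ g) *ₚ h ≈ₚ f *ₚ (g *ₚ h)
    *-assocₚ []      g h = ≈ₚ-refl
    *-assocₚ (a ∷ f) g h = begin
      (a ·ₚ g +ₚ f *ₚ (X· g)) *ₚ h              ≈⟨ distribʳₚ h (a ·ₚ g) (f *ₚ (X· g)) ⟩
      (a ·ₚ g) *ₚ h +ₚ (f *ₚ (X· g)) *ₚ h       ≈⟨ +-congₚ (·-*-assoc a g h) (*-assocₚ f (X· g) h) ⟩
      a ·ₚ (g *ₚ h) +ₚ f *ₚ ((X· g) *ₚ h)       ≈⟨ +-congₚ ≈ₚ-refl (*-congʳₚ f (X-*-assoc g h)) ⟩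
      a ·ₚ (g *ₚ h) +ₚ f *ₚ (X· (g *ₚ h))       ∎

    X-∷ : ∀ f → X· (0# ∷ f) ≈ₚ 0# ∷ (X· f)
    X-∷ f .at zero          = refl
    X-∷ f .at (suc zero)    = 0#-homo
    X-∷ f .at (suc (suc n)) = refl

    ·-∷ : ∀ a f → a ·ₚ (0# ∷ f) ≈ₚ 0# ∷ (a ·ₚ f)
    ·-∷ a f = ∷-cong (zeroʳ a) ≈ₚ-refl

    *-∷ : ∀ f g → f *ₚ (0# ∷ g) ≈ₚ 0# ∷ (f *ₚ g)
    *-∷ []      g = ≈ₚ-sym 0∷[]
    *-∷ (a ∷ f) g = begin
      a ·ₚ (0# ∷ g) +ₚ f *ₚ (X· (0# ∷ g))        ≈⟨ +-congₚ (·-∷ a g) (≈ₚ-trans (*-congʳₚ f (X-∷ g)) (*-∷ f (X· g))) ⟩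
      (0# + 0#) ∷ (a ·ₚ g +ₚ f *ₚ (X· g))        ≈⟨ ∷-cong (+-identityˡ 0#) ≈ₚ-refl ⟩
      0# ∷ (a ·ₚ g +ₚ f *ₚ (X· g))               ∎

    *-identityˡₚ : ∀ f → 1ₚ *ₚ f ≈ₚ f
    *-identityˡₚ f = ≈ₚ-trans (+-identityʳₚ _) (·-identity f)

    *-identityʳₚ : ∀ f → f *ₚ 1ₚ ≈ₚ f
    *-identityʳₚ []      = ≈ₚ-refl
    *-identityʳₚ (a ∷ f) = begin
      (a * 1# ∷ []) +ₚ f *ₚ (X· 1ₚ)    ≈⟨ +-congₚ (∷-cong (*-identityʳ a) ≈ₚ-refl) (≈ₚ-trans (*-congʳₚ f (∷-cong refl (∷-cong 1#-homo ≈ₚ-refl))) (*-∷ f 1ₚ)) ⟩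
      (a ∷ []) +ₚ (0# ∷ (f *ₚ 1ₚ))     ≈⟨ ∷-cong (+-identityʳ a) (*-identityʳₚ f) ⟩
      a ∷ f                            ∎

  polynomialRing : Ring c ℓ
  polynomialRing = record
    { Carrier = Poly
    ; _≈_ = _≈ₚ_
    ; _+_ = _+ₚ_
    ; _*_ = _*ₚ_
    ; -_ = -ₚ_
    ; 0# = []
    ; 1# = 1ₚ
    ; isRing = record
      { +-isAbelianGroup = +ₚ-isAbelianGroup
      ; *-cong = *-congₚ
      ; *-assoc = *-assocₚ
      ; *-identity = *-identityˡₚ , *-identityʳₚ
      ; distrib = distribˡₚ , distribʳₚ
      }
    }

  constant : R ⟶ᴿ polynomialRing
  constant = mkRingHom {R = R} {S = polynomialRing} (λ a → a ∷ [])
    (λ p → ∷-cong p ≈ₚ-refl) (λ a b → ≈ₚ-refl) (λ a b → ≈ₚ-refl) ≈ₚ-refl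

  X-constant : ∀ a → X *ₚ (a ∷ []) ≈ₚ (⟦ a ⟧ ∷ []) *ₚ X
  X-constant a = ∷-cong
    (trans (+-cong (zeroˡ a) (zeroʳ 1#)) (trans (+-identityʳ 0#) (sym (zeroʳ _))))
    (∷-cong (trans (*-identityˡ _) (sym (*-identityʳ _))) ≈ₚ-refl)

  module _ where
    private
      module P = Ring polynomialRing

      C : Carrier → Poly
      C = RingHomomorphism.⟦_⟧ constant

      shift : ∀ f → f *ₚ X ≈ₚ 0# ∷ f
      shift f = ≈ₚ-trans (*-congʳₚ f (∷-cong refl (≈ₚ-refl {1ₚ}))) (≈ₚ-trans (*-∷ f 1ₚ) (∷-cong refl (*-identityʳₚ f)))

      decompose : ∀ a f → a ∷ f ≈ₚ C a +ₚ f *ₚ X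
      decompose a f = ≈ₚ-sym (≈ₚ-trans (+-congₚ ≈ₚ-refl (shift f)) (∷-cong (+-identityʳ a) ≈ₚ-refl))

    central : ∀ {s} → (∀ a → C a *ₚ s ≈ₚ s *ₚ C a) → X *ₚ s ≈ₚ s *ₚ X → ∀ f → f *ₚ s ≈ₚ s *ₚ f
    central {s} Cs≈sC Xs≈sX []      = ≈ₚ-sym (P.zeroʳ s)
    central {s} Cs≈sC Xs≈sX (a ∷ f) = begin
      (a ∷ f) *ₚ s                        ≈⟨ *-congₚ (decompose a f) ≈ₚ-refl ⟩
      (C a +ₚ f *ₚ X) *ₚ s                ≈⟨ distribʳₚ s (C a) (f *ₚ X) ⟩
      C a *ₚ s +ₚ f *ₚ X *ₚ s             ≈⟨ +-congₚ (Cs≈sC a) (≈ₚ-trans (*-assocₚ f X s) (*-congₚ (≈ₚ-refl {f}) Xs≈sX)) ⟩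
      s *ₚ C a +ₚ f *ₚ (s *ₚ X)           ≈⟨ +-congₚ (≈ₚ-refl {s *ₚ C a}) (*-assocₚ f s X) ⟨
      s *ₚ C a +ₚ f *ₚ s *ₚ X             ≈⟨ +-congₚ (≈ₚ-refl {s *ₚ C a}) (*-congₚ (central Cs≈sC Xs≈sX f) (≈ₚ-refl {X})) ⟩
      s *ₚ C a +ₚ s *ₚ f *ₚ X             ≈⟨ +-congₚ (≈ₚ-refl {s *ₚ C a}) (*-assocₚ s f X) ⟩
      s *ₚ C a +ₚ s *ₚ (f *ₚ X)           ≈⟨ distribˡₚ s (C a) (f *ₚ X) ⟨
      s *ₚ (C a +ₚ f *ₚ X)                ≈⟨ *-congₚ (≈ₚ-refl {s}) (decompose a f) ⟨
      s *ₚ (a ∷ f)                        ∎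

-- The homomorphism Σ aᵢ Xⁱ ↦ Σ u(aᵢ) xⁱ
module Evaluation {R : Ring c ℓ} {φ : R ⟶ᴿ R} {S : Ring d ℓ₁} (u : R ⟶ᴿ S) (x : Ring.Carrier S)
  (commutes : ∀ r → Ring._≈_ S (Ring._*_ S x (RingHomomorphism.⟦_⟧ u r))
                               (Ring._*_ S (RingHomomorphism.⟦_⟧ u (RingHomomorphism.⟦_⟧ φ r)) x))
  where
  open SkewPolynomials R φ
  open RingHomomorphism φ using (⟦_⟧)
  open Ring R using (_+_; _*_; Carrier)
  open _≈ₚ_
  private
    module S = Ring S
    module u = RingHomomorphism u
  open S using () renaming (_+_ to _⊕_; _*_ to _⊗_; _≈_ to _∼_)
  open SetoidReasoning S.setoid
  open CommutativeSemigroupProperties (CommutativeMonoid.commutativeSemigroup S.+-commutativeMonoid) using ()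
    renaming (interchange to interchangeₛ)

  eval : Poly → S.Carrier
  eval []      = S.0#
  eval (a ∷ f) = u.⟦ a ⟧ ⊕ eval f ⊗ x

  private
    eval-0 : ∀ f → f ≈ₚ [] → eval f ∼ S.0#
    eval-0 []      p = S.refl
    eval-0 (a ∷ f) p = S.trans
      (S.+-cong (S.trans (u.⟦⟧-cong (at p zero)) u.0#-homo)
                (S.trans (S.*-congʳ (eval-0 f (coeffwise (at p ∘ suc)))) (S.zeroˡ x)))
      (S.+-identityˡ S.0#)

    eval-cong : ∀ f g → f ≈ₚ g → eval f ∼ eval g
    eval-cong []      g       p = S.sym (eval-0 g (Ring.sym polynomialRing p))
    eval-cong (a ∷ f) []      p = eval-0 (a ∷ f) p
    eval-cong (a ∷ f) (b ∷ g) p =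
      S.+-cong (u.⟦⟧-cong (at p zero)) (S.*-congʳ (eval-cong f g (coeffwise (at p ∘ suc))))

    eval-+ : ∀ f g → eval (f +ₚ g) ∼ eval f ⊕ eval g
    eval-+ []      g       = S.sym (S.+-identityˡ _)
    eval-+ (a ∷ f) []      = S.sym (S.+-identityʳ _)
    eval-+ (a ∷ f) (b ∷ g) = begin
      u.⟦ a + b ⟧ ⊕ eval (f +ₚ g) ⊗ x                     ≈⟨ S.+-cong (u.+-homo a b) (S.trans (S.*-congʳ (eval-+ f g)) (S.distribʳ x _ _)) ⟩
      (u.⟦ a ⟧ ⊕ u.⟦ b ⟧) ⊕ (eval f ⊗ x ⊕ eval g ⊗ x)     ≈⟨ interchangeₛ _ _ _ _ ⟩
      (u.⟦ a ⟧ ⊕ eval f ⊗ x) ⊕ (u.⟦ b ⟧ ⊕ eval g ⊗ x)     ∎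

    eval-· : ∀ a f → eval (a ·ₚ f) ∼ u.⟦ a ⟧ ⊗ eval f
    eval-· a []      = S.sym (S.zeroʳ _)
    eval-· a (b ∷ f) = begin
      u.⟦ a * b ⟧ ⊕ eval (a ·ₚ f) ⊗ x              ≈⟨ S.+-cong (u.*-homo a b) (S.trans (S.*-congʳ (eval-· a f)) (S.*-assoc _ _ x)) ⟩
      u.⟦ a ⟧ ⊗ u.⟦ b ⟧ ⊕ u.⟦ a ⟧ ⊗ (eval f ⊗ x)   ≈⟨ S.distribˡ _ _ _ ⟨
      u.⟦ a ⟧ ⊗ (u.⟦ b ⟧ ⊕ eval f ⊗ x)             ∎

    eval-φ : ∀ f → eval (List.map ⟦_⟧ f) ⊗ x ∼ x ⊗ eval f
    eval-φ []      = S.trans (S.zeroˡ x) (S.sym (S.zeroʳ x))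
    eval-φ (a ∷ f) = begin
      (u.⟦ ⟦ a ⟧ ⟧ ⊕ eval (List.map ⟦_⟧ f) ⊗ x) ⊗ x        ≈⟨ S.distribʳ x _ _ ⟩
      u.⟦ ⟦ a ⟧ ⟧ ⊗ x ⊕ eval (List.map ⟦_⟧ f) ⊗ x ⊗ x      ≈⟨ S.+-cong (S.sym (commutes a)) (S.trans (S.*-congʳ (eval-φ f)) (S.*-assoc x _ x)) ⟩
      x ⊗ u.⟦ a ⟧ ⊕ x ⊗ (eval f ⊗ x)                       ≈⟨ S.distribˡ x _ _ ⟨
      x ⊗ (u.⟦ a ⟧ ⊕ eval f ⊗ x)                           ∎

    eval-X : ∀ f → eval (X· f) ∼ x ⊗ eval f
    eval-X f = S.trans (S.+-congʳ u.0#-homo) (S.trans (S.+-identityˡ _) (eval-φ f))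

    eval-* : ∀ f g → eval (f *ₚ g) ∼ eval f ⊗ eval g
    eval-* []      g = S.sym (S.zeroˡ _)
    eval-* (a ∷ f) g = begin
      eval (a ·ₚ g +ₚ f *ₚ (X· g))                    ≈⟨ eval-+ (a ·ₚ g) _ ⟩
      eval (a ·ₚ g) ⊕ eval (f *ₚ (X· g))              ≈⟨ S.+-cong (eval-· a g) (S.trans (eval-* f (X· g)) (S.*-congˡ (eval-X g))) ⟩
      u.⟦ a ⟧ ⊗ eval g ⊕ eval f ⊗ (x ⊗ eval g)        ≈⟨ S.+-congˡ (S.*-assoc _ x _) ⟨
      u.⟦ a ⟧ ⊗ eval g ⊕ eval f ⊗ x ⊗ eval g          ≈⟨ S.distribʳ _ _ _ ⟨
      (u.⟦ a ⟧ ⊕ eval f ⊗ x) ⊗ eval g                 ∎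

  evalHom : polynomialRing ⟶ᴿ S
  evalHom = mkRingHom {R = polynomialRing} {S = S} eval
    (λ {f} {g} → eval-cong f g) eval-+ eval-*
    (S.trans (S.+-cong u.1#-homo (S.zeroˡ x)) (S.+-identityʳ S.1#))

  eval-commutes : ∀ {s} → (∀ r → u.⟦ r ⟧ ⊗ s ∼ s ⊗ u.⟦ r ⟧) → x ⊗ s ∼ s ⊗ x → ∀ f → eval f ⊗ s ∼ s ⊗ eval f
  eval-commutes {s} us≈su xs≈sx []      = S.trans (S.zeroˡ s) (S.sym (S.zeroʳ s))
  eval-commutes {s} us≈su xs≈sx (a ∷ f) = begin
    (u.⟦ a ⟧ ⊕ eval f ⊗ x) ⊗ s        ≈⟨ S.distribʳ s _ _ ⟩
    u.⟦ a ⟧ ⊗ s ⊕ eval f ⊗ x ⊗ s      ≈⟨ S.+-cong (us≈su a) (S.trans (S.*-assoc _ x s) (S.*-congˡ xs≈sx)) ⟩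
    s ⊗ u.⟦ a ⟧ ⊕ eval f ⊗ (s ⊗ x)    ≈⟨ S.+-congˡ (S.*-assoc _ s x) ⟨
    s ⊗ u.⟦ a ⟧ ⊕ eval f ⊗ s ⊗ x      ≈⟨ S.+-congˡ (S.*-congʳ (eval-commutes us≈su xs≈sx f)) ⟩
    s ⊗ u.⟦ a ⟧ ⊕ s ⊗ eval f ⊗ x      ≈⟨ S.+-congˡ (S.*-assoc s _ x) ⟩
    s ⊗ u.⟦ a ⟧ ⊕ s ⊗ (eval f ⊗ x)    ≈⟨ S.distribˡ s _ _ ⟨
    s ⊗ (u.⟦ a ⟧ ⊕ eval f ⊗ x)        ∎

infix 2 _⟶ᴹ_

record _⟶ᴹ_ {R : Ring r ℓr} (M : LeftModule R m₁ ℓm₁) (N : LeftModule R m₂ ℓm₂) :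
            Set (r ⊔ m₁ ⊔ m₂ ⊔ ℓm₁ ⊔ ℓm₂) where
  private
    module M = LeftModule M
    module N = LeftModule N
  field
    ⟦_⟧ : M.Carrierᴹ → N.Carrierᴹ
    isLeftModuleHomomorphism : IsLeftModuleHomomorphism M.rawLeftModule N.rawLeftModule ⟦_⟧
  open IsLeftModuleHomomorphism isLeftModuleHomomorphism public

restrict : {R : Ring r ℓr} {S : Ring s ℓ₁} → R ⟶ᴿ S → LeftModule S m ℓm → LeftModule R m ℓm
restrict {R = R} {S = S} h M = record
  { _*ₗ_ = λ a x → h.⟦ a ⟧ *ₗ x
  ; isLeftModule = record
    { isLeftSemimodule = record
      { +ᴹ-isCommutativeMonoid = +ᴹ-isCommutativeMonoid
      ; isPreleftSemimodule = record
        { *ₗ-cong = λ p q → *ₗ-cong (h.⟦⟧-cong p) q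
        ; *ₗ-zeroˡ = λ x → ≈ᴹ-trans (*ₗ-congʳ h.0#-homo) (*ₗ-zeroˡ x)
        ; *ₗ-distribʳ = λ x a b → ≈ᴹ-trans (*ₗ-congʳ (h.+-homo a b)) (*ₗ-distribʳ x _ _)
        ; *ₗ-identityˡ = λ x → ≈ᴹ-trans (*ₗ-congʳ h.1#-homo) (*ₗ-identityˡ x)
        ; *ₗ-assoc = λ a b x → ≈ᴹ-trans (*ₗ-congʳ (h.*-homo a b)) (*ₗ-assoc _ _ x)
        ; *ₗ-zeroʳ = λ a → *ₗ-zeroʳ h.⟦ a ⟧
        ; *ₗ-distribˡ = λ a → *ₗ-distribˡ h.⟦ a ⟧
        }
      }
    ; -ᴹ‿cong = -ᴹ‿cong
    ; -ᴹ‿inverse = -ᴹ‿inverse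
    }
  }
  where
  open LeftModule M
  module h = RingHomomorphism h

module _ {R : Ring r ℓr} (M : LeftModule R m₁ ℓm₁) (N : LeftModule R m₂ ℓm₂) where
  private
    module M = LeftModule M
  open LeftModule N

  mkHom : (f : M.Carrierᴹ → Carrierᴹ) →
          (∀ {x y} → x M.≈ᴹ y → f x ≈ᴹ f y) →
          (∀ x y → f (x M.+ᴹ y) ≈ᴹ f x +ᴹ f y) →
          (∀ a x → f (a M.*ₗ x) ≈ᴹ a *ₗ f x) →
          M ⟶ᴹ N
  mkHom f f-cong f-+ f-* = record
    { ⟦_⟧ = f
    ; isLeftModuleHomomorphism = record
      { +ᴹ-isGroupHomomorphism = record
        { isMonoidHomomorphism = record
          { isMagmaHomomorphism = record { isRelHomomorphism = record { cong = f-cong } ; homo = f-+ }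
          ; ε-homo = f-0
          }
        ; ⁻¹-homo = λ x → GroupProperties.inverseʳ-unique +ᴹ-group _ _
            (≈ᴹ-trans (≈ᴹ-sym (f-+ x (M.-ᴹ x))) (≈ᴹ-trans (f-cong (M.-ᴹ‿inverseʳ x)) f-0))
        }
      ; *ₗ-homo = f-*
      }
    }
    where
    f-0 : f M.0ᴹ ≈ᴹ 0ᴹ
    f-0 = ≈ᴹ-trans (f-cong (M.≈ᴹ-sym (M.*ₗ-zeroˡ M.0ᴹ)))
          (≈ᴹ-trans (f-* (Ring.0# R) M.0ᴹ) (*ₗ-zeroˡ _))

module _ {R : Ring r ℓr} where

  -- Exactness at M. It does not depend on the scalars, so exactness of a sequence of modules over an
  -- A-algebra is the same as exactness of the underlying sequence of A-modules.
  Exact : (L : LeftModule R m₁ ℓm₁) (M : LeftModule R m₂ ℓm₂) (N : LeftModule R m₃ ℓm₃) →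
          (LeftModule.Carrierᴹ L → LeftModule.Carrierᴹ M) →
          (LeftModule.Carrierᴹ M → LeftModule.Carrierᴹ N) → Set _
  Exact L M N f g = ∀ y → g y N.≈ᴹ N.0ᴹ ⇔ (∃ λ x → f x M.≈ᴹ y)
    where
    module M = LeftModule M
    module N = LeftModule N

  record ShortExact {L : LeftModule R m₁ ℓm₁} {M : LeftModule R m₂ ℓm₂} {N : LeftModule R m₃ ℓm₃}
                    (f : L ⟶ᴹ M) (g : M ⟶ᴹ N) : Set (m₁ ⊔ m₂ ⊔ m₃ ⊔ ℓm₁ ⊔ ℓm₂ ⊔ ℓm₃) where
    private
      module f = _⟶ᴹ_ f
      module g = _⟶ᴹ_ g
      module N = LeftModule N
    field
      injective  : Injective (LeftModule._≈ᴹ_ L) (LeftModule._≈ᴹ_ M) f.⟦_⟧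
      exact      : Exact L M N f.⟦_⟧ g.⟦_⟧
      surjective : Surjective (LeftModule._≈ᴹ_ M) (LeftModule._≈ᴹ_ N) g.⟦_⟧

    kernel⊆image : ∀ {y} → g.⟦ y ⟧ N.≈ᴹ N.0ᴹ → ∃ λ x → LeftModule._≈ᴹ_ M f.⟦ x ⟧ y
    kernel⊆image = Equivalence.to (exact _)

    g∘f≈0 : ∀ x → g.⟦ f.⟦ x ⟧ ⟧ N.≈ᴹ N.0ᴹ
    g∘f≈0 x = Equivalence.from (exact _) (x , LeftModule.≈ᴹ-refl M)

    lift : LeftModule.Carrierᴹ N → LeftModule.Carrierᴹ M
    lift y = proj₁ (surjective y)

    g-lift : ∀ y → g.⟦ lift y ⟧ N.≈ᴹ y
    g-lift y = proj₂ (surjective y) (LeftModule.≈ᴹ-refl M)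

  -- The maps are plain functions; that they are homomorphisms is part of the assertion.
  record ExactSequence₆
      {a₁ a₂ b₁ b₂ c₁ c₂ d₁ d₂ e₁ e₂ f₁ f₂ : Level}
      (A : LeftModule R a₁ a₂) (B : LeftModule R b₁ b₂) (C : LeftModule R c₁ c₂)
      (D : LeftModule R d₁ d₂) (E : LeftModule R e₁ e₂) (F : LeftModule R f₁ f₂)
      (α : LeftModule.Carrierᴹ A → LeftModule.Carrierᴹ B)
      (β : LeftModule.Carrierᴹ B → LeftModule.Carrierᴹ C)
      (γ : LeftModule.Carrierᴹ C → LeftModule.Carrierᴹ D)
      (δ : LeftModule.Carrierᴹ D → LeftModule.Carrierᴹ E)
      (ε : LeftModule.Carrierᴹ E → LeftModule.Carrierᴹ F)
      : Set (r ⊔ a₁ ⊔ a₂ ⊔ b₁ ⊔ b₂ ⊔ c₁ ⊔ c₂ ⊔ d₁ ⊔ d₂ ⊔ e₁ ⊔ e₂ ⊔ f₁ ⊔ f₂) where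
    open LeftModule using (rawLeftModule; _≈ᴹ_)
    field
      α-homo : IsLeftModuleHomomorphism (rawLeftModule A) (rawLeftModule B) α
      β-homo : IsLeftModuleHomomorphism (rawLeftModule B) (rawLeftModule C) β
      γ-homo : IsLeftModuleHomomorphism (rawLeftModule C) (rawLeftModule D) γ
      δ-homo : IsLeftModuleHomomorphism (rawLeftModule D) (rawLeftModule E) δ
      ε-homo : IsLeftModuleHomomorphism (rawLeftModule E) (rawLeftModule F) ε
      α-injective  : Injective (_≈ᴹ_ A) (_≈ᴹ_ B) α
      exact-B      : Exact A B C α β
      exact-C      : Exact B C D β γ
      exact-D      : Exact C D E γ δ
      exact-E      : Exact D E F δ ε
      ε-surjective : Surjective (_≈ᴹ_ E) (_≈ᴹ_ F) ε

  strictly⇒surjective : {M : LeftModule R m₁ ℓm₁} {N : LeftModule R m₂ ℓm₂} (f : M ⟶ᴹ N) →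
    (∀ y → ∃ λ x → LeftModule._≈ᴹ_ N (_⟶ᴹ_.⟦_⟧ f x) y) →
    Surjective (LeftModule._≈ᴹ_ M) (LeftModule._≈ᴹ_ N) (_⟶ᴹ_.⟦_⟧ f)
  strictly⇒surjective {N = N} f surj y =
    proj₁ (surj y) , λ z≈x → LeftModule.≈ᴹ-trans N (_⟶ᴹ_.⟦⟧-cong f z≈x) (proj₂ (surj y))

  -- A submodule of A ⊕ B.
  module _ {A : LeftModule R m₁ ℓm₁} {B : LeftModule R m₂ ℓm₂} {N : LeftModule R m₃ ℓm₃}
           (f : A ⟶ᴹ N) (g : B ⟶ᴹ N) where
    private
      module A = LeftModule A
      module B = LeftModule B
      module N = LeftModule N
      module f = _⟶ᴹ_ f
      module g = _⟶ᴹ_ g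
      module A⊕B = LeftModule (DirectProduct.leftModule A B)

      rawFibreProduct : RawLeftModule (Ring.Carrier R) _ _
      rawFibreProduct = record
        { Carrierᴹ = Σ (A.Carrierᴹ × B.Carrierᴹ) λ (x , y) → f.⟦ x ⟧ N.≈ᴹ g.⟦ y ⟧
        ; _≈ᴹ_ = λ u v → proj₁ u A⊕B.≈ᴹ proj₁ v
        ; _+ᴹ_ = λ (u , p) (v , q) → u A⊕B.+ᴹ v , N.≈ᴹ-trans (f.+ᴹ-homo _ _) (N.≈ᴹ-trans (N.+ᴹ-cong p q) (N.≈ᴹ-sym (g.+ᴹ-homo _ _)))
        ; _*ₗ_ = λ a (u , p) → a A⊕B.*ₗ u , N.≈ᴹ-trans (f.*ₗ-homo _ _) (N.≈ᴹ-trans (N.*ₗ-congˡ p) (N.≈ᴹ-sym (g.*ₗ-homo _ _)))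
        ; 0ᴹ = A⊕B.0ᴹ , N.≈ᴹ-trans f.0ᴹ-homo (N.≈ᴹ-sym g.0ᴹ-homo)
        ; -ᴹ_ = λ (u , p) → A⊕B.-ᴹ u , N.≈ᴹ-trans (f.-ᴹ-homo _) (N.≈ᴹ-trans (N.-ᴹ‿cong p) (N.≈ᴹ-sym (g.-ᴹ-homo _)))
        }

    fibreProduct : LeftModule R (m₁ ⊔ m₂ ⊔ ℓm₃) (ℓm₁ ⊔ ℓm₂)
    fibreProduct = record
      { RawLeftModule rawFibreProduct
      ; isLeftModule = LeftModuleMonomorphism.isLeftModule {M = rawFibreProduct} {⟦_⟧ = proj₁}
          (record
            { isLeftModuleHomomorphism = record
              { +ᴹ-isGroupHomomorphism = record
                { isMonoidHomomorphism = record
                  { isMagmaHomomorphism = record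
                    { isRelHomomorphism = record { cong = λ p → p }
                    ; homo = λ _ _ → A⊕B.≈ᴹ-refl
                    }
                  ; ε-homo = A⊕B.≈ᴹ-refl
                  }
                ; ⁻¹-homo = λ _ → A⊕B.≈ᴹ-refl
                }
              ; *ₗ-homo = λ _ _ → A⊕B.≈ᴹ-refl
              }
            ; injective = λ p → p
            })
          (Ring.isRing R) A⊕B.isLeftModule
      }

  -- The quotient M / k(L) keeps the carrier of M and coarsens its equality.
  module _ {L : LeftModule R m₁ ℓm₁} {M : LeftModule R m₂ ℓm₂} (k : L ⟶ᴹ M) where
    private
      module L = LeftModule L
      module k = _⟶ᴹ_ k
    open LeftModule M
    open SetoidReasoning ≈ᴹ-setoid
    open CommutativeSemigroupProperties (AbelianGroup.commutativeSemigroup +ᴹ-abelianGroup) using (interchange)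

    private
      _~_ : Carrierᴹ → Carrierᴹ → Set _
      x ~ y = ∃ λ n → x ≈ᴹ y +ᴹ k.⟦ n ⟧

      ≈⇒~ : ∀ {x y} → x ≈ᴹ y → x ~ y
      ≈⇒~ p = L.0ᴹ , ≈ᴹ-trans p (≈ᴹ-trans (≈ᴹ-sym (+ᴹ-identityʳ _)) (+ᴹ-congˡ (≈ᴹ-sym k.0ᴹ-homo)))

      ~-sym : ∀ {x y} → x ~ y → y ~ x
      ~-sym {x} {y} (n , p) = L.-ᴹ n , (begin
        y                                   ≈⟨ +ᴹ-identityʳ y ⟨
        y +ᴹ 0ᴹ                             ≈⟨ +ᴹ-congˡ (-ᴹ‿inverseʳ k.⟦ n ⟧) ⟨
        y +ᴹ (k.⟦ n ⟧ +ᴹ -ᴹ k.⟦ n ⟧)        ≈⟨ +ᴹ-assoc _ _ _ ⟨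
        y +ᴹ k.⟦ n ⟧ +ᴹ -ᴹ k.⟦ n ⟧          ≈⟨ +ᴹ-cong p (k.-ᴹ-homo n) ⟨
        x +ᴹ k.⟦ L.-ᴹ n ⟧                   ∎)

      ~-trans : ∀ {x y z} → x ~ y → y ~ z → x ~ z
      ~-trans {x} {y} {z} (n , p) (n′ , q) = n′ L.+ᴹ n , (begin
        x                                   ≈⟨ p ⟩
        y +ᴹ k.⟦ n ⟧                        ≈⟨ +ᴹ-congʳ q ⟩
        z +ᴹ k.⟦ n′ ⟧ +ᴹ k.⟦ n ⟧            ≈⟨ +ᴹ-assoc _ _ _ ⟩
        z +ᴹ (k.⟦ n′ ⟧ +ᴹ k.⟦ n ⟧)          ≈⟨ +ᴹ-congˡ (k.+ᴹ-homo n′ n) ⟨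
        z +ᴹ k.⟦ n′ L.+ᴹ n ⟧                ∎)

      ~-+ : ∀ {x y u v} → x ~ y → u ~ v → (x +ᴹ u) ~ (y +ᴹ v)
      ~-+ {x} {y} {u} {v} (n , p) (n′ , q) = n L.+ᴹ n′ , (begin
        x +ᴹ u                                   ≈⟨ +ᴹ-cong p q ⟩
        (y +ᴹ k.⟦ n ⟧) +ᴹ (v +ᴹ k.⟦ n′ ⟧)        ≈⟨ interchange _ _ _ _ ⟩
        (y +ᴹ v) +ᴹ (k.⟦ n ⟧ +ᴹ k.⟦ n′ ⟧)        ≈⟨ +ᴹ-congˡ (k.+ᴹ-homo n n′) ⟨
        (y +ᴹ v) +ᴹ k.⟦ n L.+ᴹ n′ ⟧              ∎)

      ~-neg : ∀ {x y} → x ~ y → (-ᴹ x) ~ (-ᴹ y)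
      ~-neg {x} {y} (n , p) = L.-ᴹ n , (begin
        -ᴹ x                             ≈⟨ -ᴹ‿cong p ⟩
        -ᴹ (y +ᴹ k.⟦ n ⟧)                ≈⟨ AbelianGroupProperties.⁻¹-∙-comm +ᴹ-abelianGroup _ _ ⟨
        -ᴹ y +ᴹ -ᴹ k.⟦ n ⟧               ≈⟨ +ᴹ-congˡ (k.-ᴹ-homo n) ⟨
        -ᴹ y +ᴹ k.⟦ L.-ᴹ n ⟧             ∎)

      ~-* : ∀ {a b x y} → Ring._≈_ R a b → x ~ y → (a *ₗ x) ~ (b *ₗ y)
      ~-* {a} {b} {x} {y} a≈b (n , p) = b L.*ₗ n , (begin
        a *ₗ x                           ≈⟨ *ₗ-cong a≈b p ⟩
        b *ₗ (y +ᴹ k.⟦ n ⟧)              ≈⟨ *ₗ-distribˡ b y _ ⟩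
        b *ₗ y +ᴹ b *ₗ k.⟦ n ⟧           ≈⟨ +ᴹ-congˡ (k.*ₗ-homo b n) ⟨
        b *ₗ y +ᴹ k.⟦ b L.*ₗ n ⟧         ∎)

    cokernel : LeftModule R m₂ (m₁ ⊔ ℓm₂)
    cokernel = record
      { Carrierᴹ = Carrierᴹ
      ; _≈ᴹ_ = _~_
      ; _+ᴹ_ = _+ᴹ_
      ; _*ₗ_ = _*ₗ_
      ; 0ᴹ = 0ᴹ
      ; -ᴹ_ = -ᴹ_
      ; isLeftModule = record
        { isLeftSemimodule = record
          { +ᴹ-isCommutativeMonoid = record
            { isMonoid = record
              { isSemigroup = record
                { isMagma = record
                  { isEquivalence = record { refl = ≈⇒~ ≈ᴹ-refl ; sym = ~-sym ; trans = ~-trans }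
                  ; ∙-cong = ~-+
                  }
                ; assoc = λ x y z → ≈⇒~ (+ᴹ-assoc x y z)
                }
              ; identity = (λ x → ≈⇒~ (+ᴹ-identityˡ x)) , (λ x → ≈⇒~ (+ᴹ-identityʳ x))
              }
            ; comm = λ x y → ≈⇒~ (+ᴹ-comm x y)
            }
          ; isPreleftSemimodule = record
            { *ₗ-cong = ~-*
            ; *ₗ-zeroˡ = λ x → ≈⇒~ (*ₗ-zeroˡ x)
            ; *ₗ-distribʳ = λ x a b → ≈⇒~ (*ₗ-distribʳ x a b)
            ; *ₗ-identityˡ = λ x → ≈⇒~ (*ₗ-identityˡ x)
            ; *ₗ-assoc = λ a b x → ≈⇒~ (*ₗ-assoc a b x)
            ; *ₗ-zeroʳ = λ a → ≈⇒~ (*ₗ-zeroʳ a)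
            ; *ₗ-distribˡ = λ a x y → ≈⇒~ (*ₗ-distribˡ a x y)
            }
          }
        ; -ᴹ‿cong = ~-neg
        ; -ᴹ‿inverse = (λ x → ≈⇒~ (-ᴹ‿inverseˡ x)) , (λ x → ≈⇒~ (-ᴹ‿inverseʳ x))
        }
      }

infixr 9 _∘ᴹ_

_∘ᴹ_ : {R : Ring r ℓr} {L : LeftModule R m₁ ℓm₁} {M : LeftModule R m₂ ℓm₂} {N : LeftModule R m₃ ℓm₃} →
       M ⟶ᴹ N → L ⟶ᴹ M → L ⟶ᴹ N
_∘ᴹ_ {N = N} g f = record
  { isLeftModuleHomomorphism = ModuleComposition.isLeftModuleHomomorphism (LeftModule.≈ᴹ-trans N)
      (_⟶ᴹ_.isLeftModuleHomomorphism f) (_⟶ᴹ_.isLeftModuleHomomorphism g) }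

idᴹ : {R : Ring r ℓr} (M : LeftModule R m ℓm) → M ⟶ᴹ M
idᴹ M = record
  { isLeftModuleHomomorphism =
      ModuleIdentity.isLeftModuleHomomorphism (LeftModule.rawLeftModule M) (LeftModule.≈ᴹ-refl M) }

module _ {R : Ring r ℓr} where

  pairᴹ : {L : LeftModule R m₁ ℓm₁} {M : LeftModule R m₂ ℓm₂} {N : LeftModule R m₃ ℓm₃} →
          L ⟶ᴹ M → L ⟶ᴹ N → L ⟶ᴹ DirectProduct.leftModule M N
  pairᴹ {L = L} {M} {N} f g = mkHom L (DirectProduct.leftModule M N) (λ x → f.⟦ x ⟧ , g.⟦ x ⟧)
    (λ p → f.⟦⟧-cong p , g.⟦⟧-cong p) (λ x y → f.+ᴹ-homo x y , g.+ᴹ-homo x y) (λ a x → f.*ₗ-homo a x , g.*ₗ-homo a x)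
    where
    module f = _⟶ᴹ_ f
    module g = _⟶ᴹ_ g

  module _ (M : LeftModule R m₁ ℓm₁) (N : LeftModule R m₂ ℓm₂) where
    private
      module M = LeftModule M
      module N = LeftModule N

    fstᴹ : DirectProduct.leftModule M N ⟶ᴹ M
    fstᴹ = mkHom (DirectProduct.leftModule M N) M proj₁ proj₁ (λ _ _ → M.≈ᴹ-refl) (λ _ _ → M.≈ᴹ-refl)

    sndᴹ : DirectProduct.leftModule M N ⟶ᴹ N
    sndᴹ = mkHom (DirectProduct.leftModule M N) N proj₂ proj₂ (λ _ _ → N.≈ᴹ-refl) (λ _ _ → N.≈ᴹ-refl)

    0-hom : M ⟶ᴹ N
    0-hom = mkHom M N (λ _ → N.0ᴹ) (λ _ → N.≈ᴹ-refl)
      (λ _ _ → N.≈ᴹ-sym (N.+ᴹ-identityˡ N.0ᴹ)) (λ a _ → N.≈ᴹ-sym (N.*ₗ-zeroʳ a))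

  directProduct-shortExact : (M : LeftModule R m₁ ℓm₁) (N : LeftModule R m₂ ℓm₂) →
    ShortExact (pairᴹ (idᴹ M) (0-hom M N)) (sndᴹ M N)
  directProduct-shortExact M N = record
    { injective = proj₁
    ; exact = λ (x , y) → mk⇔ (λ y≈0 → x , M.≈ᴹ-refl , N.≈ᴹ-sym y≈0) (λ (_ , _ , 0≈y) → N.≈ᴹ-sym 0≈y)
    ; surjective = λ y → (M.0ᴹ , y) , proj₂
    }
    where
    module M = LeftModule M
    module N = LeftModule N

-- Hom_R(M, N) as a module over A, for a ring homomorphism h from A to the centre of R; a acts as
-- multiplication by h(a).
module HomModule {A : Ring c ℓ} {R : Ring r ℓr} (h : A ⟶ᴿ R)
  (h-central : ∀ a b → Ring._≈_ R (Ring._*_ R (RingHomomorphism.⟦_⟧ h a) b) (Ring._*_ R b (RingHomomorphism.⟦_⟧ h a)))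
  (M : LeftModule R m₁ ℓm₁) (N : LeftModule R m₂ ℓm₂)
  where
  private
    module h = RingHomomorphism h
    module M = LeftModule M
    module hN = LeftModule (restrict {R = A} {S = R} h N)
  open LeftModule N
  open CommutativeSemigroupProperties (AbelianGroup.commutativeSemigroup +ᴹ-abelianGroup) using (interchange)

  infix  4 _≈ʰ_
  infixl 6 _+ʰ_

  _≈ʰ_ : M ⟶ᴹ N → M ⟶ᴹ N → Set _
  f ≈ʰ g = (x : M.Carrierᴹ) → f.⟦ x ⟧ ≈ᴹ g.⟦ x ⟧
    where
    module f = _⟶ᴹ_ f
    module g = _⟶ᴹ_ g

  _+ʰ_ : M ⟶ᴹ N → M ⟶ᴹ N → M ⟶ᴹ N
  f +ʰ g = mkHom M N (λ x → f.⟦ x ⟧ +ᴹ g.⟦ x ⟧)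
    (λ p → +ᴹ-cong (f.⟦⟧-cong p) (g.⟦⟧-cong p))
    (λ x y → ≈ᴹ-trans (+ᴹ-cong (f.+ᴹ-homo x y) (g.+ᴹ-homo x y)) (interchange f.⟦ x ⟧ f.⟦ y ⟧ g.⟦ x ⟧ g.⟦ y ⟧))
    (λ a x → ≈ᴹ-trans (+ᴹ-cong (f.*ₗ-homo a x) (g.*ₗ-homo a x)) (≈ᴹ-sym (*ₗ-distribˡ a _ _)))
    where
    module f = _⟶ᴹ_ f
    module g = _⟶ᴹ_ g

  0ʰ : M ⟶ᴹ N
  0ʰ = 0-hom M N

  _•ʰ_ : Ring.Carrier A → M ⟶ᴹ N → M ⟶ᴹ N
  a •ʰ f = mkHom M N (λ x → h.⟦ a ⟧ *ₗ f.⟦ x ⟧)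
    (λ p → *ₗ-congˡ (f.⟦⟧-cong p))
    (λ x y → ≈ᴹ-trans (*ₗ-congˡ (f.+ᴹ-homo x y)) (*ₗ-distribˡ _ _ _))
    (λ b x → ≈ᴹ-trans (*ₗ-congˡ (f.*ₗ-homo b x)) (≈ᴹ-trans (≈ᴹ-sym (*ₗ-assoc _ b _))
      (≈ᴹ-trans (*ₗ-congʳ (h-central a b)) (*ₗ-assoc b _ _))))
    where module f = _⟶ᴹ_ f

  -ʰ_ : M ⟶ᴹ N → M ⟶ᴹ N
  -ʰ f = mkHom M N (λ x → -ᴹ f.⟦ x ⟧)
    (λ p → -ᴹ‿cong (f.⟦⟧-cong p))
    (λ x y → ≈ᴹ-trans (-ᴹ‿cong (f.+ᴹ-homo x y)) (≈ᴹ-sym (AbelianGroupProperties.⁻¹-∙-comm +ᴹ-abelianGroup _ _)))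
    (λ a x → ≈ᴹ-trans (-ᴹ‿cong (f.*ₗ-homo a x)) (≈ᴹ-sym (GroupProperties.inverseʳ-unique +ᴹ-group _ _
      (≈ᴹ-trans (≈ᴹ-sym (*ₗ-distribˡ a _ _)) (≈ᴹ-trans (*ₗ-congˡ (-ᴹ‿inverseʳ _)) (*ₗ-zeroʳ a))))))
    where module f = _⟶ᴹ_ f

  homModule : LeftModule A (r ⊔ m₁ ⊔ m₂ ⊔ ℓm₁ ⊔ ℓm₂) (m₁ ⊔ ℓm₂)
  homModule = record
    { Carrierᴹ = M ⟶ᴹ N
    ; _≈ᴹ_ = _≈ʰ_
    ; _+ᴹ_ = _+ʰ_
    ; _*ₗ_ = _•ʰ_
    ; 0ᴹ = 0ʰ
    ; -ᴹ_ = -ʰ_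
    ; isLeftModule = record
      { isLeftSemimodule = record
        { +ᴹ-isCommutativeMonoid = record
          { isMonoid = record
            { isSemigroup = record
              { isMagma = record
                { isEquivalence = record
                  { refl = λ _ → ≈ᴹ-refl ; sym = λ p x → ≈ᴹ-sym (p x) ; trans = λ p q x → ≈ᴹ-trans (p x) (q x) }
                ; ∙-cong = λ p q x → +ᴹ-cong (p x) (q x)
                }
              ; assoc = λ _ _ _ _ → +ᴹ-assoc _ _ _
              }
            ; identity = (λ _ _ → +ᴹ-identityˡ _) , (λ _ _ → +ᴹ-identityʳ _)
            }
          ; comm = λ _ _ _ → +ᴹ-comm _ _
          }
        ; isPreleftSemimodule = record
          { *ₗ-cong = λ p q x → hN.*ₗ-cong p (q x)
          ; *ₗ-zeroˡ = λ _ _ → hN.*ₗ-zeroˡ _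
          ; *ₗ-distribʳ = λ _ a b _ → hN.*ₗ-distribʳ _ a b
          ; *ₗ-identityˡ = λ _ _ → hN.*ₗ-identityˡ _
          ; *ₗ-assoc = λ a b _ _ → hN.*ₗ-assoc a b _
          ; *ₗ-zeroʳ = λ a _ → hN.*ₗ-zeroʳ a
          ; *ₗ-distribˡ = λ a _ _ _ → hN.*ₗ-distribˡ a _ _
          }
        }
      ; -ᴹ‿cong = λ p x → -ᴹ‿cong (p x)
      ; -ᴹ‿inverse = (λ _ _ → -ᴹ‿inverseˡ _) , (λ _ _ → -ᴹ‿inverseʳ _)
      }
    }

-- Yoneda Ext¹ in a class P of R-modules closed under extensions, as a module over A, for a ring
-- homomorphism h from A to the centre of R; a acts by pushout along multiplication by h(a).
module YonedaExt {c ℓ r ℓr m p : Level} {A : Ring c ℓ} {R : Ring r ℓr} (h : A ⟶ᴿ R)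
  (h-central : ∀ a b → Ring._≈_ R (Ring._*_ R (RingHomomorphism.⟦_⟧ h a) b) (Ring._*_ R b (RingHomomorphism.⟦_⟧ h a)))
  (P : LeftModule R m m → Set p)
  (P-extension : {L M N : LeftModule R m m} {f : L ⟶ᴹ M} {g : M ⟶ᴹ N} → ShortExact f g → P L → P N → P M)
  where

  record Object : Set (lsuc m ⊔ r ⊔ ℓr ⊔ p) where
    no-eta-equality
    constructor object
    field
      underlying : LeftModule R m m
      inClass    : P underlying
  open Object public

  private
    module Mod (M : Object) = LeftModule (underlying M)

  Hom : Object → Object → Set (r ⊔ m)
  Hom M N = underlying M ⟶ᴹ underlying N

  homModule : Object → Object → LeftModule A (r ⊔ m) m
  homModule M N = HomModule.homModule {A = A} {R = R} h h-central (underlying M) (underlying N)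

  -- Objects and extensions are defined by copatterns so that they are compared by their arguments.
  _⊕_ : Object → Object → Object
  (M ⊕ N) .underlying = DirectProduct.leftModule (underlying M) (underlying N)
  (M ⊕ N) .inClass    = P-extension (directProduct-shortExact (underlying M) (underlying N)) (inClass M) (inClass N)

  -- 0 → M → middle → N → 0
  record Extension (N M : Object) : Set (lsuc m ⊔ r ⊔ ℓr ⊔ p) where
    no-eta-equality
    field
      middle     : Object
      ι          : Hom M middle
      π          : Hom middle N
      shortExact : ShortExact ι π
    open ShortExact shortExact public
    open _⟶ᴹ_ ι public using () renaming (⟦_⟧ to ι⟦_⟧)
    open _⟶ᴹ_ π public using () renaming (⟦_⟧ to π⟦_⟧)

  extension : {L M N : Object} (f : Hom L M) (g : Hom M N) → ShortExact f g → Extension N L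
  extension {M = M} f g exact .Extension.middle     = M
  extension {M = M} f g exact .Extension.ι          = f
  extension {M = M} f g exact .Extension.π          = g
  extension {M = M} f g exact .Extension.shortExact = exact

  infix 4 _≋_

  record _≋_ {N M : Object} (E F : Extension N M) : Set (r ⊔ m) where
    private
      module E = Extension E
      module F = Extension F
    open LeftModule (underlying F.middle) using () renaming (_≈ᴹ_ to _≈F_)
    open LeftModule (underlying N) using () renaming (_≈ᴹ_ to _≈N_)
    field
      ⟦_⟧ : Mod.Carrierᴹ E.middle → Mod.Carrierᴹ F.middle
      isIsomorphism : IsLeftModuleIsomorphism (Mod.rawLeftModule E.middle) (Mod.rawLeftModule F.middle) ⟦_⟧
      commutes-ι : ∀ x → ⟦ E.ι⟦ x ⟧ ⟧ ≈F F.ι⟦ x ⟧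
      commutes-π : ∀ y → F.π⟦ ⟦ y ⟧ ⟧ ≈N E.π⟦ y ⟧
    open IsLeftModuleIsomorphism isIsomorphism public

  -- Homomorphisms of extensions over the identity of N and a given α : M → M′
  module _ {N : Object} where
    infix 4 _⇒_[_]

    record _⇒_[_] {M M′ : Object} (E : Extension N M) (F : Extension N M′) (α : Hom M M′) : Set (r ⊔ m) where
      private
        module E = Extension E
        module F = Extension F
        module α = _⟶ᴹ_ α
      open LeftModule (underlying F.middle) using () renaming (_≈ᴹ_ to _≈F_)
      open LeftModule (underlying N) using () renaming (_≈ᴹ_ to _≈N_)
      field
        hom : Hom E.middle F.middle
      open _⟶ᴹ_ hom public
      field
        commutes-ι : ∀ x → ⟦ E.ι⟦ x ⟧ ⟧ ≈F F.ι⟦ α.⟦ x ⟧ ⟧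
        commutes-π : ∀ y → F.π⟦ ⟦ y ⟧ ⟧ ≈N E.π⟦ y ⟧

    fiveLemma : ∀ {M} {E F : Extension N M} → E ⇒ F [ idᴹ (underlying M) ] → E ≋ F
    fiveLemma {M} {E} {F} u = record
      { ⟦_⟧ = u.⟦_⟧
      ; isIsomorphism = record
        { isLeftModuleMonomorphism = record
          { isLeftModuleHomomorphism = u.isLeftModuleHomomorphism
          ; injective = injective
          }
        ; surjective = strictly⇒surjective u.hom strictlySurjective
        }
      ; commutes-ι = u.commutes-ι
      ; commutes-π = u.commutes-π
      }
      where
      module E = Extension E
      module F = Extension F
      module u = _⇒_[_] u
      module ι = _⟶ᴹ_ F.ι
      module ιE = _⟶ᴹ_ E.ι
      module πE = _⟶ᴹ_ E.π
      module π = _⟶ᴹ_ F.π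
      module X = Mod E.middle
      module Y = Mod F.middle
      module N = Mod N
      module M = Mod M

      kernel : ∀ {x} → u.⟦ x ⟧ Y.≈ᴹ Y.0ᴹ → x X.≈ᴹ X.0ᴹ
      kernel {x} ux≈0 =
        let n , ιn≈x = E.kernel⊆image (N.≈ᴹ-trans (N.≈ᴹ-sym (u.commutes-π x)) (N.≈ᴹ-trans (π.⟦⟧-cong ux≈0) π.0ᴹ-homo))
            n≈0 = F.injective (Y.≈ᴹ-trans (Y.≈ᴹ-sym (u.commutes-ι n)) (Y.≈ᴹ-trans (u.⟦⟧-cong ιn≈x)
                    (Y.≈ᴹ-trans ux≈0 (Y.≈ᴹ-sym ι.0ᴹ-homo))))
        in X.≈ᴹ-trans (X.≈ᴹ-sym ιn≈x) (X.≈ᴹ-trans (ιE.⟦⟧-cong n≈0) ιE.0ᴹ-homo)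

      injective : Injective X._≈ᴹ_ Y._≈ᴹ_ u.⟦_⟧
      injective {x} {y} ux≈uy = GroupProperties.x∙y⁻¹≈ε⇒x≈y X.+ᴹ-group x y (kernel
        (Y.≈ᴹ-trans (u.+ᴹ-homo x _) (Y.≈ᴹ-trans (Y.+ᴹ-cong ux≈uy (u.-ᴹ-homo y)) (Y.-ᴹ‿inverseʳ _))))

      strictlySurjective : ∀ y → ∃ λ x → u.⟦ x ⟧ Y.≈ᴹ y
      strictlySurjective y =
        let x₀ = E.lift F.π⟦ y ⟧
            n , ιn≈d = F.kernel⊆image {u.⟦ X.-ᴹ x₀ ⟧ Y.+ᴹ y}
              (N.≈ᴹ-trans (π.+ᴹ-homo _ _)
              (N.≈ᴹ-trans (N.+ᴹ-congʳ (N.≈ᴹ-trans (u.commutes-π _) (N.≈ᴹ-trans (πE.-ᴹ-homo x₀) (N.-ᴹ‿cong (E.g-lift _)))))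
              (N.-ᴹ‿inverseˡ _)))
        in x₀ X.+ᴹ E.ι⟦ n ⟧ , (let open SetoidReasoning Y.≈ᴹ-setoid in begin
             u.⟦ x₀ X.+ᴹ E.ι⟦ n ⟧ ⟧                     ≈⟨ u.+ᴹ-homo _ _ ⟩
             u.⟦ x₀ ⟧ Y.+ᴹ u.⟦ E.ι⟦ n ⟧ ⟧               ≈⟨ Y.+ᴹ-congˡ (Y.≈ᴹ-trans (u.commutes-ι n) ιn≈d) ⟩
             u.⟦ x₀ ⟧ Y.+ᴹ (u.⟦ X.-ᴹ x₀ ⟧ Y.+ᴹ y)       ≈⟨ Y.+ᴹ-assoc _ _ _ ⟨
             u.⟦ x₀ ⟧ Y.+ᴹ u.⟦ X.-ᴹ x₀ ⟧ Y.+ᴹ y         ≈⟨ Y.+ᴹ-congʳ (Y.+ᴹ-congˡ (u.-ᴹ-homo x₀)) ⟩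
             u.⟦ x₀ ⟧ Y.+ᴹ Y.-ᴹ u.⟦ x₀ ⟧ Y.+ᴹ y         ≈⟨ Y.+ᴹ-congʳ (Y.-ᴹ‿inverseʳ _) ⟩
             Y.0ᴹ Y.+ᴹ y                                ≈⟨ Y.+ᴹ-identityˡ y ⟩
             y                                          ∎)

    ≋⇒ : ∀ {M} {E F : Extension N M} → E ≋ F → E ⇒ F [ idᴹ (underlying M) ]
    ≋⇒ e = record
      { hom = record { isLeftModuleHomomorphism = e.isLeftModuleHomomorphism }
      ; commutes-ι = e.commutes-ι
      ; commutes-π = e.commutes-π
      }
      where module e = _≋_ e

    ⇒-trans : ∀ {M M′ M″} {E : Extension N M} {F : Extension N M′} {G : Extension N M″} {α : Hom M M′} {β : Hom M′ M″} →
              E ⇒ F [ α ] → F ⇒ G [ β ] → E ⇒ G [ β ∘ᴹ α ]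
    ⇒-trans {G = G} {α = α} u v = record
      { hom = v.hom ∘ᴹ u.hom
      ; commutes-ι = λ x → Mod.≈ᴹ-trans (Extension.middle G) (v.⟦⟧-cong (u.commutes-ι x)) (v.commutes-ι (_⟶ᴹ_.⟦_⟧ α x))
      ; commutes-π = λ y → Mod.≈ᴹ-trans N (v.commutes-π _) (u.commutes-π y)
      }
      where
      module u = _⇒_[_] u
      module v = _⇒_[_] v

    ⇒-resp : ∀ {M M′} {E : Extension N M} {F : Extension N M′} (α β : Hom M M′) →
             (∀ x → Mod._≈ᴹ_ M′ (_⟶ᴹ_.⟦_⟧ α x) (_⟶ᴹ_.⟦_⟧ β x)) → E ⇒ F [ α ] → E ⇒ F [ β ]
    ⇒-resp {F = F} α β α≈β u = record
      { hom = u.hom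
      ; commutes-ι = λ x → Mod.≈ᴹ-trans (Extension.middle F) (u.commutes-ι x) (_⟶ᴹ_.⟦⟧-cong (Extension.ι F) (α≈β x))
      ; commutes-π = u.commutes-π
      }
      where module u = _⇒_[_] u

    ⇒-refl : ∀ {M} {E : Extension N M} → E ⇒ E [ idᴹ (underlying M) ]
    ⇒-refl {E = E} = record
      { hom = idᴹ (underlying (Extension.middle E))
      ; commutes-ι = λ _ → Mod.≈ᴹ-refl (Extension.middle E)
      ; commutes-π = λ _ → Mod.≈ᴹ-refl N
      }

    ≋-refl : ∀ {M} {E : Extension N M} → E ≋ E
    ≋-refl = fiveLemma ⇒-refl

    ≋-trans : ∀ {M} {E F G : Extension N M} → E ≋ F → F ≋ G → E ≋ G
    ≋-trans {M} p q = fiveLemma (⇒-resp (idᴹ (underlying M) ∘ᴹ idᴹ (underlying M)) (idᴹ (underlying M)) (λ _ → Mod.≈ᴹ-refl M)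
      (⇒-trans (≋⇒ p) (≋⇒ q)))

    ≋-sym : ∀ {M} {E F : Extension N M} → E ≋ F → F ≋ E
    ≋-sym {M} {E} {F} e = fiveLemma record
      { hom = mkHom (underlying F.middle) (underlying E.middle) inv
          (λ {x} {y} p → e.injective (Y.≈ᴹ-trans (e-inv x) (Y.≈ᴹ-trans p (Y.≈ᴹ-sym (e-inv y)))))
          (λ x y → e.injective (Y.≈ᴹ-trans (e-inv _) (Y.≈ᴹ-sym (Y.≈ᴹ-trans (e.+ᴹ-homo _ _) (Y.+ᴹ-cong (e-inv x) (e-inv y))))))
          (λ a x → e.injective (Y.≈ᴹ-trans (e-inv _) (Y.≈ᴹ-sym (Y.≈ᴹ-trans (e.*ₗ-homo _ _) (Y.*ₗ-congˡ (e-inv x))))))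
      ; commutes-ι = λ x → e.injective (Y.≈ᴹ-trans (e-inv _) (Y.≈ᴹ-sym (e.commutes-ι x)))
      ; commutes-π = λ y → N.≈ᴹ-trans (N.≈ᴹ-sym (e.commutes-π (inv y))) (_⟶ᴹ_.⟦⟧-cong F.π (e-inv y))
      }
      where
      module E = Extension E
      module F = Extension F
      module e = _≋_ e
      module N = Mod N
      module Y = Mod F.middle

      inv : Y.Carrierᴹ → Mod.Carrierᴹ E.middle
      inv y = proj₁ (e.surjective y)

      e-inv : ∀ y → e.⟦ inv y ⟧ Y.≈ᴹ y
      e-inv y = proj₂ (e.surjective y) (Mod.≈ᴹ-refl E.middle)

  split : (N M : Object) → Extension N M
  split N M .Extension.middle     = M ⊕ N
  split N M .Extension.ι          = pairᴹ (idᴹ (underlying M)) (0-hom (underlying M) (underlying N))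
  split N M .Extension.π          = sndᴹ (underlying M) (underlying N)
  split N M .Extension.shortExact = directProduct-shortExact (underlying M) (underlying N)

  -- The pushout of M′ ← M → E
  module _ {N M M′ : Object} (α : Hom M M′) (E : Extension N M) where
    private
      module E = Extension E
      module M = Mod M
      module M′ = Mod M′
      module X = Mod E.middle
      module N = Mod N
      module α = _⟶ᴹ_ α
      module ι = _⟶ᴹ_ E.ι
      module π = _⟶ᴹ_ E.π
      module X- = GroupProperties X.+ᴹ-group

    antidiagonal : underlying M ⟶ᴹ DirectProduct.leftModule (underlying M′) (underlying E.middle)
    antidiagonal = pairᴹ α (HomModule.-ʰ_ {A = A} {R = R} h h-central (underlying M) (underlying E.middle) E.ι)

    private
      pushout : LeftModule R m m
      pushout = cokernel antidiagonal

      module Q = LeftModule pushout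

      ≈⇒Q : ∀ {a a′ x x′} → a M′.≈ᴹ a′ → x X.≈ᴹ x′ → (a , x) Q.≈ᴹ (a′ , x′)
      ≈⇒Q p q = M.0ᴹ ,
        M′.≈ᴹ-trans p (M′.≈ᴹ-trans (M′.≈ᴹ-sym (M′.+ᴹ-identityʳ _)) (M′.+ᴹ-congˡ (M′.≈ᴹ-sym α.0ᴹ-homo))) ,
        X.≈ᴹ-trans q (X.≈ᴹ-trans (X.≈ᴹ-sym (X.+ᴹ-identityʳ _))
          (X.+ᴹ-congˡ (X.≈ᴹ-sym (X.≈ᴹ-trans (X.-ᴹ‿cong ι.0ᴹ-homo) X-.ε⁻¹≈ε))))

      ιᵖ : underlying M′ ⟶ᴹ pushout
      ιᵖ = mkHom (underlying M′) pushout (λ a → a , X.0ᴹ)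
        (λ p → ≈⇒Q p X.≈ᴹ-refl)
        (λ _ _ → ≈⇒Q M′.≈ᴹ-refl (X.≈ᴹ-sym (X.+ᴹ-identityʳ _)))
        (λ b _ → ≈⇒Q M′.≈ᴹ-refl (X.≈ᴹ-sym (X.*ₗ-zeroʳ b)))

      π-shift : ∀ x n → π.⟦ x X.+ᴹ X.-ᴹ ι.⟦ n ⟧ ⟧ N.≈ᴹ π.⟦ x ⟧
      π-shift x n = N.≈ᴹ-trans (π.+ᴹ-homo _ _) (N.≈ᴹ-trans
        (N.+ᴹ-congˡ (N.≈ᴹ-trans (π.-ᴹ-homo _) (N.≈ᴹ-trans (N.-ᴹ‿cong (E.g∘f≈0 n)) (GroupProperties.ε⁻¹≈ε N.+ᴹ-group))))
        (N.+ᴹ-identityʳ _))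

      πᵖ : pushout ⟶ᴹ underlying N
      πᵖ = mkHom pushout (underlying N) (λ (_ , x) → π.⟦ x ⟧)
        (λ (n , _ , q) → N.≈ᴹ-trans (π.⟦⟧-cong q) (π-shift _ n))
        (λ _ _ → π.+ᴹ-homo _ _)
        (λ _ _ → π.*ₗ-homo _ _)

      pushout-shortExact : ShortExact ιᵖ πᵖ
      pushout-shortExact = record
        { injective = λ (n , p , q) → M′.≈ᴹ-trans p (M′.≈ᴹ-trans (M′.+ᴹ-congˡ (M′.≈ᴹ-trans
            (α.⟦⟧-cong (E.injective (X.≈ᴹ-trans (zero-from n q) (X.≈ᴹ-sym ι.0ᴹ-homo)))) α.0ᴹ-homo)) (M′.+ᴹ-identityʳ _))
        ; exact = λ (a , x) → mk⇔
            (λ πx≈0 → let n , ιn≈x = E.kernel⊆image πx≈0 in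
              a M′.+ᴹ α.⟦ n ⟧ , n , M′.≈ᴹ-refl ,
              X.≈ᴹ-sym (X.≈ᴹ-trans (X.+ᴹ-congˡ (X.-ᴹ‿cong ιn≈x)) (X.-ᴹ‿inverseʳ x)))
            (λ (_ , n , _ , q) → N.≈ᴹ-trans (N.≈ᴹ-sym (π-shift x n)) (N.≈ᴹ-trans (π.⟦⟧-cong (X.≈ᴹ-sym q)) π.0ᴹ-homo))
        ; surjective = strictly⇒surjective πᵖ λ y → (M′.0ᴹ , E.lift y) , E.g-lift y
        }
        where
        zero-from : ∀ n → X.0ᴹ X.≈ᴹ X.0ᴹ X.+ᴹ X.-ᴹ ι.⟦ n ⟧ → ι.⟦ n ⟧ X.≈ᴹ X.0ᴹ
        zero-from n q = X.≈ᴹ-sym (X-.x∙y⁻¹≈ε⇒x≈y _ _ (X.≈ᴹ-sym q))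

    pushObject : Object
    pushObject .underlying = pushout
    pushObject .inClass    = P-extension pushout-shortExact (inClass M′) (inClass N)

    push : Extension N M′
    push .Extension.middle     = pushObject
    push .Extension.ι          = ιᵖ
    push .Extension.π          = πᵖ
    push .Extension.shortExact = pushout-shortExact

    push-unit : E ⇒ push [ α ]
    push-unit = record
      { hom = mkHom (underlying E.middle) pushout (λ x → M′.0ᴹ , x)
          (λ p → ≈⇒Q M′.≈ᴹ-refl p)
          (λ _ _ → ≈⇒Q (M′.≈ᴹ-sym (M′.+ᴹ-identityʳ _)) X.≈ᴹ-refl)
          (λ b _ → ≈⇒Q (M′.≈ᴹ-sym (M′.*ₗ-zeroʳ b)) X.≈ᴹ-refl)
      ; commutes-ι = λ n → M.-ᴹ n ,
          M′.≈ᴹ-sym (M′.≈ᴹ-trans (M′.+ᴹ-congˡ (α.-ᴹ-homo n)) (M′.-ᴹ‿inverseʳ _)) ,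
          X.≈ᴹ-sym (X.≈ᴹ-trans (X.+ᴹ-identityˡ _) (X.≈ᴹ-trans (X.-ᴹ‿cong (ι.-ᴹ-homo n)) (X-.⁻¹-involutive _)))
      ; commutes-π = λ _ → N.≈ᴹ-refl
      }

    push-universal : {F : Extension N M′} → E ⇒ F [ α ] → push ≋ F
    push-universal {F} u = fiveLemma record
      { hom = mkHom pushout (underlying F.middle) (λ (a , x) → F.ι⟦ a ⟧ Y.+ᴹ u.⟦ x ⟧)
          (λ {(a , x)} {(a′ , x′)} (n , p , q) → begin
            F.ι⟦ a ⟧ Y.+ᴹ u.⟦ x ⟧
              ≈⟨ Y.+ᴹ-cong (ιF.⟦⟧-cong p) (u.⟦⟧-cong q) ⟩
            F.ι⟦ a′ M′.+ᴹ α.⟦ n ⟧ ⟧ Y.+ᴹ u.⟦ x′ X.+ᴹ X.-ᴹ ι.⟦ n ⟧ ⟧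
              ≈⟨ Y.+ᴹ-cong (ιF.+ᴹ-homo _ _) (Y.≈ᴹ-trans (u.+ᴹ-homo _ _) (Y.+ᴹ-congˡ (u.-ᴹ-homo _))) ⟩
            (F.ι⟦ a′ ⟧ Y.+ᴹ F.ι⟦ α.⟦ n ⟧ ⟧) Y.+ᴹ (u.⟦ x′ ⟧ Y.+ᴹ Y.-ᴹ u.⟦ ι.⟦ n ⟧ ⟧)
              ≈⟨ interchange _ _ _ _ ⟩
            (F.ι⟦ a′ ⟧ Y.+ᴹ u.⟦ x′ ⟧) Y.+ᴹ (F.ι⟦ α.⟦ n ⟧ ⟧ Y.+ᴹ Y.-ᴹ u.⟦ ι.⟦ n ⟧ ⟧)
              ≈⟨ Y.+ᴹ-congˡ (Y.≈ᴹ-trans (Y.+ᴹ-congˡ (Y.-ᴹ‿cong (u.commutes-ι n))) (Y.-ᴹ‿inverseʳ _)) ⟩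
            (F.ι⟦ a′ ⟧ Y.+ᴹ u.⟦ x′ ⟧) Y.+ᴹ Y.0ᴹ
              ≈⟨ Y.+ᴹ-identityʳ _ ⟩
            F.ι⟦ a′ ⟧ Y.+ᴹ u.⟦ x′ ⟧ ∎)
          (λ _ _ → Y.≈ᴹ-trans (Y.+ᴹ-cong (ιF.+ᴹ-homo _ _) (u.+ᴹ-homo _ _)) (interchange _ _ _ _))
          (λ _ _ → Y.≈ᴹ-trans (Y.+ᴹ-cong (ιF.*ₗ-homo _ _) (u.*ₗ-homo _ _)) (Y.≈ᴹ-sym (Y.*ₗ-distribˡ _ _ _)))
      ; commutes-ι = λ _ → Y.≈ᴹ-trans (Y.+ᴹ-congˡ u.0ᴹ-homo) (Y.+ᴹ-identityʳ _)
      ; commutes-π = λ _ → N.≈ᴹ-trans (πF.+ᴹ-homo _ _) (N.≈ᴹ-trans (N.+ᴹ-cong (F.g∘f≈0 _) (u.commutes-π _)) (N.+ᴹ-identityˡ _))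
      }
      where
      module F = Extension F
      module ιF = _⟶ᴹ_ F.ι
      module πF = _⟶ᴹ_ F.π
      module u = _⇒_[_] u
      module Y = Mod F.middle
      open SetoidReasoning Y.≈ᴹ-setoid
      open import Algebra.Properties.CommutativeSemigroup (AbelianGroup.commutativeSemigroup Y.+ᴹ-abelianGroup) using (interchange)

  ⇒-unique : ∀ {N M M′} {E : Extension N M} {F G : Extension N M′} {α β : Hom M M′} →
             E ⇒ F [ α ] → E ⇒ G [ β ] → (∀ x → Mod._≈ᴹ_ M′ (_⟶ᴹ_.⟦_⟧ α x) (_⟶ᴹ_.⟦_⟧ β x)) → F ≋ G
  ⇒-unique {N} {M} {M′} {E} {F} {G} {α} {β} u v α≈β = ≋-trans (≋-sym (push-universal {N} {M} {M′} α E u))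
    (push-universal {N} {M} {M′} α E (⇒-resp β α (λ x → Mod.≈ᴹ-sym M′ (α≈β x)) v))

  -- The pullback of E → N ← N′
  module _ {N N′ M : Object} (γ : Hom N′ N) (E : Extension N M) where
    private
      module E = Extension E
      module M = Mod M
      module X = Mod E.middle
      module N = Mod N
      module N′ = Mod N′
      module γ = _⟶ᴹ_ γ
      module ι = _⟶ᴹ_ E.ι
      module π = _⟶ᴹ_ E.π

      ι′ : underlying M ⟶ᴹ fibreProduct E.π γ
      ι′ = mkHom (underlying M) (fibreProduct E.π γ)
        (λ x → (ι.⟦ x ⟧ , N′.0ᴹ) , N.≈ᴹ-trans (E.g∘f≈0 x) (N.≈ᴹ-sym γ.0ᴹ-homo))
        (λ p → ι.⟦⟧-cong p , N′.≈ᴹ-refl)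
        (λ x y → ι.+ᴹ-homo x y , N′.≈ᴹ-sym (N′.+ᴹ-identityʳ _))
        (λ a x → ι.*ₗ-homo a x , N′.≈ᴹ-sym (N′.*ₗ-zeroʳ a))

      π′ : fibreProduct E.π γ ⟶ᴹ underlying N′
      π′ = mkHom (fibreProduct E.π γ) (underlying N′) (λ ((_ , y) , _) → y)
        proj₂ (λ _ _ → N′.≈ᴹ-refl) (λ _ _ → N′.≈ᴹ-refl)

      isShortExact : ShortExact ι′ π′
      isShortExact = record
        { injective = λ (p , _) → E.injective p
        ; exact = λ ((x , y) , πx≈γy) → mk⇔
            (λ y≈0 → let n , ιn≈x = E.kernel⊆image (N.≈ᴹ-trans πx≈γy (N.≈ᴹ-trans (γ.⟦⟧-cong y≈0) γ.0ᴹ-homo))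
                     in n , ιn≈x , N′.≈ᴹ-sym y≈0)
            (λ (_ , _ , 0≈y) → N′.≈ᴹ-sym 0≈y)
        ; surjective = λ y → ((E.lift γ.⟦ y ⟧ , y) , E.g-lift γ.⟦ y ⟧) , proj₂
        }

    pullObject : Object
    pullObject .underlying = fibreProduct E.π γ
    pullObject .inClass    = P-extension isShortExact (inClass M) (inClass N′)

    pull : Extension N′ M
    pull .Extension.middle     = pullObject
    pull .Extension.ι          = ι′
    pull .Extension.π          = π′
    pull .Extension.shortExact = isShortExact

  -- The fibre product of two extensions of N: the pullback of their direct sum along N → N ⊕ N
  module _ {N M M′ : Object} (E : Extension N M) (F : Extension N M′) where
    private
      module E = Extension E
      module F = Extension F
      module N = Mod N
      module ιE = _⟶ᴹ_ E.ι
      module πE = _⟶ᴹ_ E.π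
      module ιF = _⟶ᴹ_ F.ι
      module πF = _⟶ᴹ_ F.π

      ι⊠ : underlying (M ⊕ M′) ⟶ᴹ fibreProduct E.π F.π
      ι⊠ = mkHom (underlying (M ⊕ M′)) (fibreProduct E.π F.π)
        (λ (x , y) → (ιE.⟦ x ⟧ , ιF.⟦ y ⟧) , N.≈ᴹ-trans (E.g∘f≈0 x) (N.≈ᴹ-sym (F.g∘f≈0 y)))
        (λ (p , q) → ιE.⟦⟧-cong p , ιF.⟦⟧-cong q)
        (λ _ _ → ιE.+ᴹ-homo _ _ , ιF.+ᴹ-homo _ _)
        (λ _ _ → ιE.*ₗ-homo _ _ , ιF.*ₗ-homo _ _)

      π⊠ : fibreProduct E.π F.π ⟶ᴹ underlying N
      π⊠ = mkHom (fibreProduct E.π F.π) (underlying N) (λ ((x , _) , _) → πE.⟦ x ⟧)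
        (λ (p , _) → πE.⟦⟧-cong p) (λ _ _ → πE.+ᴹ-homo _ _) (λ _ _ → πE.*ₗ-homo _ _)

      isShortExact : ShortExact ι⊠ π⊠
      isShortExact = record
        { injective = λ (p , q) → E.injective p , F.injective q
        ; exact = λ ((x , y) , πx≈πy) → mk⇔
            (λ πx≈0 → let n , ιn≈x = E.kernel⊆image πx≈0
                          n′ , ιn′≈y = F.kernel⊆image (N.≈ᴹ-trans (N.≈ᴹ-sym πx≈πy) πx≈0)
                      in (n , n′) , ιn≈x , ιn′≈y)
            (λ ((n , _) , ιn≈x , _) → N.≈ᴹ-trans (πE.⟦⟧-cong (Mod.≈ᴹ-sym E.middle ιn≈x)) (E.g∘f≈0 n))
        ; surjective = strictly⇒surjective π⊠ λ y →
            ((E.lift y , F.lift y) , N.≈ᴹ-trans (E.g-lift y) (N.≈ᴹ-sym (F.g-lift y))) , E.g-lift y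
        }

    fibreObject : Object
    fibreObject .underlying = fibreProduct E.π F.π
    fibreObject .inClass    = P-extension isShortExact (inClass (M ⊕ M′)) (inClass N)

    infixl 7 _⊠_

    _⊠_ : Extension N (M ⊕ M′)
    _⊠_ .Extension.middle     = fibreObject
    _⊠_ .Extension.ι          = ι⊠
    _⊠_ .Extension.π          = π⊠
    _⊠_ .Extension.shortExact = isShortExact

  module _ (N M : Object) where
    private
      module N = Mod N
      module M = Mod M
      module h = RingHomomorphism h
      module EndM = HomModule {A = A} {R = R} h h-central (underlying M) (underlying M)

      id : Hom M M
      id = idᴹ (underlying M)

      sumMap : Hom (M ⊕ M) M
      sumMap = HomModule._+ʰ_ {A = A} {R = R} h h-central (underlying (M ⊕ M)) (underlying M)
        (fstᴹ (underlying M) (underlying M)) (sndᴹ (underlying M) (underlying M))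

    infixl 6 _+ᴱ_
    infix  8 -ᴱ_
    infixr 7 _•ᴱ_

    -- Baer sum: push out along M ⊕ M → M the pullback along N → N ⊕ N of the direct sum.
    _+ᴱ_ : Extension N M → Extension N M → Extension N M
    E +ᴱ F = push {N} {M ⊕ M} {M} sumMap (E ⊠ F)

    0ᴱ : Extension N M
    0ᴱ = split N M

    -ᴱ_ : Extension N M → Extension N M
    -ᴱ E = push {N} {M} {M} (EndM.-ʰ id) E

    _•ᴱ_ : Ring.Carrier A → Extension N M → Extension N M
    a •ᴱ E = push {N} {M} {M} (a EndM.•ʰ id) E

    module _ {K L L′ : Object} {G : Extension N K} {E : Extension N L} {F : Extension N L′}
             {α : Hom K L} {β : Hom K L′} where
      pair : G ⇒ E [ α ] → G ⇒ F [ β ] → G ⇒ E ⊠ F [ pairᴹ α β ]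
      pair u v = record
        { hom = mkHom (underlying (Extension.middle G)) (underlying (Extension.middle (E ⊠ F)))
            (λ x → (u.⟦ x ⟧ , v.⟦ x ⟧) , N.≈ᴹ-trans (u.commutes-π x) (N.≈ᴹ-sym (v.commutes-π x)))
            (λ p → u.⟦⟧-cong p , v.⟦⟧-cong p) (λ _ _ → u.+ᴹ-homo _ _ , v.+ᴹ-homo _ _) (λ _ _ → u.*ₗ-homo _ _ , v.*ₗ-homo _ _)
        ; commutes-ι = λ x → u.commutes-ι x , v.commutes-ι x
        ; commutes-π = u.commutes-π
        }
        where
        module u = _⇒_[_] u
        module v = _⇒_[_] v

    module _ {L L′ : Object} (E : Extension N L) (F : Extension N L′) where
      first : E ⊠ F ⇒ E [ fstᴹ (underlying L) (underlying L′) ]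
      first = record
        { hom = mkHom (underlying (Extension.middle (E ⊠ F))) (underlying (Extension.middle E)) (λ ((x , _) , _) → x)
            proj₁ (λ _ _ → Mod.≈ᴹ-refl (Extension.middle E)) (λ _ _ → Mod.≈ᴹ-refl (Extension.middle E))
        ; commutes-ι = λ _ → Mod.≈ᴹ-refl (Extension.middle E)
        ; commutes-π = λ _ → N.≈ᴹ-refl
        }

      second : E ⊠ F ⇒ F [ sndᴹ (underlying L) (underlying L′) ]
      second = record
        { hom = mkHom (underlying (Extension.middle (E ⊠ F))) (underlying (Extension.middle F)) (λ ((_ , y) , _) → y)
            proj₂ (λ _ _ → Mod.≈ᴹ-refl (Extension.middle F)) (λ _ _ → Mod.≈ᴹ-refl (Extension.middle F))
        ; commutes-ι = λ _ → Mod.≈ᴹ-refl (Extension.middle F)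
        ; commutes-π = λ (_ , πx≈πy) → N.≈ᴹ-sym πx≈πy
        }

    sum : (E F : Extension N M) → E ⊠ F ⇒ E +ᴱ F [ sumMap ]
    sum E F = push-unit {N} {M ⊕ M} {M} sumMap (E ⊠ F)

    scale : ∀ a (E : Extension N M) → E ⇒ a •ᴱ E [ a EndM.•ʰ id ]
    scale a E = push-unit {N} {M} {M} (a EndM.•ʰ id) E

    negate : (E : Extension N M) → E ⇒ -ᴱ E [ EndM.-ʰ id ]
    negate E = push-unit {N} {M} {M} (EndM.-ʰ id) E

    toSplit : (E : Extension N M) → E ⇒ 0ᴱ [ EndM.0ʰ ]
    toSplit E = record
      { hom = pairᴹ (0-hom (underlying (Extension.middle E)) (underlying M)) (Extension.π E)
      ; commutes-ι = λ x → M.≈ᴹ-refl , Extension.g∘f≈0 E x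
      ; commutes-π = λ _ → N.≈ᴹ-refl
      }

    +ᴱ-cong : ∀ {E E′ F F′ : Extension N M} → E ≋ E′ → F ≋ F′ → E +ᴱ F ≋ E′ +ᴱ F′
    +ᴱ-cong {E} {E′} {F} {F′} p q = ⇒-unique (sum E F)
      (⇒-trans (pair (⇒-trans (first E F) (≋⇒ p)) (⇒-trans (second E F) (≋⇒ q))) (sum E′ F′))
      (λ _ → M.≈ᴹ-refl)

    +ᴱ-assoc : ∀ E F G → (E +ᴱ F) +ᴱ G ≋ E +ᴱ (F +ᴱ G)
    +ᴱ-assoc E F G = ⇒-unique (⇒-trans (pair (⇒-trans (first (E ⊠ F) G) (sum E F)) (second (E ⊠ F) G)) (sum (E +ᴱ F) G))
      (⇒-trans (pair (⇒-trans (first (E ⊠ F) G) (first E F))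
                     (⇒-trans (pair (⇒-trans (first (E ⊠ F) G) (second E F)) (second (E ⊠ F) G)) (sum F G)))
               (sum E (F +ᴱ G)))
      (λ _ → M.+ᴹ-assoc _ _ _)

    +ᴱ-comm : ∀ E F → E +ᴱ F ≋ F +ᴱ E
    +ᴱ-comm E F = ⇒-unique (sum E F) (⇒-trans (pair (second E F) (first E F)) (sum F E))
      (λ _ → M.+ᴹ-comm _ _)

    +ᴱ-identityˡ : ∀ E → 0ᴱ +ᴱ E ≋ E
    +ᴱ-identityˡ E = ⇒-unique (⇒-trans (pair (toSplit E) ⇒-refl) (sum 0ᴱ E)) ⇒-refl
      (λ _ → M.+ᴹ-identityˡ _)

    -ᴱ-inverseˡ : ∀ E → -ᴱ E +ᴱ E ≋ 0ᴱ
    -ᴱ-inverseˡ E = ⇒-unique (⇒-trans (pair (negate E) ⇒-refl) (sum (-ᴱ E) E)) (toSplit E)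
      (λ _ → M.-ᴹ‿inverseˡ _)

    -ᴱ-cong : ∀ {E F : Extension N M} → E ≋ F → -ᴱ E ≋ -ᴱ F
    -ᴱ-cong {E} {F} p = ⇒-unique (negate E) (⇒-trans (≋⇒ p) (negate F))
      (λ _ → M.≈ᴹ-refl)

    •ᴱ-cong : ∀ {a b} {E F : Extension N M} → Ring._≈_ A a b → E ≋ F → a •ᴱ E ≋ b •ᴱ F
    •ᴱ-cong {a} {b} {E} {F} a≈b p = ⇒-unique (scale a E) (⇒-trans (≋⇒ p) (scale b F))
      (λ _ → M.*ₗ-congʳ (h.⟦⟧-cong a≈b))

    •ᴱ-zeroˡ : ∀ E → Ring.0# A •ᴱ E ≋ 0ᴱ
    •ᴱ-zeroˡ E = ⇒-unique (scale _ E) (toSplit E)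
      (λ _ → M.≈ᴹ-trans (M.*ₗ-congʳ h.0#-homo) (M.*ₗ-zeroˡ _))

    •ᴱ-distribʳ : ∀ E a b → Ring._+_ A a b •ᴱ E ≋ a •ᴱ E +ᴱ b •ᴱ E
    •ᴱ-distribʳ E a b = ⇒-unique (scale _ E)
      (⇒-trans (pair (scale a E) (scale b E)) (sum (a •ᴱ E) (b •ᴱ E)))
      (λ _ → M.≈ᴹ-trans (M.*ₗ-congʳ (h.+-homo a b)) (M.*ₗ-distribʳ _ _ _))

    •ᴱ-identity : ∀ E → Ring.1# A •ᴱ E ≋ E
    •ᴱ-identity E = ⇒-unique (scale _ E) ⇒-refl
      (λ _ → M.≈ᴹ-trans (M.*ₗ-congʳ h.1#-homo) (M.*ₗ-identityˡ _))

    •ᴱ-assoc : ∀ a b E → Ring._*_ A a b •ᴱ E ≋ a •ᴱ b •ᴱ E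
    •ᴱ-assoc a b E = ⇒-unique (scale _ E)
      (⇒-trans (scale b E) (scale a (b •ᴱ E)))
      (λ _ → M.≈ᴹ-trans (M.*ₗ-congʳ (h.*-homo a b)) (M.*ₗ-assoc _ _ _))

    •ᴱ-zeroʳ : ∀ a → a •ᴱ 0ᴱ ≋ 0ᴱ
    •ᴱ-zeroʳ a = ⇒-unique (scale a 0ᴱ) scaleSplit (λ _ → M.≈ᴹ-refl)
      where
      scaleSplit : 0ᴱ ⇒ 0ᴱ [ a EndM.•ʰ id ]
      scaleSplit = record
        { hom = pairᴹ ((a EndM.•ʰ id) ∘ᴹ fstᴹ (underlying M) (underlying N)) (sndᴹ (underlying M) (underlying N))
        ; commutes-ι = λ _ → M.≈ᴹ-refl , N.≈ᴹ-refl
        ; commutes-π = λ _ → N.≈ᴹ-refl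
        }

    •ᴱ-distribˡ : ∀ a E F → a •ᴱ (E +ᴱ F) ≋ a •ᴱ E +ᴱ a •ᴱ F
    •ᴱ-distribˡ a E F = ⇒-unique (⇒-trans (sum E F) (scale a (E +ᴱ F)))
      (⇒-trans (pair (⇒-trans (first E F) (scale a E)) (⇒-trans (second E F) (scale a F))) (sum (a •ᴱ E) (a •ᴱ F)))
      (λ _ → M.*ₗ-distribˡ _ _ _)

    +ᴱ-identityʳ : ∀ E → E +ᴱ 0ᴱ ≋ E
    +ᴱ-identityʳ E = ≋-trans (+ᴱ-comm E 0ᴱ) (+ᴱ-identityˡ E)

    -ᴱ-inverseʳ : ∀ E → E +ᴱ -ᴱ E ≋ 0ᴱ
    -ᴱ-inverseʳ E = ≋-trans (+ᴱ-comm E (-ᴱ E)) (-ᴱ-inverseˡ E)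

    +ᴱ-isCommutativeMonoid : IsCommutativeMonoid (_≋_ {N} {M}) _+ᴱ_ 0ᴱ
    +ᴱ-isCommutativeMonoid = record
      { isMonoid = record
        { isSemigroup = record
          { isMagma = record
            { isEquivalence = record { refl = ≋-refl ; sym = ≋-sym ; trans = ≋-trans }
            ; ∙-cong = +ᴱ-cong
            }
          ; assoc = +ᴱ-assoc
          }
        ; identity = +ᴱ-identityˡ , +ᴱ-identityʳ
        }
      ; comm = +ᴱ-comm
      }

    •ᴱ-isPreleftSemimodule : IsPreleftSemimodule (Ring.semiring A) (_≋_ {N} {M}) _+ᴱ_ 0ᴱ _•ᴱ_
    •ᴱ-isPreleftSemimodule = record
      { *ₗ-cong = •ᴱ-cong
      ; *ₗ-zeroˡ = •ᴱ-zeroˡ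
      ; *ₗ-distribʳ = •ᴱ-distribʳ
      ; *ₗ-identityˡ = •ᴱ-identity
      ; *ₗ-assoc = •ᴱ-assoc
      ; *ₗ-zeroʳ = •ᴱ-zeroʳ
      ; *ₗ-distribˡ = •ᴱ-distribˡ
      }

    ext¹ : LeftModule A (lsuc m ⊔ r ⊔ ℓr ⊔ p) (r ⊔ m)
    ext¹ = record
      { Carrierᴹ = Extension N M
      ; _≈ᴹ_ = _≋_
      ; _+ᴹ_ = _+ᴱ_
      ; _*ₗ_ = _•ᴱ_
      ; 0ᴹ = 0ᴱ
      ; -ᴹ_ = -ᴱ_
      ; isLeftModule = record
        { isLeftSemimodule = record
          { +ᴹ-isCommutativeMonoid = +ᴱ-isCommutativeMonoid
          ; isPreleftSemimodule = •ᴱ-isPreleftSemimodule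
          }
        ; -ᴹ‿cong = -ᴱ-cong
        ; -ᴹ‿inverse = -ᴱ-inverseˡ , -ᴱ-inverseʳ
        }
      }

module _ {S : Ring s ℓ} (M : LeftModule S m ℓm) where
  open Ring S using (Carrier; _≈_; 0#)
  open LeftModule M
  open Sum +ᴹ-commutativeMonoid using (sum)

  combination : ∀ {n} → (Fin n → Carrier) → (Fin n → Carrierᴹ) → Carrierᴹ
  combination a b = sum λ i → a i *ₗ b i

  record FreeOfFiniteRank : Set (s ⊔ ℓ ⊔ m ⊔ ℓm) where
    field
      rank        : ℕ
      basis       : Fin rank → Carrierᴹ
      generates   : ∀ x → ∃ λ (a : Fin rank → Carrier) → combination a basis ≈ᴹ x
      independent : ∀ (a : Fin rank → Carrier) → combination a basis ≈ᴹ 0ᴹ → ∀ i → a i ≈ 0#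

module _ {S : Ring s ℓ} where

  private
    module _ (M : LeftModule S m ℓm) where
      open LeftModule M
      open Sum +ᴹ-commutativeMonoid using (sum; sum-cong-≋)

      sum-split : ∀ k {n} (t : Fin (k ℕ.+ n) → Carrierᴹ) → sum t ≈ᴹ sum (t ∘ (_↑ˡ n)) +ᴹ sum (t ∘ (k ↑ʳ_))
      sum-split zero    t = ≈ᴹ-sym (+ᴹ-identityˡ _)
      sum-split (suc k) t = ≈ᴹ-trans (+ᴹ-congˡ (sum-split k (t ∘ suc))) (≈ᴹ-sym (+ᴹ-assoc _ _ _))

      combination-split : ∀ k {n} (a : Fin (k ℕ.+ n) → Ring.Carrier S) (b : Fin k → Carrierᴹ) (b′ : Fin n → Carrierᴹ) →
        combination M a (b ++ b′) ≈ᴹ combination M (a ∘ (_↑ˡ n)) b +ᴹ combination M (a ∘ (k ↑ʳ_)) b′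
      combination-split k {n} a b b′ = ≈ᴹ-trans (sum-split k (λ i → a i *ₗ (b ++ b′) i)) (+ᴹ-cong
        (sum-cong-≋ {k} λ i → *ₗ-congˡ (≈ᴹ-reflexive (lookup-++ˡ b b′ i)))
        (sum-cong-≋ {n} λ i → *ₗ-congˡ (≈ᴹ-reflexive (lookup-++ʳ b b′ i))))

      combination-cong : ∀ {n} (a a′ : Fin n → Ring.Carrier S) (b b′ : Fin n → Carrierᴹ) →
        (∀ i → Ring._≈_ S (a i) (a′ i)) → (∀ i → b i ≈ᴹ b′ i) → combination M a b ≈ᴹ combination M a′ b′
      combination-cong {n} a a′ b b′ p q = sum-cong-≋ {n} λ i → *ₗ-cong (p i) (q i)

      combination-zero : ∀ {n} {a : Fin n → Ring.Carrier S} (b : Fin n → Carrierᴹ) →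
        (∀ i → Ring._≈_ S (a i) (Ring.0# S)) → combination M a b ≈ᴹ 0ᴹ
      combination-zero {zero}  b a≈0 = ≈ᴹ-refl
      combination-zero {suc n} b a≈0 = ≈ᴹ-trans
        (+ᴹ-cong (≈ᴹ-trans (*ₗ-congʳ (a≈0 zero)) (*ₗ-zeroˡ _)) (combination-zero (b ∘ suc) (a≈0 ∘ suc))) (+ᴹ-identityˡ 0ᴹ)

    module _ {M : LeftModule S m₁ ℓm₁} {N : LeftModule S m₂ ℓm₂} (f : M ⟶ᴹ N) where
      private
        module f = _⟶ᴹ_ f
      open LeftModule N

      f-combination : ∀ {n} (a : Fin n → Ring.Carrier S) (b : Fin n → LeftModule.Carrierᴹ M) →
        f.⟦ combination M a b ⟧ ≈ᴹ combination N a (λ i → f.⟦ b i ⟧)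
      f-combination {zero}  a b = f.0ᴹ-homo
      f-combination {suc n} a b = ≈ᴹ-trans (f.+ᴹ-homo _ _) (+ᴹ-cong (f.*ₗ-homo _ _) (f-combination (a ∘ suc) (b ∘ suc)))

  free-extension : {L : LeftModule S m₁ ℓm₁} {M : LeftModule S m₂ ℓm₂} {N : LeftModule S m₃ ℓm₃}
    {f : L ⟶ᴹ M} {g : M ⟶ᴹ N} → ShortExact f g → FreeOfFiniteRank L → FreeOfFiniteRank N → FreeOfFiniteRank M
  free-extension {L = L} {M} {N} {f} {g} exact freeL freeN = record
    { rank        = k ℕ.+ n
    ; basis       = b ++ b′
    ; generates   = generates
    ; independent = independent
    }
    where
    module L = LeftModule L
    module M = LeftModule M
    module N = LeftModule N
    module S = Ring S
    module f = _⟶ᴹ_ f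
    module g = _⟶ᴹ_ g
    module E = ShortExact exact
    module freeL = FreeOfFiniteRank freeL
    module freeN = FreeOfFiniteRank freeN

    k n : ℕ
    k = freeL.rank
    n = freeN.rank

    b : Fin k → M.Carrierᴹ
    b i = f.⟦ freeL.basis i ⟧

    b′ : Fin n → M.Carrierᴹ
    b′ i = E.lift (freeN.basis i)

    g-b′ : ∀ a → g.⟦ combination M a b′ ⟧ N.≈ᴹ combination N a freeN.basis
    g-b′ a = N.≈ᴹ-trans (f-combination g a b′) (combination-cong N a a (λ i → g.⟦ b′ i ⟧) freeN.basis (λ _ → S.refl) (λ i → E.g-lift _))

    generates : ∀ x → ∃ λ (a : Fin (k ℕ.+ n) → S.Carrier) → combination M a (b ++ b′) M.≈ᴹ x
    generates x =
      let a′ , a′-gx = freeN.generates g.⟦ x ⟧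
          z = combination M a′ b′
          y , fy≈x-z = E.kernel⊆image {x M.+ᴹ M.-ᴹ z} (N.≈ᴹ-trans (g.+ᴹ-homo _ _) (N.≈ᴹ-trans
            (N.+ᴹ-congˡ (N.≈ᴹ-trans (g.-ᴹ-homo z) (N.-ᴹ‿cong (N.≈ᴹ-trans (g-b′ a′) a′-gx)))) (N.-ᴹ‿inverseʳ _)))
          a , a-y = freeL.generates y
      in a ++ a′ , (let open SetoidReasoning M.≈ᴹ-setoid in begin
           combination M (a ++ a′) (b ++ b′)
             ≈⟨ combination-split M k (a ++ a′) b b′ ⟩
           combination M ((a ++ a′) ∘ (_↑ˡ n)) b M.+ᴹ combination M ((a ++ a′) ∘ (k ↑ʳ_)) b′
             ≈⟨ M.+ᴹ-cong (combination-cong M _ a b b (λ i → S.reflexive (lookup-++ˡ a a′ i)) (λ _ → M.≈ᴹ-refl))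
                          (combination-cong M _ a′ b′ b′ (λ i → S.reflexive (lookup-++ʳ a a′ i)) (λ _ → M.≈ᴹ-refl)) ⟩
           combination M a b M.+ᴹ z
             ≈⟨ M.+ᴹ-congʳ (f-combination f a freeL.basis) ⟨
           f.⟦ combination L a freeL.basis ⟧ M.+ᴹ z
             ≈⟨ M.+ᴹ-congʳ (M.≈ᴹ-trans (f.⟦⟧-cong a-y) fy≈x-z) ⟩
           x M.+ᴹ M.-ᴹ z M.+ᴹ z
             ≈⟨ M.≈ᴹ-trans (M.+ᴹ-assoc x _ z) (M.≈ᴹ-trans (M.+ᴹ-congˡ (M.-ᴹ‿inverseˡ z)) (M.+ᴹ-identityʳ x)) ⟩
           x ∎)

    independent : ∀ (a : Fin (k ℕ.+ n) → S.Carrier) → combination M a (b ++ b′) M.≈ᴹ M.0ᴹ → ∀ i → a i S.≈ S.0#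
    independent a ab≈0 i = S.trans (S.reflexive (≡.cong a (≡.sym (Fin.join-splitAt k n i)))) (cases (splitAt k i))
      where
      u = combination M (a ∘ (_↑ˡ n)) b
      v = combination M (a ∘ (k ↑ʳ_)) b′

      u+v≈0 : u M.+ᴹ v M.≈ᴹ M.0ᴹ
      u+v≈0 = M.≈ᴹ-trans (M.≈ᴹ-sym (combination-split M k a b b′)) ab≈0

      fu : f.⟦ combination L (a ∘ (_↑ˡ n)) freeL.basis ⟧ M.≈ᴹ u
      fu = f-combination f (a ∘ (_↑ˡ n)) freeL.basis

      right : ∀ j → a (k ↑ʳ j) S.≈ S.0#
      right = freeN.independent (a ∘ (k ↑ʳ_)) (N.≈ᴹ-trans (N.≈ᴹ-sym (g-b′ (a ∘ (k ↑ʳ_))))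
        (N.≈ᴹ-trans (N.≈ᴹ-sym (N.+ᴹ-identityˡ _)) (N.≈ᴹ-trans
          (N.+ᴹ-congʳ (N.≈ᴹ-sym (N.≈ᴹ-trans (g.⟦⟧-cong (M.≈ᴹ-sym fu)) (E.g∘f≈0 _))))
          (N.≈ᴹ-trans (N.≈ᴹ-sym (g.+ᴹ-homo u v)) (N.≈ᴹ-trans (g.⟦⟧-cong u+v≈0) g.0ᴹ-homo)))))

      v≈0 : v M.≈ᴹ M.0ᴹ
      v≈0 = combination-zero M b′ right

      left : ∀ j → a (j ↑ˡ n) S.≈ S.0#
      left = freeL.independent (a ∘ (_↑ˡ n)) (E.injective (M.≈ᴹ-trans fu
        (M.≈ᴹ-trans (M.≈ᴹ-sym (M.+ᴹ-identityʳ u)) (M.≈ᴹ-trans (M.+ᴹ-congˡ (M.≈ᴹ-sym v≈0))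
          (M.≈ᴹ-trans u+v≈0 (M.≈ᴹ-sym f.0ᴹ-homo))))))

      cases : ∀ (j : Fin k ⊎ Fin n) → a (join k n j) S.≈ S.0#
      cases (inj₁ j) = left j
      cases (inj₂ j) = right j

module _ {R : Ring r ℓr} where
  private
    module R = Ring R
  open SemiringExp R.semiring using (_^_; ^-homo-*)

  ^-shift : ∀ {τ s u} → τ R.* s R.≈ s R.* u → ∀ l → τ ^ l R.* s R.≈ s R.* u ^ l
  ^-shift {τ} {s} {u} p zero    = R.trans (R.*-identityˡ s) (R.sym (R.*-identityʳ s))
  ^-shift {τ} {s} {u} p (suc l) = begin
    τ R.* τ ^ l R.* s      ≈⟨ R.*-assoc τ _ s ⟩
    τ R.* (τ ^ l R.* s)    ≈⟨ R.*-congˡ (^-shift p l) ⟩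
    τ R.* (s R.* u ^ l)    ≈⟨ R.*-assoc τ s _ ⟨
    τ R.* s R.* u ^ l      ≈⟨ R.*-congʳ p ⟩
    s R.* u R.* u ^ l      ≈⟨ R.*-assoc s u _ ⟩
    s R.* (u R.* u ^ l)    ∎
    where open SetoidReasoning R.setoid

  -- τ^l (H/sH) = 0: every τ^l x lies in sH.
  Annihilates : LeftModule R m ℓm → (τ s : R.Carrier) → ℕ → Set _
  Annihilates H τ s l = ∀ x → ∃ λ y → τ ^ l *ₗ x ≈ᴹ s *ₗ y
    where open LeftModule H

  annihilates-extension : ∀ {τ s u} → τ R.* s R.≈ s R.* u →
    {L : LeftModule R m₁ ℓm₁} {M : LeftModule R m₂ ℓm₂} {N : LeftModule R m₃ ℓm₃} {f : L ⟶ᴹ M} {g : M ⟶ᴹ N} → ShortExact f g →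
    ∀ {k l} → Annihilates L τ s k → Annihilates N τ s l → Annihilates M τ s (k ℕ.+ l)
  annihilates-extension {τ = τ} {s} {u} p {L} {M} {N} {f} {g} exact {k} {l} annL annN x =
      let y , xy = annN g.⟦ x ⟧
          y′ = E.lift y
          b = τ ^ l
          a = τ ^ k
          n , fn≈d = E.kernel⊆image {b M.*ₗ x M.+ᴹ M.-ᴹ (s M.*ₗ y′)} (N.≈ᴹ-trans (g.+ᴹ-homo _ _) (N.≈ᴹ-trans
            (N.+ᴹ-cong (N.≈ᴹ-trans (g.*ₗ-homo b x) xy)
                       (N.≈ᴹ-trans (g.-ᴹ-homo _) (N.-ᴹ‿cong (N.≈ᴹ-trans (g.*ₗ-homo s y′) (N.*ₗ-congˡ (E.g-lift y))))))
            (N.-ᴹ‿inverseʳ _)))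
          w , nw = annL n
      in f.⟦ w ⟧ M.+ᴹ u ^ k M.*ₗ y′ , (let open SetoidReasoning M.≈ᴹ-setoid in begin
           τ ^ (k ℕ.+ l) M.*ₗ x
             ≈⟨ M.*ₗ-congʳ (^-homo-* τ k l) ⟩
           (a R.* b) M.*ₗ x
             ≈⟨ M.*ₗ-assoc a b x ⟩
           a M.*ₗ (b M.*ₗ x)
             ≈⟨ M.*ₗ-congˡ (M.≈ᴹ-trans (M.+ᴹ-assoc _ _ _) (M.≈ᴹ-trans (M.+ᴹ-congˡ (M.-ᴹ‿inverseˡ _)) (M.+ᴹ-identityʳ _))) ⟨
           a M.*ₗ (b M.*ₗ x M.+ᴹ M.-ᴹ (s M.*ₗ y′) M.+ᴹ s M.*ₗ y′)
             ≈⟨ M.*ₗ-congˡ (M.+ᴹ-congʳ fn≈d) ⟨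
           a M.*ₗ (f.⟦ n ⟧ M.+ᴹ s M.*ₗ y′)
             ≈⟨ M.*ₗ-distribˡ a _ _ ⟩
           a M.*ₗ f.⟦ n ⟧ M.+ᴹ a M.*ₗ (s M.*ₗ y′)
             ≈⟨ M.+ᴹ-cong (M.≈ᴹ-trans (M.≈ᴹ-sym (f.*ₗ-homo a n)) (M.≈ᴹ-trans (f.⟦⟧-cong nw) (f.*ₗ-homo s w)))
                          (M.≈ᴹ-trans (M.≈ᴹ-sym (M.*ₗ-assoc a s y′)) (M.≈ᴹ-trans (M.*ₗ-congʳ (^-shift p k)) (M.*ₗ-assoc s (u ^ k) y′))) ⟩
           s M.*ₗ f.⟦ w ⟧ M.+ᴹ s M.*ₗ (u ^ k M.*ₗ y′)
             ≈⟨ M.*ₗ-distribˡ s _ _ ⟨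
           s M.*ₗ (f.⟦ w ⟧ M.+ᴹ u ^ k M.*ₗ y′) ∎)
    where
    module L = LeftModule L
    module M = LeftModule M
    module N = LeftModule N
    module f = _⟶ᴹ_ f
    module g = _⟶ᴹ_ g
    module E = ShortExact exact

-- F is the field 𝔽_q with q = p^e elements and A = 𝔽_q[t]. The 𝔽_q-algebra structure of K is the one
-- that ι : A → K induces on constants.
record PerfectAField (f ℓf ℓf′ k ℓk ℓk′ : Level) : Set (lsuc (f ⊔ ℓf ⊔ ℓf′ ⊔ k ⊔ ℓk ⊔ ℓk′)) where
  field
    p e          : ℕ
    F            : HeytingField f ℓf ℓf′
    F-cardinality : HasCardinality F (p ℕ.^ e)
    K            : HeytingField k ℓk ℓk′
    K-char       : HasCharacteristic K p
    K-perfect    : IsPerfect K p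

  ringF : Ring f ℓf
  ringF = CommutativeRing.ring (fieldRing F)

  ringK : Ring k ℓk
  ringK = CommutativeRing.ring (fieldRing K)

  module A = SkewPolynomials ringF (idᴿ ringF)

  A : Ring f ℓf
  A = A.polynomialRing

  field
    ι : A ⟶ᴿ ringK

  θ : Ring.Carrier ringK
  θ = RingHomomorphism.⟦_⟧ ι A.X

module DualMotives {f ℓf ℓf′ k ℓk ℓk′ : Level} (𝒦 : PerfectAField f ℓf ℓf′ k ℓk ℓk′) where
  open PerfectAField 𝒦

  -- c ↦ c^(1/q)
  qthRoot : ringK ⟶ᴿ ringK
  qthRoot = QthRoot.rootHom K K-char K-perfect e

  module K⟨σ⟩ = SkewPolynomials ringK qthRoot

  -- K{σ}, in which σ c = c^(1/q) σ
  K⟨σ⟩ : Ring k ℓk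
  K⟨σ⟩ = K⟨σ⟩.polynomialRing

  module K[t,σ] = SkewPolynomials K⟨σ⟩ (idᴿ K⟨σ⟩)

  -- The ring generated by K, t and σ subject to tc = ct, tσ = σt and σc = c^(1/q)σ is the polynomial
  -- ring K{σ}[t] in a central variable t.
  K[t,σ] : Ring k ℓk
  K[t,σ] = K[t,σ].polynomialRing

  open Ring K[t,σ] using (_*_; _-_; _≈_; Carrier)

  fromK⟨σ⟩ : K⟨σ⟩ ⟶ᴿ K[t,σ]
  fromK⟨σ⟩ = K[t,σ].constant

  fromK : ringK ⟶ᴿ K[t,σ]
  fromK = _∘ᴿ_ {R = ringK} {S = K⟨σ⟩} {T = K[t,σ]} fromK⟨σ⟩ K⟨σ⟩.constant

  t σ : Carrier
  t = K[t,σ].X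
  σ = RingHomomorphism.⟦_⟧ fromK⟨σ⟩ K⟨σ⟩.X

  t-θ : Carrier
  t-θ = t - RingHomomorphism.⟦_⟧ fromK θ

  fromF : ringF ⟶ᴿ K[t,σ]
  fromF = _∘ᴿ_ {R = ringF} {S = ringK} {T = K[t,σ]} fromK (_∘ᴿ_ {R = ringF} {S = A} {T = ringK} ι A.constant)

  private
    module R = Ring K[t,σ]
    module fromK⟨σ⟩ = RingHomomorphism fromK⟨σ⟩
    module fromK = RingHomomorphism fromK
    module fromF = RingHomomorphism fromF
    module qthRoot = RingHomomorphism qthRoot
    module Cσ = RingHomomorphism K⟨σ⟩.constant
    module ι = RingHomomorphism ι
    module KR = CommutativeRing (fieldRing K)
    module FR = CommutativeRing (fieldRing F)
    module K⟨σ⟩R = Ring K⟨σ⟩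

    j : FR.Carrier → KR.Carrier
    j c = ι.⟦ RingHomomorphism.⟦_⟧ A.constant c ⟧

    module j = RingHomomorphism (_∘ᴿ_ {R = ringF} {S = A} {T = ringK} ι A.constant)
    open CommutativeExp KR.commutativeSemiring using (_^_)
    module F^ = CommutativeExp FR.commutativeSemiring

    j-^ : ∀ c n → j c ^ n KR.≈ j (c F^.^ n)
    j-^ c zero    = KR.sym j.1#-homo
    j-^ c (suc n) = KR.trans (KR.*-congˡ (j-^ c n)) (KR.sym (j.*-homo c _))

    qthRoot-j : ∀ c → qthRoot.⟦ j c ⟧ KR.≈ j c
    qthRoot-j c = QthRoot.root-unique K K-char K-perfect e
      (KR.trans (j-^ c (p ℕ.^ e)) (j.⟦⟧-cong (x^q≈x F (p ℕ.^ e) F-cardinality c)))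

    fromF-central : ∀ c b → fromF.⟦ c ⟧ * b ≈ b * fromF.⟦ c ⟧
    fromF-central c b = R.sym (K[t,σ].central {fromF.⟦ c ⟧}
      (λ a → R.trans (R.sym (fromK⟨σ⟩.*-homo a Cσ.⟦ j c ⟧)) (R.trans (fromK⟨σ⟩.⟦⟧-cong (central-K⟨σ⟩ a)) (fromK⟨σ⟩.*-homo Cσ.⟦ j c ⟧ a)))
      (K[t,σ].X-constant Cσ.⟦ j c ⟧) b)
      where
      central-K⟨σ⟩ : ∀ a → a K⟨σ⟩R.* Cσ.⟦ j c ⟧ K⟨σ⟩R.≈ Cσ.⟦ j c ⟧ K⟨σ⟩R.* a
      central-K⟨σ⟩ = K⟨σ⟩.central {Cσ.⟦ j c ⟧}
        (λ a → K⟨σ⟩R.trans (K⟨σ⟩R.sym (Cσ.*-homo a (j c))) (K⟨σ⟩R.trans (Cσ.⟦⟧-cong (KR.*-comm a (j c))) (Cσ.*-homo (j c) a)))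
        (K⟨σ⟩R.trans (K⟨σ⟩.X-constant (j c)) (K⟨σ⟩R.*-congʳ {K⟨σ⟩.X} (Cσ.⟦⟧-cong (qthRoot-j c))))

    t-central : ∀ b → t * b ≈ b * t
    t-central b = R.sym (K[t,σ].central {t} (λ a → R.sym (K[t,σ].X-constant a)) R.refl b)

  -- A → K[t,σ], Σ aᵢ tⁱ ↦ Σ aᵢ tⁱ
  private
    module AEval = Evaluation {R = ringF} {φ = idᴿ ringF} {S = K[t,σ]} fromF t (λ c → t-central fromF.⟦ c ⟧)

  fromA : A ⟶ᴿ K[t,σ]
  fromA = AEval.evalHom

  fromA-central : ∀ a b → RingHomomorphism.⟦_⟧ fromA a * b ≈ b * RingHomomorphism.⟦_⟧ fromA a
  fromA-central a b = AEval.eval-commutes {b} (λ c → fromF-central c b) (t-central b) a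

  private
    module Rp = RingProperties K[t,σ]

    σ-shift : ∃ λ u → t-θ * σ ≈ σ * u
    σ-shift = t - fromK.⟦ θq ⟧ , (begin
      (t - fromK.⟦ θ ⟧) * σ                   ≈⟨ Rp.[y-z]x≈yx-zx σ t fromK.⟦ θ ⟧ ⟩
      t * σ - fromK.⟦ θ ⟧ * σ                 ≈⟨ R.+-cong (t-central σ) (R.-‿cong θσ) ⟩
      σ * t - σ * fromK.⟦ θq ⟧                ≈⟨ Rp.x[y-z]≈xy-xz σ t fromK.⟦ θq ⟧ ⟨
      σ * (t - fromK.⟦ θq ⟧)                  ∎)
      where
      open SetoidReasoning R.setoid

      θq : KR.Carrier
      θq = θ ^ (p ℕ.^ e)

      θσ : fromK.⟦ θ ⟧ * σ ≈ σ * fromK.⟦ θq ⟧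
      θσ = begin
        fromK⟨σ⟩.⟦ Cσ.⟦ θ ⟧ ⟧ * σ                             ≈⟨ fromK⟨σ⟩.*-homo Cσ.⟦ θ ⟧ K⟨σ⟩.X ⟨
        fromK⟨σ⟩.⟦ Cσ.⟦ θ ⟧ K⟨σ⟩R.* K⟨σ⟩.X ⟧                  ≈⟨ fromK⟨σ⟩.⟦⟧-cong (K⟨σ⟩R.*-congʳ {K⟨σ⟩.X} (Cσ.⟦⟧-cong (QthRoot.root-unique K K-char K-perfect e KR.refl))) ⟨
        fromK⟨σ⟩.⟦ Cσ.⟦ qthRoot.⟦ θq ⟧ ⟧ K⟨σ⟩R.* K⟨σ⟩.X ⟧     ≈⟨ fromK⟨σ⟩.⟦⟧-cong (K⟨σ⟩.X-constant θq) ⟨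
        fromK⟨σ⟩.⟦ K⟨σ⟩.X K⟨σ⟩R.* Cσ.⟦ θq ⟧ ⟧                 ≈⟨ fromK⟨σ⟩.*-homo K⟨σ⟩.X Cσ.⟦ θq ⟧ ⟩
        σ * fromK.⟦ θq ⟧                                      ∎

  record IsDualMotive {m ℓm} (H : LeftModule K[t,σ] m ℓm) : Set (k ⊔ ℓk ⊔ m ⊔ ℓm) where
    field
      free         : FreeOfFiniteRank (restrict {R = K⟨σ⟩} {S = K[t,σ]} fromK⟨σ⟩ H)
      l            : ℕ
      annihilates  : Annihilates H t-θ σ l

  isDualMotive-extension : ∀ {m} {L M N : LeftModule K[t,σ] m m} {f : L ⟶ᴹ M} {g : M ⟶ᴹ N} →
    ShortExact f g → IsDualMotive L → IsDualMotive N → IsDualMotive M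
  isDualMotive-extension {m} {L} {M} {N} {f} {g} exact dmL dmN = record
    { free = free-extension {f = restrictHom f} {g = restrictHom g}
        (record { injective = E.injective ; exact = E.exact ; surjective = E.surjective }) dmL.free dmN.free
    ; l = dmL.l ℕ.+ dmN.l
    ; annihilates = annihilates-extension {R = K[t,σ]} {τ = t-θ} {σ} {proj₁ σ-shift} (proj₂ σ-shift)
        {L} {M} {N} {f} {g} exact {dmL.l} {dmN.l} dmL.annihilates dmN.annihilates
    }
    where
    module E = ShortExact exact
    module dmL = IsDualMotive dmL
    module dmN = IsDualMotive dmN

    restrictHom : {H H′ : LeftModule K[t,σ] m m} → H ⟶ᴹ H′ →
      restrict {R = K⟨σ⟩} {S = K[t,σ]} fromK⟨σ⟩ H ⟶ᴹ restrict {R = K⟨σ⟩} {S = K[t,σ]} fromK⟨σ⟩ H′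
    restrictHom {H} {H′} u = mkHom (restrict {R = K⟨σ⟩} {S = K[t,σ]} fromK⟨σ⟩ H) (restrict {R = K⟨σ⟩} {S = K[t,σ]} fromK⟨σ⟩ H′)
      u.⟦_⟧ u.⟦⟧-cong u.+ᴹ-homo (λ a → u.*ₗ-homo fromK⟨σ⟩.⟦ a ⟧)
      where module u = _⟶ᴹ_ u

-- The carrier and the equality of a dual t-motive live in universe m.
module DualMotiveExt {f ℓf ℓf′ k ℓk ℓk′ : Level} (𝒦 : PerfectAField f ℓf ℓf′ k ℓk ℓk′) (m : Level) where
  open PerfectAField 𝒦 using (A)
  open DualMotives 𝒦
  open YonedaExt {A = A} {R = K[t,σ]} fromA fromA-central (IsDualMotive {m} {m}) isDualMotive-extension public
    renaming (Object to DualMotive)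

{-# OPTIONS --safe #-}
-- In an extension-closed class of modules the two six-term sequences are exact for formal reasons,
-- except for the surjectivity of the last maps. That is Ext² = 0, and it holds because K[t,σ] is a
-- polynomial ring S[t] over S = K{σ} and dual t-motives are free over S: an extension of N by M splits
-- over S, so it is M ⊕ N with t(x , y) = (t x + δ y , t y) for some S-linear δ : N → M, and conversely
-- every such δ gives an extension. Since S-linear maps N → M₂ lift to N → M and S-linear maps M₁ → N
-- extend to M → N, the classes of the corresponding extensions do too.
module Submission where

open import Algebra.Bundles using (AbelianGroup; Ring)
open import Algebra.Module.Bundles using (LeftModule)
import Algebra.Module.Construct.DirectProduct as DirectProduct
import Algebra.Module.Construct.Zero as Zero
open import Algebra.Module.Morphism.Structures using (IsLeftModuleHomomorphism)
open import Algebra.Morphism.Bundles using (RingHomomorphism)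
import Algebra.Properties.AbelianGroup as AbelianGroupProperties
import Algebra.Properties.CommutativeMonoid.Sum as Sum
import Algebra.Properties.CommutativeSemigroup as CommutativeSemigroupProperties
import Algebra.Properties.Group as GroupProperties
import Algebra.Properties.Ring as RingProperties
open import Data.Fin.Base using (Fin; suc)
open import Data.List.Base using ([]; _∷_)
import Data.List.Properties as List
open import Data.Nat.Base using (zero; suc)
open import Data.Product.Base using (∃; _×_; _,_; proj₁; proj₂)
open import Data.Unit.Polymorphic.Base using (tt)
open import Function.Base using (_∘_)
open import Function.Bundles using (mk⇔)
open import Function.Definitions using (Surjective)
open import Level using (Level; _⊔_)
import Relation.Binary.PropositionalEquality as ≡
import Relation.Binary.Reasoning.Setoid as SetoidReasoning
open import Defs

open _⟶ᴹ_ using (⟦_⟧)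

-- Identities in Ext are rarely checked on middle terms. By `⇒-unique`, two morphisms out of one
-- extension over equal maps of the left ends have equivalent targets, so most such identities
-- reduce to an equation between those maps. The formal exactness rests on two criteria: a pushout
-- along α splits iff α extends to the middle term, and a pullback along γ splits iff γ lifts to it.
-- For the last maps, the point is how a twist δ transforms: pushing out along π turns it into π ∘
-- δ, pulling back along i turns it into δ ∘ i. Both problems are solved by one S-linear splitting
-- of 0 → M₁ → M → M₂ → 0, which exists because M₂ is free over S: if s is a section of π and r the
-- retraction of i that it determines, then s ∘ δ lifts δ and δ ∘ r extends δ. Neither map has to
-- commute with t, and the new twist meets no further condition, since every extension of dual
-- t-motives is again one.

module _ {r ℓr l ℓl m ℓm n ℓn} {R : Ring r ℓr}
  {L : LeftModule R l ℓl} {M : LeftModule R m ℓm} {N : LeftModule R n ℓn} where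
  private
    module N = LeftModule N
  open CommutativeSemigroupProperties (AbelianGroup.commutativeSemigroup N.+ᴹ-abelianGroup) using (interchange)

  copairᴹ : L ⟶ᴹ N → M ⟶ᴹ N → DirectProduct.leftModule L M ⟶ᴹ N
  copairᴹ f g = mkHom (DirectProduct.leftModule L M) N (λ (x , y) → ⟦ f ⟧ x N.+ᴹ ⟦ g ⟧ y)
    (λ (p , q) → N.+ᴹ-cong (f.⟦⟧-cong p) (g.⟦⟧-cong q))
    (λ _ _ → N.≈ᴹ-trans (N.+ᴹ-cong (f.+ᴹ-homo _ _) (g.+ᴹ-homo _ _)) (interchange _ _ _ _))
    (λ _ _ → N.≈ᴹ-trans (N.+ᴹ-cong (f.*ₗ-homo _ _) (g.*ₗ-homo _ _)) (N.≈ᴹ-sym (N.*ₗ-distribˡ _ _ _)))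
    where
    module f = _⟶ᴹ_ f
    module g = _⟶ᴹ_ g

negᴹ : ∀ {r ℓr m ℓm} {R : Ring r ℓr} (M : LeftModule R m ℓm) → M ⟶ᴹ M
negᴹ M = mkHom M M -ᴹ_ -ᴹ‿cong
  (λ x y → ≈ᴹ-sym (AbelianGroupProperties.⁻¹-∙-comm +ᴹ-abelianGroup x y))
  (λ a x → ≈ᴹ-sym (GroupProperties.inverseʳ-unique +ᴹ-group _ _
      (≈ᴹ-trans (≈ᴹ-sym (*ₗ-distribˡ a _ _)) (≈ᴹ-trans (*ₗ-congˡ (-ᴹ‿inverseʳ x)) (*ₗ-zeroʳ a)))))
  where open LeftModule M

-- Factoring homomorphisms through the two ends of a short exact sequence.

module _ {r ℓr l ℓl m ℓm n ℓn} {R : Ring r ℓr}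
  {L : LeftModule R l ℓl} {M : LeftModule R m ℓm} {N : LeftModule R n ℓn}
  {f : L ⟶ᴹ M} {g : M ⟶ᴹ N} (exact : ShortExact f g) where
  private
    module L = LeftModule L
    module M = LeftModule M
    module N = LeftModule N
    module f = _⟶ᴹ_ f
    module g = _⟶ᴹ_ g
    module E = ShortExact exact

  difference∈image : ∀ {x y} → ⟦ g ⟧ x N.≈ᴹ ⟦ g ⟧ y → ∃ λ z → ⟦ f ⟧ z M.≈ᴹ x M.+ᴹ M.-ᴹ y
  difference∈image gx≈gy = E.kernel⊆image (N.≈ᴹ-trans (g.+ᴹ-homo _ _)
    (N.≈ᴹ-trans (N.+ᴹ-cong gx≈gy (g.-ᴹ-homo _)) (N.-ᴹ‿inverseʳ _)))

  module _ {x ℓx} {X : LeftModule R x ℓx} (u : X ⟶ᴹ M) (gu≈0 : ∀ x → ⟦ g ⟧ (⟦ u ⟧ x) N.≈ᴹ N.0ᴹ) where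
    private
      module X = LeftModule X
      module u = _⟶ᴹ_ u

      v : X.Carrierᴹ → L.Carrierᴹ
      v x = proj₁ (E.kernel⊆image (gu≈0 x))

    factorThroughKernel-commutes : ∀ x → ⟦ f ⟧ (v x) M.≈ᴹ ⟦ u ⟧ x
    factorThroughKernel-commutes x = proj₂ (E.kernel⊆image (gu≈0 x))

    -- The preimages under `f` are picked pointwise; injectivity of `f` makes them unique, and each
    -- law is checked after applying `f`.
    factorThroughKernel : X ⟶ᴹ L
    factorThroughKernel = mkHom X L v
      (λ p → E.injective (M.≈ᴹ-trans (factorThroughKernel-commutes _) (M.≈ᴹ-trans (u.⟦⟧-cong p) (M.≈ᴹ-sym (factorThroughKernel-commutes _)))))
      (λ x y → E.injective (M.≈ᴹ-trans (factorThroughKernel-commutes _) (M.≈ᴹ-trans (u.+ᴹ-homo x y)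
        (M.≈ᴹ-sym (M.≈ᴹ-trans (f.+ᴹ-homo _ _) (M.+ᴹ-cong (factorThroughKernel-commutes x) (factorThroughKernel-commutes y)))))))
      (λ a x → E.injective (M.≈ᴹ-trans (factorThroughKernel-commutes _) (M.≈ᴹ-trans (u.*ₗ-homo a x)
        (M.≈ᴹ-sym (M.≈ᴹ-trans (f.*ₗ-homo _ _) (M.*ₗ-congˡ (factorThroughKernel-commutes x)))))))

  module _ {x ℓx} {X : LeftModule R x ℓx} (u : M ⟶ᴹ X) (uf≈0 : ∀ x → LeftModule._≈ᴹ_ X (⟦ u ⟧ (⟦ f ⟧ x)) (LeftModule.0ᴹ X)) where
    private
      module X = LeftModule X
      module u = _⟶ᴹ_ u

      -- Points with the same image under `g` differ by an element of the image of `f`, which `u`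
      -- kills. Hence the lifts `E.lift`, which need not be additive, become linear after applying
      -- `u`.
      u-cong : ∀ {x y} → ⟦ g ⟧ x N.≈ᴹ ⟦ g ⟧ y → ⟦ u ⟧ x X.≈ᴹ ⟦ u ⟧ y
      u-cong {x} {y} gx≈gy = let z , fz≈x-y = difference∈image gx≈gy in
        GroupProperties.x∙y⁻¹≈ε⇒x≈y X.+ᴹ-group _ _
          (X.≈ᴹ-trans (X.+ᴹ-congˡ (X.≈ᴹ-sym (u.-ᴹ-homo y)))
          (X.≈ᴹ-trans (X.≈ᴹ-sym (u.+ᴹ-homo x _))
          (X.≈ᴹ-trans (u.⟦⟧-cong (M.≈ᴹ-sym fz≈x-y)) (uf≈0 z))))

    factorThroughCokernel : N ⟶ᴹ X
    factorThroughCokernel = mkHom N X (λ y → ⟦ u ⟧ (E.lift y))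
      (λ p → u-cong (N.≈ᴹ-trans (E.g-lift _) (N.≈ᴹ-trans p (N.≈ᴹ-sym (E.g-lift _)))))
      (λ x y → X.≈ᴹ-trans (u-cong (N.≈ᴹ-trans (E.g-lift _)
        (N.≈ᴹ-sym (N.≈ᴹ-trans (g.+ᴹ-homo _ _) (N.+ᴹ-cong (E.g-lift x) (E.g-lift y)))))) (u.+ᴹ-homo _ _))
      (λ a x → X.≈ᴹ-trans (u-cong (N.≈ᴹ-trans (E.g-lift _)
        (N.≈ᴹ-sym (N.≈ᴹ-trans (g.*ₗ-homo _ _) (N.*ₗ-congˡ (E.g-lift x)))))) (u.*ₗ-homo _ _))

    factorThroughCokernel-commutes : ∀ x → ⟦ u ⟧ (E.lift (⟦ g ⟧ x)) X.≈ᴹ ⟦ u ⟧ x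
    factorThroughCokernel-commutes x = u-cong (E.g-lift _)

-- The formal part of the six-term sequences.

module YonedaExactness {c ℓ r ℓr m p : Level} {A : Ring c ℓ} {R : Ring r ℓr} (h : A ⟶ᴿ R)
  (h-central : ∀ a b → Ring._≈_ R (Ring._*_ R (RingHomomorphism.⟦_⟧ h a) b) (Ring._*_ R b (RingHomomorphism.⟦_⟧ h a)))
  (P : LeftModule R m m → Set p)
  (P-extension : {L M N : LeftModule R m m} {f : L ⟶ᴹ M} {g : M ⟶ᴹ N} → ShortExact f g → P L → P N → P M)
  where

  open YonedaExt {A = A} {R = R} h h-central P P-extension

  private
    module Mod (M : Object) = LeftModule (underlying M)
    module Homs (M N : Object) = HomModule {A = A} {R = R} h h-central (underlying M) (underlying N)

    id : (M : Object) → Hom M M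
    id M = idᴹ (underlying M)

  -- Universal property of the pullback: a map of extensions over `γ` on the right ends becomes one
  -- over the identity of `N′`, the only kind that `fiveLemma` and `⇒-unique` accept.
  toPull : ∀ {N N′ M M′} {γ : Hom N′ N} {E : Extension N′ M′} {F : Extension N M} {α : Hom M′ M} →
    (u : Hom (Extension.middle E) (Extension.middle F)) →
    (∀ x → Mod._≈ᴹ_ (Extension.middle F) (⟦ u ⟧ (Extension.ι⟦_⟧ E x)) (Extension.ι⟦_⟧ F (⟦ α ⟧ x))) →
    (∀ y → Mod._≈ᴹ_ N (Extension.π⟦_⟧ F (⟦ u ⟧ y)) (⟦ γ ⟧ (Extension.π⟦_⟧ E y))) →
    E ⇒ pull {N} {N′} {M} γ F [ α ]
  toPull {N} {N′} {M} {M′} {γ} {E} {F} {α} u comm-ι comm-π = record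
    { hom = mkHom (underlying (Extension.middle E)) (underlying (Extension.middle (pull {N} {N′} {M} γ F)))
        (λ x → (⟦ u ⟧ x , E.π⟦ x ⟧) , comm-π x)
        (λ p → u.⟦⟧-cong p , πE.⟦⟧-cong p)
        (λ x y → u.+ᴹ-homo x y , πE.+ᴹ-homo x y)
        (λ a x → u.*ₗ-homo a x , πE.*ₗ-homo a x)
    ; commutes-ι = λ x → comm-ι x , E.g∘f≈0 x
    ; commutes-π = λ _ → Mod.≈ᴹ-refl N′
    }
    where
    module E = Extension E
    module u = _⟶ᴹ_ u
    module πE = _⟶ᴹ_ E.π

  module _ {N N′ M : Object} (γ : Hom N′ N) (E : Extension N M) where
    pullProjection : Hom (Extension.middle (pull {N} {N′} {M} γ E)) (Extension.middle E)
    pullProjection = mkHom (underlying (Extension.middle (pull {N} {N′} {M} γ E))) (underlying (Extension.middle E))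
      (λ ((x , _) , _) → x) proj₁ (λ _ _ → Mod.≈ᴹ-refl (Extension.middle E)) (λ _ _ → Mod.≈ᴹ-refl (Extension.middle E))

  pull-map : ∀ {N N′ M M′} (γ : Hom N′ N) {E : Extension N M} {F : Extension N M′} {α : Hom M M′} →
    E ⇒ F [ α ] → pull {N} {N′} {M} γ E ⇒ pull {N} {N′} {M′} γ F [ α ]
  pull-map {N} {N′} {M} {M′} γ {E} {F} {α} u = toPull {N} {N′} {M′} {M} {γ} {_} {F} {α}
    (u.hom ∘ᴹ pullProjection {N} {N′} {M} γ E)
    u.commutes-ι
    (λ ((x , _) , πx≈γy) → Mod.≈ᴹ-trans N (u.commutes-π x) πx≈γy)
    where module u = _⇒_[_] u

  -- When a pushout or a pullback of an extension splits.

  module _ {N M M′ : Object} (α : Hom M M′) (E : Extension N M) where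
    private
      module E = Extension E
      module M′ = Mod M′

    module _ (ρ : Hom E.middle M′) (ρι≈α : ∀ x → ⟦ ρ ⟧ E.ι⟦ x ⟧ M′.≈ᴹ ⟦ α ⟧ x) where
      extension⇒split : E ⇒ 0ᴱ N M′ [ α ]
      extension⇒split = record
        { hom = pairᴹ ρ E.π
        ; commutes-ι = λ x → ρι≈α x , E.g∘f≈0 x
        ; commutes-π = λ _ → Mod.≈ᴹ-refl N
        }

      extends⇒push≋0 : push {N} {M} {M′} α E ≋ 0ᴱ N M′
      extends⇒push≋0 = push-universal {N} {M} {M′} α E extension⇒split

    -- The composite of `E` to the pushout and on to `M′ ⊕ N` lies over `α`, so its first component
    -- restricts to `α` on `M`.
    push≋0⇒extends : push {N} {M} {M′} α E ≋ 0ᴱ N M′ → ∃ λ (ρ : Hom E.middle M′) → ∀ x → ⟦ ρ ⟧ E.ι⟦ x ⟧ M′.≈ᴹ ⟦ α ⟧ x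
    push≋0⇒extends e = fstᴹ (underlying M′) (underlying N) ∘ᴹ _⇒_[_].hom u , λ x → proj₁ (_⇒_[_].commutes-ι u x)
      where
      u : E ⇒ 0ᴱ N M′ [ id M′ ∘ᴹ α ]
      u = ⇒-trans (push-unit {N} {M} {M′} α E) (≋⇒ e)

  module _ {N N′ M : Object} (γ : Hom N′ N) (E : Extension N M) where
    private
      module E = Extension E
      module N = Mod N
      module M = Mod M
      module X = Mod E.middle
      module π = _⟶ᴹ_ E.π

    -- The inclusion of `N′` into `M ⊕ N′`, carried to the pullback and projected to the middle of
    -- `E`, is the lift; the equation that defines the fibre product says that it lies over `γ`.
    pull≋0⇒lifts : pull {N} {N′} {M} γ E ≋ 0ᴱ N′ M → ∃ λ (s : Hom N′ E.middle) → ∀ y → E.π⟦ ⟦ s ⟧ y ⟧ N.≈ᴹ ⟦ γ ⟧ y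
    pull≋0⇒lifts e = pullProjection {N} {N′} {M} γ E ∘ᴹ section , λ y →
      N.≈ᴹ-trans (proj₂ (⟦ section ⟧ y)) (_⟶ᴹ_.⟦⟧-cong γ (u.commutes-π (M.0ᴹ , y)))
      where
      module u = _⇒_[_] (≋⇒ (≋-sym e))

      section : Hom N′ (Extension.middle (pull {N} {N′} {M} γ E))
      section = u.hom ∘ᴹ pairᴹ (0-hom (underlying N′) (underlying M)) (id N′)

    lifts⇒pull≋0 : (s : Hom N′ E.middle) → (∀ y → E.π⟦ ⟦ s ⟧ y ⟧ N.≈ᴹ ⟦ γ ⟧ y) → pull {N} {N′} {M} γ E ≋ 0ᴱ N′ M
    lifts⇒pull≋0 s πs≈γ = ≋-sym (fiveLemma (toPull {N} {N′} {M} {M} {γ} {0ᴱ N′ M} {E} {id M}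
      (copairᴹ E.ι s)
      (λ _ → X.≈ᴹ-trans (X.+ᴹ-congˡ s.0ᴹ-homo) (X.+ᴹ-identityʳ _))
      (λ (x , y) → N.≈ᴹ-trans (π.+ᴹ-homo _ _) (N.≈ᴹ-trans (N.+ᴹ-cong (E.g∘f≈0 x) (πs≈γ y)) (N.+ᴹ-identityˡ _)))))
      where module s = _⟶ᴹ_ s

  -- Linearity of the maps in the sequences.

  module _ {N M M′ : Object} (α : Hom M M′) where
    private
      module M′ = Mod M′
      module α = _⟶ᴹ_ α

      unit : (E : Extension N M) → E ⇒ push {N} {M} {M′} α E [ α ]
      unit = push-unit {N} {M} {M′} α

      push-cong : {E F : Extension N M} → E ≋ F → push {N} {M} {M′} α E ≋ push {N} {M} {M′} α F
      push-cong {E} {F} e = ⇒-unique (unit E) (⇒-trans (≋⇒ e) (unit F)) (λ _ → M′.≈ᴹ-refl)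

      push-+ : ∀ E F → push {N} {M} {M′} α (_+ᴱ_ N M E F) ≋ _+ᴱ_ N M′ (push {N} {M} {M′} α E) (push {N} {M} {M′} α F)
      push-+ E F = ⇒-unique (⇒-trans (sum N M E F) (unit (_+ᴱ_ N M E F)))
        (⇒-trans (pair N M (⇒-trans (first N M E F) (unit E)) (⇒-trans (second N M E F) (unit F)))
                 (sum N M′ (push {N} {M} {M′} α E) (push {N} {M} {M′} α F)))
        (λ _ → α.+ᴹ-homo _ _)

      push-• : ∀ a E → push {N} {M} {M′} α (_•ᴱ_ N M a E) ≋ _•ᴱ_ N M′ a (push {N} {M} {M′} α E)
      push-• a E = ⇒-unique (⇒-trans (scale N M a E) (unit (_•ᴱ_ N M a E)))
        (⇒-trans (unit E) (scale N M′ a (push {N} {M} {M′} α E)))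
        (λ _ → α.*ₗ-homo _ _)

    -- In each law both sides receive a morphism from one extension (`E ⊠ F` for sums, `E` for
    -- multiples); the maps of left ends agree because `α` is linear.
    push-homo : IsLeftModuleHomomorphism (LeftModule.rawLeftModule (ext¹ N M)) (LeftModule.rawLeftModule (ext¹ N M′)) (push {N} {M} {M′} α)
    push-homo = _⟶ᴹ_.isLeftModuleHomomorphism (mkHom (ext¹ N M) (ext¹ N M′) (push {N} {M} {M′} α) push-cong push-+ push-•)

  module _ {N M M′ : Object} (E : Extension N M) where
    private
      module M′ = Mod M′
      module H = LeftModule (homModule M M′)

      unit : (α : Hom M M′) → E ⇒ push {N} {M} {M′} α E [ α ]
      unit α = push-unit {N} {M} {M′} α E

    connecting-push-homo : IsLeftModuleHomomorphism (LeftModule.rawLeftModule (homModule M M′)) (LeftModule.rawLeftModule (ext¹ N M′))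
      (λ α → push {N} {M} {M′} α E)
    connecting-push-homo = _⟶ᴹ_.isLeftModuleHomomorphism (mkHom (homModule M M′) (ext¹ N M′) (λ α → push {N} {M} {M′} α E)
      (λ {α} {β} α≈β → ⇒-unique (unit α) (unit β) α≈β)
      (λ α β → ⇒-unique (unit (α H.+ᴹ β)) (⇒-trans (pair N M′ (unit α) (unit β)) (sum N M′ _ _)) (λ _ → M′.≈ᴹ-refl))
      (λ a α → ⇒-unique (unit (a H.*ₗ α)) (⇒-trans (unit α) (scale N M′ a _)) (λ _ → M′.≈ᴹ-refl)))

  module _ {N N′ M : Object} (γ : Hom N′ N) where
    private
      module N = Mod N
      module M = Mod M
      module γ = _⟶ᴹ_ γ

      pullγ : Extension N M → Extension N′ M
      pullγ = pull {N} {N′} {M} γ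

      -- A Baer sum is a pushout of a fibre product, so pulling back has to be moved past `⊠` before
      -- it can meet the sum.
      pull-⊠ : (E F : Extension N M) → _⊠_ (pullγ E) (pullγ F) ⇒ pull {N} {N′} {M ⊕ M} γ (_⊠_ E F) [ id (M ⊕ M) ]
      pull-⊠ E F = toPull {N} {N′} {M ⊕ M} {M ⊕ M} {γ} {_⊠_ (pullγ E) (pullγ F)} {_⊠_ E F} {id (M ⊕ M)}
        (mkHom (underlying (Extension.middle (_⊠_ (pullγ E) (pullγ F)))) (underlying (Extension.middle (_⊠_ E F)))
          (λ ((((x , y) , πx≈γy) , ((x′ , y′) , πx′≈γy′)) , y≈y′) →
            (x , x′) , N.≈ᴹ-trans πx≈γy (N.≈ᴹ-trans (γ.⟦⟧-cong y≈y′) (N.≈ᴹ-sym πx′≈γy′)))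
          (λ ((p , _) , (p′ , _)) → p , p′) (λ _ _ → Y.≈ᴹ-refl) (λ _ _ → Y.≈ᴹ-refl))
        (λ _ → Y.≈ᴹ-refl)
        (λ ((((x , y) , πx≈γy) , _) , _) → πx≈γy)
        where module Y = LeftModule (DirectProduct.leftModule (underlying (Extension.middle E)) (underlying (Extension.middle F)))

    pull-homo : IsLeftModuleHomomorphism (LeftModule.rawLeftModule (ext¹ N M)) (LeftModule.rawLeftModule (ext¹ N′ M)) pullγ
    pull-homo = _⟶ᴹ_.isLeftModuleHomomorphism (mkHom (ext¹ N M) (ext¹ N′ M) pullγ
      (λ {E} {F} e → fiveLemma (pull-map {N} {N′} {M} {M} γ (≋⇒ e)))
      (λ E F → ⇒-unique
        (⇒-trans (pull-⊠ E F) (pull-map {N} {N′} {M ⊕ M} {M} γ (sum N M E F)))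
        (sum N′ M (pullγ E) (pullγ F))
        (λ _ → M.≈ᴹ-refl))
      (λ a E → ⇒-unique (pull-map {N} {N′} {M} {M} γ (scale N M a E)) (scale N′ M a (pullγ E)) (λ _ → M.≈ᴹ-refl)))

  module _ {N N′ M : Object} (E : Extension N M) where
    private
      module E = Extension E
      module N = Mod N
      module N′ = Mod N′
      module M = Mod M
      module X = Mod E.middle
      module H = LeftModule (homModule N′ N)
      module HX = Homs E.middle E.middle
      module ι = _⟶ᴹ_ E.ι
      module π = _⟶ᴹ_ E.π
      open CommutativeSemigroupProperties (AbelianGroup.commutativeSemigroup X.+ᴹ-abelianGroup) using (interchange)

      pullE : Hom N′ N → Extension N′ M
      pullE γ = pull {N} {N′} {M} γ E

      sumMap : Hom (M ⊕ M) M
      sumMap = Homs._+ʰ_ (M ⊕ M) M (fstᴹ (underlying M) (underlying M)) (sndᴹ (underlying M) (underlying M))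

      -- Adding points over `β y` and `γ y` gives a point over `(β + γ) y`. This lies over `sumMap`,
      -- as the map to the Baer sum does, so the two targets are equivalent.
      pullE-+ : ∀ β γ → _⊠_ (pullE β) (pullE γ) ⇒ pullE (β H.+ᴹ γ) [ sumMap ]
      pullE-+ β γ = toPull {N} {N′} {M} {M ⊕ M} {β H.+ᴹ γ} {_⊠_ (pullE β) (pullE γ)} {E} {sumMap}
        (mkHom (underlying (Extension.middle (_⊠_ (pullE β) (pullE γ)))) (underlying E.middle)
          (λ ((((x , _) , _) , ((x′ , _) , _)) , _) → x X.+ᴹ x′)
          (λ ((p , _) , (q , _)) → X.+ᴹ-cong p q)
          (λ _ _ → interchange _ _ _ _)
          (λ _ _ → X.≈ᴹ-sym (X.*ₗ-distribˡ _ _ _)))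
        (λ _ → X.≈ᴹ-sym (ι.+ᴹ-homo _ _))
        (λ ((((x , y) , πx≈βy) , ((x′ , y′) , πx′≈γy′)) , y≈y′) → N.≈ᴹ-trans (π.+ᴹ-homo _ _)
          (N.+ᴹ-cong πx≈βy (N.≈ᴹ-trans πx′≈γy′ (_⟶ᴹ_.⟦⟧-cong γ (N′.≈ᴹ-sym y≈y′)))))

      pullE-• : ∀ a γ → pullE γ ⇒ pullE (a H.*ₗ γ) [ Homs._•ʰ_ M M a (id M) ]
      pullE-• a γ = toPull {N} {N′} {M} {M} {a H.*ₗ γ} {pullE γ} {E} {Homs._•ʰ_ M M a (id M)}
        ((a HX.•ʰ id E.middle) ∘ᴹ pullProjection {N} {N′} {M} γ E)
        (λ _ → X.≈ᴹ-sym (ι.*ₗ-homo _ _))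
        (λ ((x , y) , πx≈γy) → N.≈ᴹ-trans (π.*ₗ-homo _ _) (N.*ₗ-congˡ πx≈γy))

    connecting-pull-homo : IsLeftModuleHomomorphism (LeftModule.rawLeftModule (homModule N′ N)) (LeftModule.rawLeftModule (ext¹ N′ M)) pullE
    connecting-pull-homo = _⟶ᴹ_.isLeftModuleHomomorphism (mkHom (homModule N′ N) (ext¹ N′ M) pullE
      (λ {β} {γ} β≈γ → fiveLemma (toPull {N} {N′} {M} {M} {γ} {pullE β} {E} {id M} (pullProjection {N} {N′} {M} β E)
        (λ _ → X.≈ᴹ-refl)
        (λ ((_ , y) , πx≈βy) → N.≈ᴹ-trans πx≈βy (β≈γ y))))
      (λ β γ → ⇒-unique (pullE-+ β γ) (sum N′ M (pullE β) (pullE γ)) (λ _ → M.≈ᴹ-refl))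
      (λ a γ → ⇒-unique (pullE-• a γ) (scale N′ M a (pullE γ)) (λ _ → M.≈ᴹ-refl)))

  module _ {L M N : Object} (v : Hom M N) where
    private
      module v = _⟶ᴹ_ v

    postcompose-homo : IsLeftModuleHomomorphism (LeftModule.rawLeftModule (homModule L M)) (LeftModule.rawLeftModule (homModule L N)) (v ∘ᴹ_)
    postcompose-homo = _⟶ᴹ_.isLeftModuleHomomorphism (mkHom (homModule L M) (homModule L N) (v ∘ᴹ_)
      (λ p x → v.⟦⟧-cong (p x)) (λ _ _ _ → v.+ᴹ-homo _ _) (λ _ _ _ → v.*ₗ-homo _ _))

  precompose-homo : ∀ {L M N : Object} (u : Hom L M) →
    IsLeftModuleHomomorphism (LeftModule.rawLeftModule (homModule M N)) (LeftModule.rawLeftModule (homModule L N)) (_∘ᴹ u)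
  precompose-homo {L} {M} {N} u = _⟶ᴹ_.isLeftModuleHomomorphism (mkHom (homModule M N) (homModule L N) (_∘ᴹ u)
    (λ p x → p (⟦ u ⟧ x)) (λ _ _ _ → Mod.≈ᴹ-refl N) (λ _ _ _ → Mod.≈ᴹ-refl N))

  -- Exactness at the inner terms.

  module _ {M₁ M M₂ : Object} (i : Hom M₁ M) (π : Hom M M₂) (exact : ShortExact i π) where
    private
      module S = ShortExact exact
      module M₁ = Mod M₁
      module M = Mod M
      module M₂ = Mod M₂
      module i = _⟶ᴹ_ i
      module π = _⟶ᴹ_ π

      E : Extension M₂ M₁
      E = extension {M₁} {M} {M₂} i π exact

    module _ {N : Object} (F : Extension N M)
      (ρ : Hom (Extension.middle F) M₂) (ρι≈π : ∀ x → ⟦ ρ ⟧ (Extension.ι⟦_⟧ F x) M₂.≈ᴹ ⟦ π ⟧ x)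
      where
      private
        module F = Extension F
        module N = Mod N
        module Y = Mod F.middle
        module ρ = _⟶ᴹ_ ρ
        module ιF = _⟶ᴹ_ F.ι
        module πF = _⟶ᴹ_ F.π

        𝟘 : LeftModule R m m
        𝟘 = Zero.leftModule

        -- ker ρ, as the fibre product of ρ and 0 → M₂
        kernel : LeftModule R m m
        kernel = fibreProduct ρ (0-hom 𝟘 (underlying M₂))

        ιᵏ : underlying M₁ ⟶ᴹ kernel
        ιᵏ = mkHom (underlying M₁) kernel (λ x → (F.ι⟦ ⟦ i ⟧ x ⟧ , tt) , M₂.≈ᴹ-trans (ρι≈π _) (S.g∘f≈0 x))
          (λ p → ιF.⟦⟧-cong (i.⟦⟧-cong p) , tt)
          (λ _ _ → Y.≈ᴹ-trans (ιF.⟦⟧-cong (i.+ᴹ-homo _ _)) (ιF.+ᴹ-homo _ _) , tt)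
          (λ _ _ → Y.≈ᴹ-trans (ιF.⟦⟧-cong (i.*ₗ-homo _ _)) (ιF.*ₗ-homo _ _) , tt)

        inclusion : kernel ⟶ᴹ underlying F.middle
        inclusion = mkHom kernel (underlying F.middle) (λ ((x , _) , _) → x) proj₁ (λ _ _ → Y.≈ᴹ-refl) (λ _ _ → Y.≈ᴹ-refl)

        kernel-shortExact : ShortExact ιᵏ (F.π ∘ᴹ inclusion)
        kernel-shortExact = record
          { injective = λ (p , _) → S.injective (F.injective p)
          ; exact = λ ((y , _) , ρy≈0) → mk⇔
              (λ πy≈0 →
                let x , ιx≈y = F.kernel⊆image πy≈0
                    w , iw≈x = S.kernel⊆image (M₂.≈ᴹ-trans (M₂.≈ᴹ-sym (ρι≈π x)) (M₂.≈ᴹ-trans (ρ.⟦⟧-cong ιx≈y) ρy≈0))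
                in w , Y.≈ᴹ-trans (ιF.⟦⟧-cong iw≈x) ιx≈y , tt)
              (λ (w , ιiw≈y , _) → N.≈ᴹ-trans (πF.⟦⟧-cong (Y.≈ᴹ-sym ιiw≈y)) (F.g∘f≈0 _))
          ; surjective = strictly⇒surjective (F.π ∘ᴹ inclusion) λ n →
              -- A lift of `n` need not lie in the kernel of `ρ`. Since `ρ` restricts to the
              -- surjection `π` on `M`, it can be corrected by an element of `M`, which does not
              -- change its image in `N`.
              let y = F.lift n
                  x = S.lift (⟦ ρ ⟧ y)
              in ((y Y.+ᴹ Y.-ᴹ F.ι⟦ x ⟧ , tt) , M₂.≈ᴹ-trans (ρ.+ᴹ-homo _ _) (M₂.≈ᴹ-trans
                   (M₂.+ᴹ-congˡ (M₂.≈ᴹ-trans (ρ.-ᴹ-homo _) (M₂.-ᴹ‿cong (M₂.≈ᴹ-trans (ρι≈π x) (S.g-lift _)))))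
                   (M₂.-ᴹ‿inverseʳ _))) ,
                 N.≈ᴹ-trans (πF.+ᴹ-homo _ _) (N.≈ᴹ-trans
                   (N.+ᴹ-cong (F.g-lift n) (N.≈ᴹ-trans (πF.-ᴹ-homo _) (N.≈ᴹ-trans (N.-ᴹ‿cong (F.g∘f≈0 x)) (GroupProperties.ε⁻¹≈ε N.+ᴹ-group))))
                   (N.+ᴹ-identityʳ n))
          }

        kernelObject : Object
        kernelObject .underlying = kernel
        kernelObject .inClass    = P-extension kernel-shortExact (inClass M₁) (inClass N)

      -- A preimage of `F` under pushout along `i`: the kernel of `ρ` meets `M` in the kernel of
      -- `π`, which is `M₁`, and still maps onto `N`.
      kernelExtension : Extension N M₁
      kernelExtension = extension {M₁} {kernelObject} {N} ιᵏ (F.π ∘ᴹ inclusion) kernel-shortExact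

      push-kernelExtension : push {N} {M₁} {M} i kernelExtension ≋ F
      push-kernelExtension = push-universal {N} {M₁} {M} i kernelExtension record
        { hom = inclusion
        ; commutes-ι = λ _ → Y.≈ᴹ-refl
        ; commutes-π = λ _ → N.≈ᴹ-refl
        }

    module _ {N : Object} (F : Extension M N)
      (s : Hom M₁ (Extension.middle F)) (πs≈i : ∀ x → Extension.π⟦_⟧ F (⟦ s ⟧ x) M.≈ᴹ ⟦ i ⟧ x)
      where
      private
        module F = Extension F
        module Y = Mod F.middle
        module s = _⟶ᴹ_ s
        module πF = _⟶ᴹ_ F.π

        coker : LeftModule R m m
        coker = cokernel s

        module C = LeftModule coker

        ≈⇒C : ∀ {x y} → x Y.≈ᴹ y → x C.≈ᴹ y
        ≈⇒C p = M₁.0ᴹ , Y.≈ᴹ-trans p (Y.≈ᴹ-sym (Y.≈ᴹ-trans (Y.+ᴹ-congˡ s.0ᴹ-homo) (Y.+ᴹ-identityʳ _)))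

        projection : underlying F.middle ⟶ᴹ coker
        projection = mkHom (underlying F.middle) coker (λ y → y) ≈⇒C (λ _ _ → C.≈ᴹ-refl) (λ _ _ → C.≈ᴹ-refl)

        πs≈0 : ∀ x → ⟦ π ⟧ F.π⟦ ⟦ s ⟧ x ⟧ M₂.≈ᴹ M₂.0ᴹ
        πs≈0 x = M₂.≈ᴹ-trans (π.⟦⟧-cong (πs≈i x)) (S.g∘f≈0 x)

        πᶜ : coker ⟶ᴹ underlying M₂
        πᶜ = mkHom coker (underlying M₂) (λ y → ⟦ π ⟧ F.π⟦ y ⟧)
          (λ (x , p) → M₂.≈ᴹ-trans (π.⟦⟧-cong (M.≈ᴹ-trans (πF.⟦⟧-cong p) (πF.+ᴹ-homo _ _)))
            (M₂.≈ᴹ-trans (π.+ᴹ-homo _ _) (M₂.≈ᴹ-trans (M₂.+ᴹ-congˡ (πs≈0 x)) (M₂.+ᴹ-identityʳ _))))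
          (λ _ _ → M₂.≈ᴹ-trans (π.⟦⟧-cong (πF.+ᴹ-homo _ _)) (π.+ᴹ-homo _ _))
          (λ _ _ → M₂.≈ᴹ-trans (π.⟦⟧-cong (πF.*ₗ-homo _ _)) (π.*ₗ-homo _ _))

        cokernel-shortExact : ShortExact (projection ∘ᴹ F.ι) πᶜ
        cokernel-shortExact = record
          { injective = λ {a} {b} (x , ιa≈ιb+sx) →
              -- Projecting `ι a = ι b + s x` to `M` leaves `i x = 0`, so the image of `s` meets `N`
              -- only in zero.
              let ix≈0 = M.≈ᴹ-sym (M.≈ᴹ-trans (M.≈ᴹ-sym (F.g∘f≈0 a)) (M.≈ᴹ-trans (πF.⟦⟧-cong ιa≈ιb+sx)
                    (M.≈ᴹ-trans (πF.+ᴹ-homo _ _) (M.≈ᴹ-trans (M.+ᴹ-cong (F.g∘f≈0 b) (πs≈i x)) (M.+ᴹ-identityˡ _)))))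
                  sx≈0 = Y.≈ᴹ-trans (s.⟦⟧-cong (S.injective (M.≈ᴹ-trans ix≈0 (M.≈ᴹ-sym i.0ᴹ-homo)))) s.0ᴹ-homo
              in F.injective (Y.≈ᴹ-trans ιa≈ιb+sx (Y.≈ᴹ-trans (Y.+ᴹ-congˡ sx≈0) (Y.+ᴹ-identityʳ _)))
          ; exact = λ y → mk⇔
              (λ ππy≈0 →
                let x , ix≈πy = S.kernel⊆image ππy≈0
                    n , ιn≈y-sx = difference∈image F.shortExact (M.≈ᴹ-trans (M.≈ᴹ-sym ix≈πy) (M.≈ᴹ-sym (πs≈i x)))
                in n , M₁.-ᴹ x , Y.≈ᴹ-trans ιn≈y-sx (Y.+ᴹ-congˡ (Y.≈ᴹ-sym (s.-ᴹ-homo x))))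
              (λ (n , ιn~y) → M₂.≈ᴹ-trans (_⟶ᴹ_.⟦⟧-cong πᶜ (C.≈ᴹ-sym ιn~y)) (M₂.≈ᴹ-trans (π.⟦⟧-cong (F.g∘f≈0 n)) π.0ᴹ-homo))
          ; surjective = strictly⇒surjective πᶜ λ y →
              F.lift (S.lift y) , M₂.≈ᴹ-trans (π.⟦⟧-cong (F.g-lift _)) (S.g-lift y)
          }

        cokernelObject : Object
        cokernelObject .underlying = coker
        cokernelObject .inClass    = P-extension cokernel-shortExact (inClass N) (inClass M₂)

      -- Dual to `kernelExtension`: dividing the middle of `F` by the lifted copy of `M₁` keeps `N`
      -- intact and turns the quotient `M` into `M₂`.
      cokernelExtension : Extension M₂ N
      cokernelExtension = extension {N} {cokernelObject} {M₂} (projection ∘ᴹ F.ι) πᶜ cokernel-shortExact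

      pull-cokernelExtension : pull {M₂} {M} {N} π cokernelExtension ≋ F
      pull-cokernelExtension = ≋-sym (fiveLemma (toPull {M₂} {M} {N} {N} {π} {F} {cokernelExtension} {id N} projection
        (λ _ → C.≈ᴹ-refl) (λ _ → M₂.≈ᴹ-refl)))

    module _ (N : Object) where
      private
        module N = Mod N

        δ : Hom N M₂ → Extension N M₁
        δ γ = pull {M₂} {N} {M₁} γ E

        δ′ : Hom M₁ N → Extension M₂ N
        δ′ α = push {M₂} {M₁} {N} α E

      postcompose-injective : ∀ {u v : Hom N M₁} → (∀ x → ⟦ i ∘ᴹ u ⟧ x M.≈ᴹ ⟦ i ∘ᴹ v ⟧ x) → ∀ x → ⟦ u ⟧ x M₁.≈ᴹ ⟦ v ⟧ x
      postcompose-injective iu≈iv x = S.injective (iu≈iv x)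

      precompose-injective : ∀ {u v : Hom M₂ N} → (∀ x → ⟦ u ∘ᴹ π ⟧ x N.≈ᴹ ⟦ v ∘ᴹ π ⟧ x) → ∀ y → ⟦ u ⟧ y N.≈ᴹ ⟦ v ⟧ y
      precompose-injective {u} {v} uπ≈vπ y = N.≈ᴹ-trans (_⟶ᴹ_.⟦⟧-cong u (M₂.≈ᴹ-sym (S.g-lift y)))
        (N.≈ᴹ-trans (uπ≈vπ _) (_⟶ᴹ_.⟦⟧-cong v (S.g-lift y)))

      exact-Hom-covariant : Exact (homModule N M₁) (homModule N M) (homModule N M₂) (i ∘ᴹ_) (π ∘ᴹ_)
      exact-Hom-covariant u = mk⇔
        (λ πu≈0 → factorThroughKernel exact u πu≈0 ,
                  factorThroughKernel-commutes exact u πu≈0)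
        (λ (v , iv≈u) x → M₂.≈ᴹ-trans (π.⟦⟧-cong (M.≈ᴹ-sym (iv≈u x))) (S.g∘f≈0 _))

      exact-Hom-contravariant : Exact (homModule M₂ N) (homModule M N) (homModule M₁ N) (_∘ᴹ π) (_∘ᴹ i)
      exact-Hom-contravariant u = mk⇔
        (λ ui≈0 → factorThroughCokernel exact u ui≈0 ,
                  factorThroughCokernel-commutes exact u ui≈0)
        (λ (v , vπ≈u) x → N.≈ᴹ-trans (N.≈ᴹ-sym (vπ≈u _)) (N.≈ᴹ-trans (_⟶ᴹ_.⟦⟧-cong v (S.g∘f≈0 x)) (_⟶ᴹ_.0ᴹ-homo v)))

      exact-connecting-pull : Exact (homModule N M) (homModule N M₂) (ext¹ N M₁) (π ∘ᴹ_) δ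
      exact-connecting-pull γ = mk⇔ (pull≋0⇒lifts {M₂} {N} {M₁} γ E)
        (λ (s , πs≈γ) → lifts⇒pull≋0 {M₂} {N} {M₁} γ E s πs≈γ)

      exact-connecting-push : Exact (homModule M N) (homModule M₁ N) (ext¹ M₂ N) (_∘ᴹ i) δ′
      exact-connecting-push α = mk⇔ (push≋0⇒extends {M₂} {M₁} {N} α E)
        (λ (ρ , ρi≈α) → extends⇒push≋0 {M₂} {M₁} {N} α E ρ ρi≈α)

      -- If `ρ` extends `i` to the middle of `F`, then `π ∘ ρ` kills `M₁` and descends to some
      -- `γ : N → M₂`, and `ρ` identifies `F` with the pullback of `E` along `γ`. Conversely, the
      -- projection of such a pullback to `M` extends `i`.
      exact-Ext-kernel-push : Exact (homModule N M₂) (ext¹ N M₁) (ext¹ N M) δ (push {N} {M₁} {M} i)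
      exact-Ext-kernel-push F = mk⇔
        (λ e → toHom (push≋0⇒extends {N} {M₁} {M} i F e))
        (λ (γ , e) →
          let u = ≋⇒ (≋-sym e)
          in extends⇒push≋0 {N} {M₁} {M} i F (pullProjection {M₂} {N} {M₁} γ E ∘ᴹ _⇒_[_].hom u)
               (λ x → proj₁ (_⇒_[_].commutes-ι u x)))
        where
        module F = Extension F

        toHom : (∃ λ (ρ : Hom F.middle M) → ∀ x → ⟦ ρ ⟧ F.ι⟦ x ⟧ M.≈ᴹ ⟦ i ⟧ x) → ∃ λ γ → δ γ ≋ F
        toHom (ρ , ρι≈i) = γ , ≋-sym (fiveLemma (toPull {M₂} {N} {M₁} {M₁} {γ} {F} {E} {id M₁} ρ ρι≈i
          (λ y → M₂.≈ᴹ-sym (factorThroughCokernel-commutes F.shortExact (π ∘ᴹ ρ) πρι≈0 y))))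
          where
          πρι≈0 : ∀ x → ⟦ π ⟧ (⟦ ρ ⟧ F.ι⟦ x ⟧) M₂.≈ᴹ M₂.0ᴹ
          πρι≈0 x = M₂.≈ᴹ-trans (π.⟦⟧-cong (ρι≈i x)) (S.g∘f≈0 x)

          γ : Hom N M₂
          γ = factorThroughCokernel F.shortExact (π ∘ᴹ ρ) πρι≈0

      -- If `s` lifts `π` to the middle of `F`, then `s ∘ i` lands in `N`; the resulting
      -- `α : M₁ → N` makes `F` the pushout of `E` along `α`.
      exact-Ext-kernel-pull : Exact (homModule M₁ N) (ext¹ M₂ N) (ext¹ M N) δ′ (pull {M₂} {M} {N} π)
      exact-Ext-kernel-pull F = mk⇔
        (λ e → toHom (pull≋0⇒lifts {M₂} {M} {N} π F e))
        (λ (α , e) →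
          let u : E ⇒ F [ id N ∘ᴹ α ]
              u = ⇒-trans (push-unit {M₂} {M₁} {N} α E) (≋⇒ e)
          in lifts⇒pull≋0 {M₂} {M} {N} π F (_⇒_[_].hom u) (_⇒_[_].commutes-π u))
        where
        module F = Extension F
        module Y = Mod F.middle

        toHom : (∃ λ (s : Hom M F.middle) → ∀ y → F.π⟦ ⟦ s ⟧ y ⟧ M₂.≈ᴹ ⟦ π ⟧ y) → ∃ λ α → δ′ α ≋ F
        toHom (s , πs≈π) = α , push-universal {M₂} {M₁} {N} α E record
          { hom = s
          ; commutes-ι = λ x → Y.≈ᴹ-sym (factorThroughKernel-commutes F.shortExact (s ∘ᴹ i) πsi≈0 x)
          ; commutes-π = πs≈π
          }
          where
          πsi≈0 : ∀ x → F.π⟦ ⟦ s ⟧ (⟦ i ⟧ x) ⟧ M₂.≈ᴹ M₂.0ᴹ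
          πsi≈0 x = M₂.≈ᴹ-trans (πs≈π _) (S.g∘f≈0 x)

          α : Hom M₁ N
          α = factorThroughKernel F.shortExact (s ∘ᴹ i) πsi≈0

      exact-Ext-push : Exact (ext¹ N M₁) (ext¹ N M) (ext¹ N M₂) (push {N} {M₁} {M} i) (push {N} {M} {M₂} π)
      exact-Ext-push F = mk⇔
        (λ e → let ρ , ρι≈π = push≋0⇒extends {N} {M} {M₂} π F e
               in kernelExtension {N} F ρ ρι≈π , push-kernelExtension {N} F ρ ρι≈π)
        (λ (G , e) →
          let u : G ⇒ push {N} {M} {M₂} π F [ π ∘ᴹ (id M ∘ᴹ i) ]
              u = ⇒-trans (⇒-trans (push-unit {N} {M₁} {M} i G) (≋⇒ e)) (push-unit {N} {M} {M₂} π F)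
          -- `G` maps to the split extension over the zero map, and `u` lies over `π ∘ i = 0`; the
          -- two targets therefore agree.
          in ⇒-unique u
               (extension⇒split {N} {M₁} {M₂} (0-hom (underlying M₁) (underlying M₂)) G
                 (0-hom (underlying (Extension.middle G)) (underlying M₂)) (λ _ → M₂.≈ᴹ-refl))
               S.g∘f≈0)

      exact-Ext-pull : Exact (ext¹ M₂ N) (ext¹ M N) (ext¹ M₁ N) (pull {M₂} {M} {N} π) (pull {M} {M₁} {N} i)
      exact-Ext-pull F = mk⇔
        (λ e → let s , πs≈i = pull≋0⇒lifts {M} {M₁} {N} i F e
               in cokernelExtension {N} F s πs≈i , pull-cokernelExtension {N} F s πs≈i)
        (λ (G , e) →
          let module u = _⇒_[_] (≋⇒ {M} {N} {pull {M₂} {M} {N} π G} {F} e)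
              module G = Extension G
              s : Hom M₁ (Extension.middle (pull {M₂} {M} {N} π G))
              s = mkHom (underlying M₁) (underlying (Extension.middle (pull {M₂} {M} {N} π G)))
                -- Over the image of `i` the pullback along `π` has the obvious section with first
                -- component zero, because `π ∘ i = 0`.
                (λ x → (Mod.0ᴹ G.middle , ⟦ i ⟧ x) , M₂.≈ᴹ-trans (_⟶ᴹ_.0ᴹ-homo G.π) (M₂.≈ᴹ-sym (S.g∘f≈0 x)))
                (λ p → Mod.≈ᴹ-refl G.middle , i.⟦⟧-cong p)
                (λ _ _ → Mod.≈ᴹ-sym G.middle (Mod.+ᴹ-identityʳ G.middle _) , i.+ᴹ-homo _ _)
                (λ a _ → Mod.≈ᴹ-sym G.middle (Mod.*ₗ-zeroʳ G.middle a) , i.*ₗ-homo _ _)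
          in lifts⇒pull≋0 {M} {M₁} {N} i F (u.hom ∘ᴹ s) (λ x → u.commutes-π (⟦ s ⟧ x)))

-- Linear combinations and maps out of free modules.

module _ {r ℓr m ℓm} {R : Ring r ℓr} (M : LeftModule R m ℓm) where
  private
    module R = Ring R
  open LeftModule M
  open Sum +ᴹ-commutativeMonoid using (sum-cong-≋; ∑-distrib-+)

  combination-congˡ : ∀ {n} {a a′ : Fin n → R.Carrier} (y : Fin n → Carrierᴹ) →
    (∀ i → a i R.≈ a′ i) → combination M a y ≈ᴹ combination M a′ y
  combination-congˡ {n} y a≈a′ = sum-cong-≋ {n} λ i → *ₗ-congʳ (a≈a′ i)

  combination-congʳ : ∀ {n} (a : Fin n → R.Carrier) {y y′ : Fin n → Carrierᴹ} →
    (∀ i → y i ≈ᴹ y′ i) → combination M a y ≈ᴹ combination M a y′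
  combination-congʳ {n} a y≈y′ = sum-cong-≋ {n} λ i → *ₗ-congˡ (y≈y′ i)

  combination-+ : ∀ {n} (a a′ : Fin n → R.Carrier) (y : Fin n → Carrierᴹ) →
    combination M (λ i → a i R.+ a′ i) y ≈ᴹ combination M a y +ᴹ combination M a′ y
  combination-+ {n} a a′ y = ≈ᴹ-trans (sum-cong-≋ {n} λ i → *ₗ-distribʳ (y i) (a i) (a′ i))
    (∑-distrib-+ (λ i → a i *ₗ y i) (λ i → a′ i *ₗ y i))

  combination-* : ∀ {n} c (a : Fin n → R.Carrier) (y : Fin n → Carrierᴹ) →
    combination M (λ i → c R.* a i) y ≈ᴹ c *ₗ combination M a y
  combination-* {zero}  c a y = ≈ᴹ-sym (*ₗ-zeroʳ c)
  combination-* {suc n} c a y = ≈ᴹ-trans (+ᴹ-cong (*ₗ-assoc c _ _) (combination-* c (a ∘ suc) (y ∘ suc)))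
    (≈ᴹ-sym (*ₗ-distribˡ c _ _))

module _ {r ℓr m ℓm n ℓn} {R : Ring r ℓr} {M : LeftModule R m ℓm} {N : LeftModule R n ℓn} (f : M ⟶ᴹ N) where
  private
    module N = LeftModule N
    module f = _⟶ᴹ_ f

  combination-homo : ∀ {k} (a : Fin k → Ring.Carrier R) (y : Fin k → LeftModule.Carrierᴹ M) →
    ⟦ f ⟧ (combination M a y) N.≈ᴹ combination N a (λ i → ⟦ f ⟧ (y i))
  combination-homo {zero}  a y = f.0ᴹ-homo
  combination-homo {suc k} a y = N.≈ᴹ-trans (f.+ᴹ-homo _ _) (N.+ᴹ-cong (f.*ₗ-homo _ _) (combination-homo (a ∘ suc) (y ∘ suc)))

module _ {r ℓr m ℓm n ℓn} {R : Ring r ℓr} {M : LeftModule R m ℓm} {N : LeftModule R n ℓn} (free : FreeOfFiniteRank N) where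
  private
    module R = Ring R
    module M = LeftModule M
    module N = LeftModule N
    module free = FreeOfFiniteRank free

    coordinates : N.Carrierᴹ → Fin free.rank → R.Carrier
    coordinates x = proj₁ (free.generates x)

    spans : ∀ x → combination N (coordinates x) free.basis N.≈ᴹ x
    spans x = proj₂ (free.generates x)

    -- Independence speaks only of vanishing combinations, so it is applied to the difference,
    -- written `a + (-1) a′` to let `combination-+` and `combination-*` evaluate it.
    unique : ∀ {a a′ : Fin free.rank → R.Carrier} → combination N a free.basis N.≈ᴹ combination N a′ free.basis → ∀ i → a i R.≈ a′ i
    unique {a} {a′} p i = GroupProperties.x∙y⁻¹≈ε⇒x≈y R.+-group _ _
      (R.trans (R.+-congˡ (R.sym (RingProperties.-1*x≈-x R (a′ i)))) (free.independent (λ j → a j R.+ R.- R.1# R.* a′ j) (begin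
        combination N (λ j → a j R.+ R.- R.1# R.* a′ j) free.basis  ≈⟨ combination-+ N a _ free.basis ⟩
        x N.+ᴹ combination N (λ j → R.- R.1# R.* a′ j) free.basis    ≈⟨ N.+ᴹ-cong p (combination-* N (R.- R.1#) a′ free.basis) ⟩
        x′ N.+ᴹ R.- R.1# N.*ₗ x′                                    ≈⟨ N.+ᴹ-congʳ (N.*ₗ-identityˡ x′) ⟨
        R.1# N.*ₗ x′ N.+ᴹ R.- R.1# N.*ₗ x′                          ≈⟨ N.*ₗ-distribʳ x′ R.1# (R.- R.1#) ⟨
        (R.1# R.+ R.- R.1#) N.*ₗ x′                                 ≈⟨ N.*ₗ-congʳ (R.-‿inverseʳ R.1#) ⟩
        R.0# N.*ₗ x′                                                ≈⟨ N.*ₗ-zeroˡ x′ ⟩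
        N.0ᴹ                                                        ∎) i))
      where
      open SetoidReasoning N.≈ᴹ-setoid
      x = combination N a free.basis
      x′ = combination N a′ free.basis

  -- The coordinates supplied by `generates` are not assumed to respect equality or to be linear;
  -- `unique` forces both.
  linearExtension : (Fin free.rank → M.Carrierᴹ) → N ⟶ᴹ M
  linearExtension y = mkHom N M (λ x → combination M (coordinates x) y)
    (λ {x} {x′} p → combination-congˡ M y (unique (N.≈ᴹ-trans (spans x) (N.≈ᴹ-trans p (N.≈ᴹ-sym (spans x′))))))
    (λ x x′ → M.≈ᴹ-trans (combination-congˡ M y (unique (N.≈ᴹ-trans (spans (x N.+ᴹ x′)) (N.≈ᴹ-sym
      (N.≈ᴹ-trans (combination-+ N _ _ free.basis) (N.+ᴹ-cong (spans x) (spans x′))))))) (combination-+ M (coordinates x) (coordinates x′) y))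
    (λ c x → M.≈ᴹ-trans (combination-congˡ M y (unique (N.≈ᴹ-trans (spans (c N.*ₗ x)) (N.≈ᴹ-sym
      (N.≈ᴹ-trans (combination-* N c _ free.basis) (N.*ₗ-congˡ (spans x))))))) (combination-* M c (coordinates x) y))

  module _ (g : M ⟶ᴹ N) (surjective : ∀ y → ∃ λ x → ⟦ g ⟧ x N.≈ᴹ y) where
    section : N ⟶ᴹ M
    section = linearExtension λ i → proj₁ (surjective (free.basis i))

    g-section : ∀ y → ⟦ g ⟧ (⟦ section ⟧ y) N.≈ᴹ y
    g-section y = N.≈ᴹ-trans (combination-homo g (coordinates y) _)
      (N.≈ᴹ-trans (combination-congʳ N (coordinates y) λ i → proj₂ (surjective (free.basis i))) (spans y))

-- Modules over `R[t]` as `R`-modules with an endomorphism.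

module _ {g ℓg} (G : AbelianGroup g ℓg) where
  open AbelianGroup G
  open CommutativeSemigroupProperties commutativeSemigroup using (interchange)
  open AbelianGroupProperties G using (⁻¹-∙-comm)

  record AdditiveEndomorphism : Set (g ⊔ ℓg) where
    field
      app    : Carrier → Carrier
      cong   : ∀ {x y} → x ≈ y → app x ≈ app y
      homo   : ∀ x y → app (x ∙ y) ≈ app x ∙ app y

    ε-homo : app ε ≈ ε
    ε-homo = GroupProperties.identityʳ-unique group (app ε) (app ε)
      (trans (sym (homo ε ε)) (cong (identityˡ ε)))
  open AdditiveEndomorphism

  -- Serves as the target of `Evaluation`: an action of `R[t]` on `G` is a ring homomorphism from
  -- `R[t]` to this ring, so polynomials need not be made to act by hand.
  endomorphismRing : Ring (g ⊔ ℓg) (g ⊔ ℓg)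
  endomorphismRing = record
    { Carrier = AdditiveEndomorphism
    ; _≈_ = λ u v → ∀ x → app u x ≈ app v x
    ; _+_ = λ u v → record
      { app  = λ x → app u x ∙ app v x
      ; cong = λ p → ∙-cong (cong u p) (cong v p)
      ; homo = λ x y → trans (∙-cong (homo u x y) (homo v x y)) (interchange _ _ _ _)
      }
    ; _*_ = λ u v → record
      { app  = λ x → app u (app v x)
      ; cong = λ p → cong u (cong v p)
      ; homo = λ x y → trans (cong u (homo v x y)) (homo u _ _)
      }
    ; -_ = λ u → record
      { app  = λ x → app u x ⁻¹
      ; cong = λ p → ⁻¹-cong (cong u p)
      ; homo = λ x y → trans (⁻¹-cong (homo u x y)) (sym (⁻¹-∙-comm _ _))
      }
    ; 0# = record { app = λ _ → ε ; cong = λ _ → refl ; homo = λ _ _ → sym (identityˡ ε) }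
    ; 1# = record { app = λ x → x ; cong = λ p → p ; homo = λ _ _ → refl }
    ; isRing = record
      { +-isAbelianGroup = record
        { isGroup = record
          { isMonoid = record
            { isSemigroup = record
              { isMagma = record
                { isEquivalence = record
                  { refl = λ _ → refl ; sym = λ p x → sym (p x) ; trans = λ p q x → trans (p x) (q x) }
                ; ∙-cong = λ p q x → ∙-cong (p x) (q x)
                }
              ; assoc = λ _ _ _ _ → assoc _ _ _
              }
            ; identity = (λ _ _ → identityˡ _) , (λ _ _ → identityʳ _)
            }
          ; inverse = (λ _ _ → inverseˡ _) , (λ _ _ → inverseʳ _)
          ; ⁻¹-cong = λ p x → ⁻¹-cong (p x)
          }
        ; comm = λ _ _ _ → comm _ _
        }
      ; *-cong = λ {_} {v} p q x → trans (p _) (cong v (q x))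
      ; *-assoc = λ _ _ _ _ → refl
      ; *-identity = (λ _ _ → refl) , (λ _ _ → refl)
      ; distrib = (λ u _ _ _ → homo u _ _) , (λ _ _ _ _ → refl)
      }
    }

  tautologicalModule : LeftModule endomorphismRing g ℓg
  tautologicalModule = record
    { Carrierᴹ = Carrier
    ; _≈ᴹ_ = _≈_
    ; _+ᴹ_ = _∙_
    ; _*ₗ_ = app
    ; 0ᴹ = ε
    ; -ᴹ_ = _⁻¹
    ; isLeftModule = record
      { isLeftSemimodule = record
        { +ᴹ-isCommutativeMonoid = isCommutativeMonoid
        ; isPreleftSemimodule = record
          { *ₗ-cong = λ {_} {v} p q → trans (p _) (cong v q)
          ; *ₗ-zeroˡ = λ _ → refl
          ; *ₗ-distribʳ = λ _ _ _ → refl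
          ; *ₗ-identityˡ = λ _ → refl
          ; *ₗ-assoc = λ _ _ _ → refl
          ; *ₗ-zeroʳ = ε-homo
          ; *ₗ-distribˡ = homo
          }
        }
      ; -ᴹ‿cong = ⁻¹-cong
      ; -ᴹ‿inverse = inverse
      }
    }

module PolynomialModules {r ℓr} (R : Ring r ℓr) where
  open SkewPolynomials R (idᴿ R)

  private
    module R = Ring R
    module R[t] = Ring polynomialRing

    C : R.Carrier → Poly
    C = RingHomomorphism.⟦_⟧ constant

    R[t] : Ring r ℓr
    R[t] = polynomialRing

    0·≈0 : ∀ f → R.0# ·ₚ f ≈ₚ []
    0·≈0 f = coeffwise (go f)
      where
      go : ∀ f n → coeff (R.0# ·ₚ f) n R.≈ R.0#
      go []      n       = R.refl
      go (a ∷ f) zero    = R.zeroˡ a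
      go (a ∷ f) (suc n) = go f n

    X*≈ : ∀ f → X *ₚ f ≈ₚ R.0# ∷ f
    X*≈ f = R[t].trans (R[t].+-cong {R.0# ·ₚ f} {[]} {1ₚ *ₚ (X· f)} {X· f} (0·≈0 f) (R[t].*-identityˡ (X· f)))
      (R[t].reflexive (≡.cong (R.0# ∷_) (List.map-id f)))

    ∷≈ : ∀ a f → a ∷ f ≈ₚ C a +ₚ X *ₚ f
    ∷≈ a f = R[t].trans {a ∷ f} {C a +ₚ (R.0# ∷ f)}
      (coeffwise λ { zero → R.sym (R.+-identityʳ a) ; (suc n) → R.refl })
      (R[t].+-cong {C a} (R[t].refl {C a}) (R[t].sym (X*≈ f)))

  forget : ∀ {m ℓm} → LeftModule R[t] m ℓm → LeftModule R m ℓm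
  forget = restrict {R = R} {S = R[t]} constant

  forgetHom : ∀ {m ℓm n ℓn} {M : LeftModule R[t] m ℓm} {N : LeftModule R[t] n ℓn} → M ⟶ᴹ N → forget M ⟶ᴹ forget N
  forgetHom {M = M} {N} u = mkHom (forget M) (forget N) ⟦ u ⟧ u.⟦⟧-cong u.+ᴹ-homo (λ a → u.*ₗ-homo (C a))
    where module u = _⟶ᴹ_ u

  tᴹ : ∀ {m ℓm} (M : LeftModule R[t] m ℓm) → forget M ⟶ᴹ forget M
  tᴹ M = mkHom (forget M) (forget M) (X *ₗ_) *ₗ-congˡ (*ₗ-distribˡ X)
    (λ a x → ≈ᴹ-trans (≈ᴹ-sym (*ₗ-assoc X (C a) x)) (≈ᴹ-trans (*ₗ-congʳ (X-constant a)) (*ₗ-assoc (C a) X x)))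
    where open LeftModule M

  module _ {m ℓm n ℓn} (M : LeftModule R[t] m ℓm) (N : LeftModule R[t] n ℓn) where
    private
      module M = LeftModule M
      module N = LeftModule N

    -- Induction on the polynomial along `a + X f`.
    mkHom[t] : (u : forget M ⟶ᴹ forget N) → (∀ x → ⟦ u ⟧ (X M.*ₗ x) N.≈ᴹ X N.*ₗ ⟦ u ⟧ x) → M ⟶ᴹ N
    mkHom[t] u u-X = mkHom M N ⟦ u ⟧ u.⟦⟧-cong u.+ᴹ-homo homo
      where
      module u = _⟶ᴹ_ u
      open SetoidReasoning N.≈ᴹ-setoid

      homo : ∀ f x → ⟦ u ⟧ (f M.*ₗ x) N.≈ᴹ f N.*ₗ ⟦ u ⟧ x
      homo []      x = N.≈ᴹ-trans (u.⟦⟧-cong (M.*ₗ-zeroˡ x)) (N.≈ᴹ-trans u.0ᴹ-homo (N.≈ᴹ-sym (N.*ₗ-zeroˡ _)))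
      homo (a ∷ f) x = begin
        ⟦ u ⟧ ((a ∷ f) M.*ₗ x)                              ≈⟨ u.⟦⟧-cong (M.≈ᴹ-trans (M.*ₗ-congʳ (∷≈ a f)) (M.*ₗ-distribʳ x (C a) (X *ₚ f))) ⟩
        ⟦ u ⟧ (C a M.*ₗ x M.+ᴹ (X *ₚ f) M.*ₗ x)             ≈⟨ u.+ᴹ-homo _ _ ⟩
        ⟦ u ⟧ (C a M.*ₗ x) N.+ᴹ ⟦ u ⟧ ((X *ₚ f) M.*ₗ x)     ≈⟨ N.+ᴹ-cong (u.*ₗ-homo a x) (N.≈ᴹ-trans (u.⟦⟧-cong (M.*ₗ-assoc X f x)) (u-X _)) ⟩
        C a N.*ₗ ⟦ u ⟧ x N.+ᴹ X N.*ₗ ⟦ u ⟧ (f M.*ₗ x)       ≈⟨ N.+ᴹ-congˡ (N.*ₗ-congˡ (homo f x)) ⟩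
        C a N.*ₗ ⟦ u ⟧ x N.+ᴹ X N.*ₗ (f N.*ₗ ⟦ u ⟧ x)       ≈⟨ N.+ᴹ-congˡ (N.*ₗ-assoc X f _) ⟨
        C a N.*ₗ ⟦ u ⟧ x N.+ᴹ (X *ₚ f) N.*ₗ ⟦ u ⟧ x         ≈⟨ N.*ₗ-distribʳ _ (C a) (X *ₚ f) ⟨
        (C a +ₚ X *ₚ f) N.*ₗ ⟦ u ⟧ x                        ≈⟨ N.*ₗ-congʳ (∷≈ a f) ⟨
        (a ∷ f) N.*ₗ ⟦ u ⟧ x                                ∎

  module _ {m ℓm} (M : LeftModule R m ℓm) (T : M ⟶ᴹ M) where
    private
      module T = _⟶ᴹ_ T
    open LeftModule M

    private
      End : Ring (m ⊔ ℓm) (m ⊔ ℓm)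
      End = endomorphismRing +ᴹ-abelianGroup

      scalar : R ⟶ᴿ End
      scalar = mkRingHom {R = R} {S = End}
        (λ a → record { app = a *ₗ_ ; cong = *ₗ-congˡ ; homo = *ₗ-distribˡ a })
        (λ p x → *ₗ-congʳ p) (λ a b x → *ₗ-distribʳ x a b) (λ a b x → *ₗ-assoc a b x) *ₗ-identityˡ

      T′ : AdditiveEndomorphism +ᴹ-abelianGroup
      T′ = record { app = ⟦ T ⟧ ; cong = T.⟦⟧-cong ; homo = T.+ᴹ-homo }

      module Eval = Evaluation {R = R} {φ = idᴿ R} {S = End} scalar T′ T.*ₗ-homo

    -- Evaluation at `T` needs `T` to commute with the scalars, which is exactly its `R`-linearity.
    withAction : LeftModule R[t] m ℓm
    withAction = restrict {R = R[t]} {S = End} Eval.evalHom (tautologicalModule +ᴹ-abelianGroup)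

    private
      module W = LeftModule withAction

    C-withAction : ∀ a x → C a W.*ₗ x ≈ᴹ a *ₗ x
    C-withAction a x = +ᴹ-identityʳ _

    X-withAction : ∀ x → X W.*ₗ x ≈ᴹ ⟦ T ⟧ x
    X-withAction x = ≈ᴹ-trans (+ᴹ-cong (*ₗ-zeroˡ x) (≈ᴹ-trans (+ᴹ-identityʳ _) (*ₗ-identityˡ _))) (+ᴹ-identityˡ _)

    -- The identity on carriers is not a trivial coercion: a scalar `a` of `forget withAction` acts
    -- as an evaluated constant polynomial, that is by `a x + 0`.
    intoWithAction : M ⟶ᴹ forget withAction
    intoWithAction = mkHom M (forget withAction) (λ x → x) (λ p → p) (λ _ _ → ≈ᴹ-refl) (λ a x → ≈ᴹ-sym (C-withAction a x))

    outOfWithAction : forget withAction ⟶ᴹ M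
    outOfWithAction = mkHom (forget withAction) M (λ x → x) (λ p → p) (λ _ _ → ≈ᴹ-refl) C-withAction

  module _ {m n ℓm ℓn} (M : LeftModule R[t] m ℓm) (N : LeftModule R[t] n ℓn) (δ : forget N ⟶ᴹ forget M) where
    private
      module M = LeftModule M
      module N = LeftModule N
      module δ = _⟶ᴹ_ δ

      M×N : LeftModule R (m ⊔ n) (ℓm ⊔ ℓn)
      M×N = DirectProduct.leftModule (forget M) (forget N)

    twistedAction : M×N ⟶ᴹ M×N
    twistedAction = pairᴹ (copairᴹ (tᴹ M) δ) (tᴹ N ∘ᴹ sndᴹ (forget M) (forget N))

    -- M ⊕ N with t (x , y) = (t x + δ y , t y)
    twisted : LeftModule R[t] (m ⊔ n) (ℓm ⊔ ℓn)
    twisted = withAction M×N twistedAction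

    private
      module W = LeftModule twisted

    ιᵗ : M ⟶ᴹ twisted
    ιᵗ = mkHom[t] M twisted (intoWithAction M×N twistedAction ∘ᴹ pairᴹ (idᴹ (forget M)) (0-hom (forget M) (forget N)))
      (λ x → W.≈ᴹ-sym {X W.*ₗ (x , N.0ᴹ)} (W.≈ᴹ-trans {X W.*ₗ (x , N.0ᴹ)} (X-withAction M×N twistedAction (x , N.0ᴹ))
        (M.≈ᴹ-trans (M.+ᴹ-congˡ δ.0ᴹ-homo) (M.+ᴹ-identityʳ _) , N.*ₗ-zeroʳ X)))

    πᵗ : twisted ⟶ᴹ N
    πᵗ = mkHom[t] twisted N (sndᴹ (forget M) (forget N) ∘ᴹ outOfWithAction M×N twistedAction)
      (λ z → proj₂ (X-withAction M×N twistedAction z))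

    -- Exactness ignores scalars, and additively this is the direct product sequence.
    twisted-shortExact : ShortExact ιᵗ πᵗ
    twisted-shortExact = record { injective = D.injective ; exact = D.exact ; surjective = D.surjective }
      where module D = ShortExact (directProduct-shortExact (forget M) (forget N))

  -- An extension of `R[t]`-modules in terms of an `R`-linear splitting.

  module SplitOverR {l m n ℓl ℓm ℓn} {L : LeftModule R[t] l ℓl} {M : LeftModule R[t] m ℓm} {N : LeftModule R[t] n ℓn}
    {f : L ⟶ᴹ M} {g : M ⟶ᴹ N} (exact : ShortExact f g) (free : FreeOfFiniteRank (forget N)) where
    private
      module L = LeftModule L
      module M = LeftModule M
      module N = LeftModule N
      module f = _⟶ᴹ_ f
      module g = _⟶ᴹ_ g
      module E = ShortExact exact

      exactᴿ : ShortExact (forgetHom {M = L} {M} f) (forgetHom {M = M} {N} g)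
      exactᴿ = record { injective = E.injective ; exact = E.exact ; surjective = E.surjective }

    s : forget N ⟶ᴹ forget M
    s = section free (forgetHom {M = M} {N} g) (λ y → E.lift y , E.g-lift y)

    gs≈id : ∀ y → ⟦ g ⟧ (⟦ s ⟧ y) N.≈ᴹ y
    gs≈id = g-section free (forgetHom {M = M} {N} g) (λ y → E.lift y , E.g-lift y)

    private
      module s = _⟶ᴹ_ s

      module _ {x ℓx} {Y : LeftModule R x ℓx} (u : Y ⟶ᴹ forget M) (v : Y ⟶ᴹ forget N) (gu≈v : ∀ y → ⟦ g ⟧ (⟦ u ⟧ y) N.≈ᴹ ⟦ v ⟧ y) where
        u-sv : Y ⟶ᴹ forget M
        u-sv = copairᴹ u (s ∘ᴹ negᴹ (forget N) ∘ᴹ v) ∘ᴹ pairᴹ (idᴹ Y) (idᴹ Y)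

        g[u-sv]≈0 : ∀ y → ⟦ g ⟧ (⟦ u-sv ⟧ y) N.≈ᴹ N.0ᴹ
        g[u-sv]≈0 y = N.≈ᴹ-trans (g.+ᴹ-homo _ _) (N.≈ᴹ-trans (N.+ᴹ-cong (gu≈v y) (gs≈id _)) (N.-ᴹ‿inverseʳ _))

        -- The `L`-coordinate of `u` in the decomposition of `M` as `f L + s N`. Taking `u = t s`
        -- gives the twist, taking `u = id` the retraction.
        defect : Y ⟶ᴹ forget L
        defect = factorThroughKernel exactᴿ u-sv g[u-sv]≈0

        f-defect : ∀ y → ⟦ u ⟧ y M.≈ᴹ ⟦ f ⟧ (⟦ defect ⟧ y) M.+ᴹ ⟦ s ⟧ (⟦ v ⟧ y)
        f-defect y = M.≈ᴹ-sym (begin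
          ⟦ f ⟧ (⟦ defect ⟧ y) M.+ᴹ z                 ≈⟨ M.+ᴹ-congʳ (factorThroughKernel-commutes exactᴿ u-sv g[u-sv]≈0 y) ⟩
          ⟦ u ⟧ y M.+ᴹ ⟦ s ⟧ (N.-ᴹ ⟦ v ⟧ y) M.+ᴹ z     ≈⟨ M.+ᴹ-congʳ (M.+ᴹ-congˡ (s.-ᴹ-homo _)) ⟩
          ⟦ u ⟧ y M.+ᴹ M.-ᴹ z M.+ᴹ z                   ≈⟨ M.+ᴹ-assoc _ _ _ ⟩
          ⟦ u ⟧ y M.+ᴹ (M.-ᴹ z M.+ᴹ z)                 ≈⟨ M.+ᴹ-congˡ (M.-ᴹ‿inverseˡ z) ⟩
          ⟦ u ⟧ y M.+ᴹ M.0ᴹ                            ≈⟨ M.+ᴹ-identityʳ _ ⟩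
          ⟦ u ⟧ y                                      ∎)
          where
          open SetoidReasoning M.≈ᴹ-setoid
          z = ⟦ s ⟧ (⟦ v ⟧ y)

    -- Up to the inclusion `f` this is the commutator `t s - s t`, the failure of the section to be
    -- `t`-linear.
    δ : forget N ⟶ᴹ forget L
    δ = defect (tᴹ M ∘ᴹ s) (tᴹ N) (λ y → N.≈ᴹ-trans (g.*ₗ-homo X _) (N.*ₗ-congˡ (gs≈id y)))

    ts≈fδ+st : ∀ y → X M.*ₗ ⟦ s ⟧ y M.≈ᴹ ⟦ f ⟧ (⟦ δ ⟧ y) M.+ᴹ ⟦ s ⟧ (X N.*ₗ y)
    ts≈fδ+st = f-defect (tᴹ M ∘ᴹ s) (tᴹ N) (λ y → N.≈ᴹ-trans (g.*ₗ-homo X _) (N.*ₗ-congˡ (gs≈id y)))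

    retraction : forget M ⟶ᴹ forget L
    retraction = defect (idᴹ (forget M)) (forgetHom {M = M} {N} g) (λ _ → N.≈ᴹ-refl)

    retraction-f : ∀ x → ⟦ retraction ⟧ (⟦ f ⟧ x) L.≈ᴹ x
    retraction-f x = E.injective (M.≈ᴹ-sym (M.≈ᴹ-trans
      (f-defect (idᴹ (forget M)) (forgetHom {M = M} {N} g) (λ _ → N.≈ᴹ-refl) (⟦ f ⟧ x))
      (M.≈ᴹ-trans (M.+ᴹ-congˡ (M.≈ᴹ-trans (s.⟦⟧-cong (E.g∘f≈0 x)) s.0ᴹ-homo)) (M.+ᴹ-identityʳ _))))

    module _ {m′ n′ ℓm′ ℓn′} {M′ : LeftModule R[t] m′ ℓm′} {N′ : LeftModule R[t] n′ ℓn′} (δ′ : forget N′ ⟶ᴹ forget M′)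
      (a : M′ ⟶ᴹ L)
      {y ℓy} {Y : LeftModule R[t] y ℓy} (v : Y ⟶ᴹ twisted M′ N′ δ′) (b : Y ⟶ᴹ N)
      (aδ′v≈δb : ∀ y → ⟦ a ⟧ (⟦ δ′ ⟧ (proj₂ (⟦ v ⟧ y))) L.≈ᴹ ⟦ δ ⟧ (⟦ b ⟧ y))
      where
      private
        module M′ = LeftModule M′
        module Y = LeftModule Y
        module b = _⟶ᴹ_ b
        module v = _⟶ᴹ_ v

        fa : M′ ⟶ᴹ M
        fa = f ∘ᴹ a

        v₁ : forget Y ⟶ᴹ forget M′
        v₁ = fstᴹ (forget M′) (forget N′) ∘ᴹ outOfWithAction (DirectProduct.leftModule (forget M′) (forget N′)) (twistedAction M′ N′ δ′)
          ∘ᴹ forgetHom {M = Y} {twisted M′ N′ δ′} v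

        v₁-X : ∀ y → ⟦ v₁ ⟧ (X Y.*ₗ y) M′.≈ᴹ X M′.*ₗ ⟦ v₁ ⟧ y M′.+ᴹ ⟦ δ′ ⟧ (proj₂ (⟦ v ⟧ y))
        v₁-X y = M′.≈ᴹ-trans (proj₁ (v.*ₗ-homo X y))
          (proj₁ (X-withAction (DirectProduct.leftModule (forget M′) (forget N′)) (twistedAction M′ N′ δ′) (⟦ v ⟧ y)))

        w : forget Y ⟶ᴹ forget M
        w = copairᴹ (forgetHom {M = M′} {M} fa ∘ᴹ v₁) (s ∘ᴹ forgetHom {M = Y} {N} b) ∘ᴹ pairᴹ (idᴹ (forget Y)) (idᴹ (forget Y))

      -- y ↦ f (a x) + s (b y), where v y = (x , _). The hypothesis makes the twists δ′ and δ cancel in t-linearity.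
      fromTwisted : Y ⟶ᴹ M
      fromTwisted = mkHom[t] Y M w λ y → let x = ⟦ v₁ ⟧ y in begin
        ⟦ fa ⟧ (⟦ v₁ ⟧ (X Y.*ₗ y)) M.+ᴹ ⟦ s ⟧ (⟦ b ⟧ (X Y.*ₗ y))
          ≈⟨ M.+ᴹ-cong (M.≈ᴹ-trans (_⟶ᴹ_.⟦⟧-cong fa (v₁-X y)) (_⟶ᴹ_.+ᴹ-homo fa _ _)) (s.⟦⟧-cong (b.*ₗ-homo X y)) ⟩
        (⟦ fa ⟧ (X M′.*ₗ x) M.+ᴹ ⟦ fa ⟧ (⟦ δ′ ⟧ (proj₂ (⟦ v ⟧ y)))) M.+ᴹ ⟦ s ⟧ (X N.*ₗ ⟦ b ⟧ y)
          ≈⟨ M.+ᴹ-congʳ (M.+ᴹ-cong (_⟶ᴹ_.*ₗ-homo fa X x) (f.⟦⟧-cong (aδ′v≈δb y))) ⟩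
        (X M.*ₗ ⟦ fa ⟧ x M.+ᴹ ⟦ f ⟧ (⟦ δ ⟧ (⟦ b ⟧ y))) M.+ᴹ ⟦ s ⟧ (X N.*ₗ ⟦ b ⟧ y)
          ≈⟨ M.+ᴹ-assoc _ _ _ ⟩
        X M.*ₗ ⟦ fa ⟧ x M.+ᴹ (⟦ f ⟧ (⟦ δ ⟧ (⟦ b ⟧ y)) M.+ᴹ ⟦ s ⟧ (X N.*ₗ ⟦ b ⟧ y))
          ≈⟨ M.+ᴹ-congˡ (ts≈fδ+st (⟦ b ⟧ y)) ⟨
        X M.*ₗ ⟦ fa ⟧ x M.+ᴹ X M.*ₗ ⟦ s ⟧ (⟦ b ⟧ y)
          ≈⟨ M.*ₗ-distribˡ X _ _ ⟨
        X M.*ₗ (⟦ fa ⟧ x M.+ᴹ ⟦ s ⟧ (⟦ b ⟧ y)) ∎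
        where open SetoidReasoning M.≈ᴹ-setoid

  -- Surjectivity of the last maps, by lifting and extending twists.

  module FreeExtensions {c ℓ m p : Level} {A : Ring c ℓ} (h : A ⟶ᴿ R[t])
    (h-central : ∀ a b → RingHomomorphism.⟦_⟧ h a *ₚ b ≈ₚ b *ₚ RingHomomorphism.⟦_⟧ h a)
    (P : LeftModule R[t] m m → Set p)
    (P-extension : {L M N : LeftModule R[t] m m} {f : L ⟶ᴹ M} {g : M ⟶ᴹ N} → ShortExact f g → P L → P N → P M)
    (P⇒free : {H : LeftModule R[t] m m} → P H → FreeOfFiniteRank (forget H))
    where

    open YonedaExt {A = A} {R = R[t]} h h-central P P-extension
    open YonedaExactness {A = A} {R = R[t]} h h-central P P-extension

    module _ (N M : Object) (δ : forget (underlying N) ⟶ᴹ forget (underlying M)) where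
      -- Any `δ` is admissible: membership in the class comes from the short exact sequence alone.
      twistedObject : Object
      twistedObject .underlying = twisted (underlying M) (underlying N) δ
      twistedObject .inClass    = P-extension (twisted-shortExact (underlying M) (underlying N) δ) (inClass M) (inClass N)

      twistedExtension : Extension N M
      twistedExtension = extension {M} {twistedObject} {N} (ιᵗ (underlying M) (underlying N) δ) (πᵗ (underlying M) (underlying N) δ)
        (twisted-shortExact (underlying M) (underlying N) δ)

    module _ {M₁ M M₂ : Object} (i : Hom M₁ M) (π : Hom M M₂) (exact : ShortExact i π) (N : Object) where
      private
        module M₁ = LeftModule (underlying M₁)
        module N = LeftModule (underlying N)
        module Σ = SplitOverR {L = underlying M₁} {underlying M} {underlying M₂} {i} {π} exact (P⇒free (inClass M₂))

      -- `ΣF.δ` takes values in `M₂`; composing with the section of `π` lifts it to `M`, and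
      -- applying `π` recovers it. The comparison map is `(x , y) ↦ ι (π x) + s y`, with `s` the
      -- section belonging to `F`.
      push-preimage : ∀ F → ∃ λ G → push {N} {M} {M₂} π G ≋ F
      push-preimage F = G , push-universal {N} {M} {M₂} π G record
        { hom = ΣF.fromTwisted {M′ = underlying M} {underlying N} δ′ π {Y = underlying (twistedObject N M δ′)} (idᴹ _)
            (πᵗ (underlying M) (underlying N) δ′) (λ _ → Σ.gs≈id _)
        ; commutes-ι = λ _ → Y.≈ᴹ-trans (Y.+ᴹ-congˡ (_⟶ᴹ_.0ᴹ-homo ΣF.s)) (Y.+ᴹ-identityʳ _)
        ; commutes-π = λ (_ , y) → N.≈ᴹ-trans (_⟶ᴹ_.+ᴹ-homo F.π _ _) (N.≈ᴹ-trans (N.+ᴹ-cong (F.g∘f≈0 _) (ΣF.gs≈id y)) (N.+ᴹ-identityˡ y))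
        }
        where
        module F = Extension F
        module Y = LeftModule (underlying F.middle)
        module ΣF = SplitOverR {L = underlying M₂} {underlying F.middle} {underlying N} {F.ι} {F.π} F.shortExact (P⇒free (inClass N))

        δ′ : forget (underlying N) ⟶ᴹ forget (underlying M)
        δ′ = Σ.s ∘ᴹ ΣF.δ

        G : Extension N M
        G = twistedExtension N M δ′

      push-surjective : Surjective (_≋_ {N} {M}) (_≋_ {N} {M₂}) (push {N} {M} {M₂} π)
      push-surjective = strictly⇒surjective {M = ext¹ N M} {N = ext¹ N M₂}
        (record { isLeftModuleHomomorphism = push-homo {N} {M} {M₂} π }) push-preimage

      -- `ΣF.δ` is defined only on `M₁`; composing with the retraction extends it to `M`. The
      -- comparison map, now out of the pullback of the twisted extension, is
      -- `((n , z) , x) ↦ ι n + s x`.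
      pull-preimage : ∀ F → ∃ λ G → pull {M} {M₁} {N} i G ≋ F
      pull-preimage F = G , fiveLemma record
        { hom = ΣF.fromTwisted {M′ = underlying N} {underlying M} δ′ (idᴹ (underlying N)) {Y = underlying (Extension.middle (pull {M} {M₁} {N} i G))}
            (pullProjection {M} {M₁} {N} i G) (Extension.π (pull {M} {M₁} {N} i G))
            -- Points of the pullback satisfy `z = i x`, where the retraction undoes `i`, so both
            -- twists take the same value.
            (λ (_ , z≈ix) → _⟶ᴹ_.⟦⟧-cong ΣF.δ (M₁.≈ᴹ-trans (_⟶ᴹ_.⟦⟧-cong Σ.retraction z≈ix) (Σ.retraction-f _)))
        ; commutes-ι = λ _ → Y.≈ᴹ-trans (Y.+ᴹ-congˡ (_⟶ᴹ_.0ᴹ-homo ΣF.s)) (Y.+ᴹ-identityʳ _)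
        ; commutes-π = λ ((_ , x) , _) → M₁.≈ᴹ-trans (_⟶ᴹ_.+ᴹ-homo F.π _ _) (M₁.≈ᴹ-trans (M₁.+ᴹ-cong (F.g∘f≈0 _) (ΣF.gs≈id x)) (M₁.+ᴹ-identityˡ x))
        }
        where
        module F = Extension F
        module Y = LeftModule (underlying F.middle)
        module ΣF = SplitOverR {L = underlying N} {underlying F.middle} {underlying M₁} {F.ι} {F.π} F.shortExact (P⇒free (inClass M₁))

        δ′ : forget (underlying M) ⟶ᴹ forget (underlying N)
        δ′ = ΣF.δ ∘ᴹ Σ.retraction

        G : Extension M N
        G = twistedExtension M N δ′

      pull-surjective : Surjective (_≋_ {M} {N}) (_≋_ {M₁} {N}) (pull {M} {M₁} {N} i)
      pull-surjective = strictly⇒surjective {M = ext¹ M N} {N = ext¹ M₁ N}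
        (record { isLeftModuleHomomorphism = pull-homo {M} {M₁} {N} i }) pull-preimage

theorem11p5 : ∀ {f ℓf ℓf′ k ℓk ℓk′ m : Level}
    (𝒦 : PerfectAField f ℓf ℓf′ k ℓk ℓk′)
    (let open DualMotiveExt 𝒦 m)
    {M₁ M M₂ : DualMotive} (i : Hom M₁ M) (π : Hom M M₂) (exact : ShortExact i π)
    (N : DualMotive) →
    let E = extension {M₁} {M} {M₂} i π exact in
    ExactSequence₆
    (homModule N M₁) (homModule N M) (homModule N M₂) (ext¹ N M₁) (ext¹ N M) (ext¹ N M₂)
    (i ∘ᴹ_) (π ∘ᴹ_) (λ h → pull {M₂} {N} {M₁} h E) (push {N} {M₁} {M} i) (push {N} {M} {M₂} π)
    ×
    ExactSequence₆
    (homModule M₂ N) (homModule M N) (homModule M₁ N) (ext¹ M₂ N) (ext¹ M N) (ext¹ M₁ N)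
    (_∘ᴹ π) (_∘ᴹ i) (λ h → push {M₂} {M₁} {N} h E) (pull {M₂} {M} {N} π) (pull {M} {M₁} {N} i)
-- The record fields are given one by one because comparing the two copies of ext¹ as module bundles,
-- proofs of the module axioms included, is infeasible over the concrete ring K[t,σ].
theorem11p5 {m = m} 𝒦 {M₁} {M} {M₂} i π exact N =
  record
    { α-homo = postcompose-homo {N} {M₁} {M} i
    ; β-homo = postcompose-homo {N} {M} {M₂} π
    ; γ-homo = connecting-pull-homo {M₂} {N} {M₁} E
    ; δ-homo = push-homo {N} {M₁} {M} i
    ; ε-homo = push-homo {N} {M} {M₂} π
    ; α-injective = λ {u} {v} → postcompose-injective {M₁} {M} {M₂} i π exact N {u} {v}
    ; exact-B = exact-Hom-covariant {M₁} {M} {M₂} i π exact N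
    ; exact-C = exact-connecting-pull {M₁} {M} {M₂} i π exact N
    ; exact-D = exact-Ext-kernel-push {M₁} {M} {M₂} i π exact N
    ; exact-E = exact-Ext-push {M₁} {M} {M₂} i π exact N
    ; ε-surjective = push-surjective {M₁} {M} {M₂} i π exact N
    } ,
  record
    { α-homo = precompose-homo {M} {M₂} {N} π
    ; β-homo = precompose-homo {M₁} {M} {N} i
    ; γ-homo = connecting-push-homo {M₂} {M₁} {N} E
    ; δ-homo = pull-homo {M₂} {M} {N} π
    ; ε-homo = pull-homo {M} {M₁} {N} i
    ; α-injective = λ {u} {v} → precompose-injective {M₁} {M} {M₂} i π exact N {u} {v}
    ; exact-B = exact-Hom-contravariant {M₁} {M} {M₂} i π exact N
    ; exact-C = exact-connecting-push {M₁} {M} {M₂} i π exact N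
    ; exact-D = exact-Ext-kernel-pull {M₁} {M} {M₂} i π exact N
    ; exact-E = exact-Ext-pull {M₁} {M} {M₂} i π exact N
    ; ε-surjective = pull-surjective {M₁} {M} {M₂} i π exact N
    }
  where
  open PerfectAField 𝒦 using (A)
  open DualMotives 𝒦
  open YonedaExactness {A = A} {R = K[t,σ]} fromA fromA-central (IsDualMotive {m} {m}) isDualMotive-extension
  -- `K[t,σ]` is by construction the polynomial ring over `K⟨σ⟩` with the identity automorphism, and
  -- `forget` is the restriction along `fromK⟨σ⟩`, so `IsDualMotive.free` is literally the freeness
  -- that is required.
  open PolynomialModules K⟨σ⟩ using (module FreeExtensions)
  open FreeExtensions {A = A} fromA fromA-central (IsDualMotive {m} {m}) isDualMotive-extension IsDualMotive.free

  E : DualMotiveExt.Extension 𝒦 m M₂ M₁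
  E = DualMotiveExt.extension 𝒦 m {M₁} {M} {M₂} i π exact
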